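{- Let $\mu$ be a strict partition that is not of the form $(k+1,k,\ldots,2,1)$, written as $$\mu=(k+1,k,k-1,\ldots,k-\ell+1,a_0,a_1,\ldots)$$ with $k\ge1$, $\ell\ge0$ and $k-\ell>a_0\ge0$ (so $k-\ell$ is the largest positive integer below $\mu_1=k+1$ that is not a part of $\mu$, and $a_0\ge a_1\ge\cdots$ are the remaining parts). Then $$|\mathrm{Av}_n(\mu)|=\frac{n^{k-1}\log^\ell n}{\ell!\,(k-1)!\prod_{j=0}^{k-\ell-1}\bigl(k-\ell-a_j-j\bigr)}\left(1+O\!\left(\frac1{\log n}\right)\right).$$
   Context: A partition is a weakly decreasing sequence of nonnegative integers with finitely many nonzero parts, identified with its Ferrers board. $\alpha$ contains $\mu$ if one can delete some rows and some columns of the Ferrers board of $\alpha$ so that after top/left-justifying one obtains $\mu$; otherwise $\alpha$ avoids $\mu$. $\mathrm{Av}_n(\mu)$ is the set of partitions of weight $n$ avoiding $\mu$. Strict: positive parts distinct. Implied constants may depend on $\mu$. -}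

module Defs where

open import Data.Bool.Base using (if_then_else_)
open import Data.Fin.Subset using (Subset)
open import Data.Fin.Subset.Properties using (anySubset?)
open import Data.Integer.Base as ℤ using (+_)
import Data.Integer.Properties as ℤ
open import Data.List.Base
  using (List; []; _∷_; length; map; filter; concatMap; upTo; deduplicate)
open import Data.List.Membership.Propositional using (_∈_)
open import Data.Nat.ListAction using (sum)
open import Data.List.Membership.Propositional.Properties
  using (∈-filter⁺; ∈-filter⁻; ∈-deduplicate⁺; ∈-deduplicate⁻; ∈-map⁺; ∈-concatMap⁺; ∈-upTo⁺)
import Data.List.Properties as List
open import Data.List.Relation.Unary.All as All using (All; []; _∷_)
import Data.List.Relation.Unary.Any as Any
open import Data.List.Relation.Unary.Any using (here; there)
open import Data.List.Relation.Unary.AllPairs using ([]; _∷_)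
open import Data.List.Relation.Unary.Linked as Linked using (Linked; []; [-]; _∷_)
open import Data.List.Relation.Unary.Unique.Propositional using (Unique)
open import Data.List.Relation.Unary.Unique.DecPropositional.Properties using (deduplicate-!)
open import Data.Nat.Base as ℕ using (ℕ; zero; suc; NonZero; _∸_; _!)
import Data.Nat.Properties as ℕ
open import Data.Product.Base using (∃-syntax; _×_; _,_; proj₁; proj₂)
open import Data.Rational.Base as ℚ using (ℚ; 0ℚ; 1ℚ; _/_)
import Data.Rational.Properties as ℚ
open import Data.Rational.Solver using (module +-*-Solver)
import Data.Rational.Unnormalised.Base as ℚᵘ
import Data.Rational.Unnormalised.Properties as ℚᵘ
open import Data.Sum.Base using (_⊎_; inj₁; inj₂)
open import Data.Vec.Base using ([]; _∷_)
open import Function.Bundles using (_⇔_; mk⇔)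
open import Relation.Binary.Definitions using (DecidableEquality)
open import Relation.Binary.PropositionalEquality
  using (_≡_; refl; sym; trans; cong; cong₂; subst; subst₂; module ≡-Reasoning)
open import Relation.Nullary using (¬_; Dec; yes; no; contradiction; ¬?)
open import Relation.Nullary.Decidable as Dec using (_×-dec_)
open import Relation.Unary using (Pred; Decidable)
open import Level using (0ℓ)

-- The finitely many positive parts are listed; `part` pads them with zeros
-- to a weakly decreasing infinite sequence.

record Partition : Set where
  constructor mkPartition
  field
    parts      : List ℕ
    decreasing : Linked ℕ._≥_ parts
    positive   : All (0 ℕ.<_) parts

open Partition public

entry : List ℕ → ℕ → ℕ
entry []       _       = 0
entry (x ∷ xs) zero    = x
entry (x ∷ xs) (suc i) = entry xs i

part : Partition → ℕ → ℕ
part α = entry (parts α)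

weight : Partition → ℕ
weight α = sum (parts α)

Strict : Partition → Set
Strict α = Unique (parts α)

-- α = (k+1, k, …, 2, 1) for some k ≥ 0.
IsStaircase : Partition → Set
IsStaircase α = ∃[ k ] (∀ i → part α i ≡ suc k ∸ i)

keepRows : (rows : List ℕ) → Subset (length rows) → List ℕ
keepRows []       []      = []
keepRows (x ∷ xs) (r ∷ R) = if r then x ∷ keepRows xs R else keepRows xs R

-- A left-justified row of m cells occupies columns 0, …, m-1; the number of
-- these that belong to C is its length once the other columns are deleted.
keepColumns : ∀ {w} → Subset w → ℕ → ℕ
keepColumns []      _       = 0
keepColumns (c ∷ C) zero    = 0
keepColumns (c ∷ C) (suc m) = if c then suc (keepColumns C m) else keepColumns C m

-- R and C are the rows and columns of the Ferrers board of α that are kept;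
-- the board has `part α 0` columns.  Rows left without cells are dropped.
deleteLines : (α : Partition) → Subset (length (parts α)) → Subset (part α 0) → List ℕ
deleteLines α R C = filter (0 ℕ.<?_) (map (keepColumns C) (keepRows (parts α) R))

Contains : Partition → Partition → Set
Contains α μ = ∃[ R ] ∃[ C ] deleteLines α R C ≡ parts μ

Av : Partition → ℕ → Pred Partition 0ℓ
Av μ n α = weight α ≡ n × ¬ Contains α μ

record Enumeration (P : Pred Partition 0ℓ) : Set where
  field
    elements : List Partition
    unique   : Unique elements
    exact    : ∀ α → α ∈ elements ⇔ P α

parts-injective : ∀ {α β} → parts α ≡ parts β → α ≡ β
parts-injective {mkPartition xs d p} {mkPartition _ e q} refl =
  cong₂ (mkPartition xs) (Linked.irrelevant ℕ.≤-irrelevant d e)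
                         (All.irrelevant ℕ.<-irrelevant p q)

_≟ᴾ_ : DecidableEquality Partition
α ≟ᴾ β = Dec.map′ parts-injective (cong parts)
                  (List.≡-dec ℕ._≟_ (parts α) (parts β))

contains? : ∀ α μ → Dec (Contains α μ)
contains? α μ = anySubset? λ R → anySubset? λ C →
  List.≡-dec ℕ._≟_ (deleteLines α R C) (parts μ)

Av? : ∀ μ n → Decidable (Av μ n)
Av? μ n α = (weight α ℕ.≟ n) ×-dec ¬? (contains? α μ)

private
  words : ℕ → ℕ → List (List ℕ)
  words b zero    = [] ∷ []
  words b (suc f) = [] ∷ concatMap (λ p → map (p ∷_) (words b f)) (upTo b)

  []∈words : ∀ b f → [] ∈ words b f
  []∈words b zero    = here refl
  []∈words b (suc f) = here refl

  ∈-words : ∀ {b} f xs → length xs ℕ.≤ f → All (ℕ._< b) xs → xs ∈ words b f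
  ∈-words {b} f   []       _           _          = []∈words b f
  ∈-words (suc f) (x ∷ xs) (ℕ.s≤s len) (x<b ∷ xs<b) =
    there (∈-concatMap⁺ (λ p → map (p ∷_) (words _ f))
      (Any.map (λ { refl → ∈-map⁺ (x ∷_) (∈-words f xs len xs<b) }) (∈-upTo⁺ x<b)))

  length≤sum : ∀ {xs} → All (0 ℕ.<_) xs → length xs ℕ.≤ sum xs
  length≤sum []       = ℕ.z≤n
  length≤sum (p ∷ ps) = ℕ.+-mono-≤ p (length≤sum ps)

  entries≤sum : ∀ xs → All (ℕ._≤ sum xs) xs
  entries≤sum []       = []
  entries≤sum (x ∷ xs) =
    ℕ.m≤m+n x (sum xs) ∷ All.map (λ h → ℕ.≤-trans h (ℕ.m≤n+m (sum xs) x)) (entries≤sum xs)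

  toPartitions : List ℕ → List Partition
  toPartitions xs with Linked.linked? (λ x y → y ℕ.≤? x) xs | All.all? (0 ℕ.<?_) xs
  ... | yes d | yes p = mkPartition xs d p ∷ []
  ... | _     | _     = []

  ∈-toPartitions : ∀ α → α ∈ toPartitions (parts α)
  ∈-toPartitions α
    with Linked.linked? (λ x y → y ℕ.≤? x) (parts α) | All.all? (0 ℕ.<?_) (parts α)
  ... | yes d | yes p = here (parts-injective refl)
  ... | yes _ | no ¬p = contradiction (positive α) ¬p
  ... | no ¬d | _     = contradiction (decreasing α) ¬d

  candidates : ℕ → List Partition
  candidates n = concatMap toPartitions (words (suc n) n)

  ∈-candidates : ∀ α → α ∈ candidates (weight α)
  ∈-candidates α = ∈-concatMap⁺ toPartitions
    (Any.map (λ { refl → ∈-toPartitions α })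
      (∈-words (weight α) (parts α) (length≤sum (positive α))
        (All.map ℕ.s≤s (entries≤sum (parts α)))))

Av-enumeration : ∀ μ n → Enumeration (Av μ n)
Av-enumeration μ n = record
  { elements = deduplicate _≟ᴾ_ found
  ; unique   = deduplicate-! _≟ᴾ_ found
  ; exact    = λ α → mk⇔
      (λ α∈ → proj₂ (∈-filter⁻ (Av? μ n) {xs = candidates n} (∈-deduplicate⁻ _≟ᴾ_ found α∈)))
      (λ { (refl , avoids) →
             ∈-deduplicate⁺ _≟ᴾ_ (∈-filter⁺ (Av? μ n) (∈-candidates α) (refl , avoids)) })
  }
  where
  found : List Partition
  found = filter (Av? μ n) (candidates n)

∣Av∣ : Partition → ℕ → ℕ
∣Av∣ μ n = length (Enumeration.elements (Av-enumeration μ n))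

-- μ = (k+1, k, …, k-ℓ+1, a₀, a₁, …) with k ≥ 1 and k-ℓ > a₀ ≥ 0.  The last
-- condition forces ℓ < k, so no subtraction below is truncated.
record HasForm (μ : Partition) (k ℓ : ℕ) (a : ℕ → ℕ) : Set where
  field
    k≥1       : k ℕ.≥ 1
    leading   : ∀ i → i ℕ.≤ ℓ → part μ i ≡ suc k ∸ i
    remaining : ∀ j → part μ (suc ℓ ℕ.+ j) ≡ a j
    gap       : k ∸ ℓ ℕ.> a 0

∏[_] : ℕ → (ℕ → ℕ) → ℕ
∏[ zero  ] f = 1
∏[ suc n ] f = ∏[ n ] f ℕ.* f n

-- For μ strict of the form above, every factor k-ℓ-aⱼ-j is positive, so
-- truncated subtraction agrees with subtraction of integers
-- (`factor-positive`).
denominator : ℕ → ℕ → (ℕ → ℕ) → ℕ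
denominator k ℓ a = ℓ ! ℕ.* (k ∸ 1) ! ℕ.* ∏[ k ∸ ℓ ] (λ j → k ∸ ℓ ∸ a j ∸ j)

private
  strict-step : ∀ xs → Linked ℕ._≥_ xs → Unique xs → ∀ i →
                entry xs (suc i) ≡ 0 ⊎ entry xs (suc i) ℕ.< entry xs i
  strict-step []           _       _                i       = inj₁ refl
  strict-step (x ∷ [])     _       _                i       = inj₁ refl
  strict-step (x ∷ y ∷ xs) (h ∷ _) ((x≢y ∷ _) ∷ _) zero    =
    inj₂ (ℕ.≤∧≢⇒< h (λ y≡x → x≢y (sym y≡x)))
  strict-step (x ∷ y ∷ xs) (_ ∷ l) (_ ∷ u)         (suc i) = strict-step (y ∷ xs) l u i

module _ {μ k ℓ a} (strict : Strict μ) (form : HasForm μ k ℓ a) where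
  open HasForm form

  private
    a-step : ∀ j → a (suc j) ≡ 0 ⊎ a (suc j) ℕ.< a j
    a-step j rewrite sym (remaining (suc j)) | sym (remaining j) | ℕ.+-suc ℓ j =
      strict-step (parts μ) (decreasing μ) strict (suc ℓ ℕ.+ j)

    a-bound : ∀ j → a j ≡ 0 ⊎ a j ℕ.+ j ℕ.< k ∸ ℓ
    a-bound zero    = inj₂ (subst (ℕ._< k ∸ ℓ) (sym (ℕ.+-identityʳ (a 0))) gap)
    a-bound (suc j) with a-step j
    ... | inj₁ z = inj₁ z
    ... | inj₂ h with a-bound j
    ...   | inj₁ z = contradiction (subst (a (suc j) ℕ.<_) z h) ℕ.n≮0
    ...   | inj₂ b = inj₂ (ℕ.≤-<-trans
                       (subst (ℕ._≤ a j ℕ.+ j) (sym (ℕ.+-suc (a (suc j)) j)) (ℕ.+-monoˡ-≤ j h)) b)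

  factor-positive : ∀ j → j ℕ.< k ∸ ℓ → a j ℕ.+ j ℕ.< k ∸ ℓ
  factor-positive j j<c with a-bound j
  ... | inj₁ z = subst (λ x → x ℕ.+ j ℕ.< k ∸ ℓ) (sym z) j<c
  ... | inj₂ b = b

  private
    ∏-nonZero : ∀ n (f : ℕ → ℕ) → (∀ j → j ℕ.< n → NonZero (f j)) → NonZero (∏[ n ] f)
    ∏-nonZero zero    f h = _
    ∏-nonZero (suc n) f h =
      ℕ.m*n≢0 _ _ {{∏-nonZero n f (λ j lt → h j (ℕ.m<n⇒m<1+n lt))}} {{h n ℕ.≤-refl}}

  denominator-nonZero : NonZero (denominator k ℓ a)
  denominator-nonZero =
    ℕ.m*n≢0 _ _ {{ℕ.m*n≢0 _ _ {{ℕ._!≢0 ℓ}} {{ℕ._!≢0 (k ∸ 1)}}}}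
                {{∏-nonZero (k ∸ ℓ) _ λ j lt → ℕ.>-nonZero
                    (subst (0 ℕ.<_) (sym (ℕ.∸-+-assoc (k ∸ ℓ) (a j) j))
                      (ℕ.m<n⇒0<n∸m (factor-positive j lt)))}}

Cauchy : (ℕ → ℚ) → Set
Cauchy x = ∀ ε → 0ℚ ℚ.< ε →
  ∃[ N ] (∀ m n → N ℕ.≤ m → N ℕ.≤ n → ℚ.∣ x m ℚ.- x n ∣ ℚ.≤ ε)

record ℝ : Set where
  constructor mkℝ
  field
    approx : ℕ → ℚ
    cauchy : Cauchy approx

open ℝ public

-- Comparison of the limits.
infix 4 _≤_

_≤_ : ℝ → ℝ → Set
x ≤ y = ∀ ε → 0ℚ ℚ.< ε →
  ∃[ N ] (∀ n → N ℕ.≤ n → approx x n ℚ.≤ approx y n ℚ.+ ε)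

private
  half : ∀ ε → 0ℚ ℚ.< ε → ∃[ δ ] (0ℚ ℚ.< δ × δ ℚ.+ δ ≡ ε)
  half ε ε>0 = ε ℚ.* ℚ.½ ,
    subst (ℚ._< ε ℚ.* ℚ.½) (ℚ.*-zeroˡ ℚ.½) (ℚ.*-monoˡ-<-pos ℚ.½ ε>0) ,
    trans (sym (ℚ.*-distribˡ-+ ε ℚ.½ ℚ.½)) (ℚ.*-identityʳ ε)

  +-cauchy : ∀ {x y} → Cauchy x → Cauchy y → Cauchy (λ n → x n ℚ.+ y n)
  +-cauchy {x} {y} cx cy ε ε>0 with half ε ε>0
  ... | δ , δ>0 , δ+δ≡ε with cx δ δ>0 | cy δ δ>0
  ...   | M , hx | N , hy = M ℕ.⊔ N , λ m n hm hn → begin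
    ℚ.∣ x m ℚ.+ y m ℚ.- (x n ℚ.+ y n) ∣
      ≡⟨ cong ℚ.∣_∣ (rearrange (x m) (y m) (x n) (y n)) ⟩
    ℚ.∣ (x m ℚ.- x n) ℚ.+ (y m ℚ.- y n) ∣
      ≤⟨ ℚ.∣p+q∣≤∣p∣+∣q∣ (x m ℚ.- x n) (y m ℚ.- y n) ⟩
    ℚ.∣ x m ℚ.- x n ∣ ℚ.+ ℚ.∣ y m ℚ.- y n ∣
      ≤⟨ ℚ.+-mono-≤ (hx m n (ℕ.m⊔n≤o⇒m≤o M N hm) (ℕ.m⊔n≤o⇒m≤o M N hn))
                    (hy m n (ℕ.m⊔n≤o⇒n≤o M N hm) (ℕ.m⊔n≤o⇒n≤o M N hn)) ⟩
    δ ℚ.+ δ ≡⟨ δ+δ≡ε ⟩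
    ε ∎
    where
    open ℚ.≤-Reasoning
    open +-*-Solver
    rearrange : ∀ a b c d → a ℚ.+ b ℚ.- (c ℚ.+ d) ≡ (a ℚ.- c) ℚ.+ (b ℚ.- d)
    rearrange = solve 4 (λ a b c d → a :+ b :- (c :+ d) := (a :- c) :+ (b :- d)) refl

  neg-cauchy : ∀ {x} → Cauchy x → Cauchy (λ n → ℚ.- x n)
  neg-cauchy {x} cx ε ε>0 with cx ε ε>0
  ... | N , h = N , λ m n hm hn → subst (ℚ._≤ ε)
    (trans (sym (ℚ.∣-p∣≡∣p∣ (x m ℚ.- x n))) (cong ℚ.∣_∣ (ℚ.neg-distrib-+ (x m) (ℚ.- x n))))
    (h m n hm hn)

  ∣∣-cauchy : ∀ {x} → Cauchy x → Cauchy (λ n → ℚ.∣ x n ∣)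
  ∣∣-cauchy {x} cx ε ε>0 with cx ε ε>0
  ... | N , h = N , λ m n hm hn → ℚ.≤-trans (reverse-triangle (x m) (x n)) (h m n hm hn)
    where
    open +-*-Solver
    one-sided : ∀ p q → ℚ.∣ p ∣ ℚ.- ℚ.∣ q ∣ ℚ.≤ ℚ.∣ p ℚ.- q ∣
    one-sided p q = begin
      ℚ.∣ p ∣ ℚ.- ℚ.∣ q ∣
        ≡⟨ cong (λ r → ℚ.∣ r ∣ ℚ.- ℚ.∣ q ∣) (solve 2 (λ a b → a := (a :- b) :+ b) refl p q) ⟩
      ℚ.∣ (p ℚ.- q) ℚ.+ q ∣ ℚ.- ℚ.∣ q ∣
        ≤⟨ ℚ.+-monoˡ-≤ (ℚ.- ℚ.∣ q ∣) (ℚ.∣p+q∣≤∣p∣+∣q∣ (p ℚ.- q) q) ⟩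
      ℚ.∣ p ℚ.- q ∣ ℚ.+ ℚ.∣ q ∣ ℚ.- ℚ.∣ q ∣
        ≡⟨ solve 2 (λ a b → a :+ b :- b := a) refl ℚ.∣ p ℚ.- q ∣ ℚ.∣ q ∣ ⟩
      ℚ.∣ p ℚ.- q ∣ ∎
      where open ℚ.≤-Reasoning
    swap : ∀ p q → ℚ.- (p ℚ.- q) ≡ q ℚ.- p
    swap = solve 2 (λ a b → :- (a :- b) := b :- a) refl
    reverse-triangle : ∀ p q → ℚ.∣ ℚ.∣ p ∣ ℚ.- ℚ.∣ q ∣ ∣ ℚ.≤ ℚ.∣ p ℚ.- q ∣
    reverse-triangle p q with ℚ.∣p∣≡p∨∣p∣≡-p (ℚ.∣ p ∣ ℚ.- ℚ.∣ q ∣)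
    ... | inj₁ e = subst (ℚ._≤ ℚ.∣ p ℚ.- q ∣) (sym e) (one-sided p q)
    ... | inj₂ e = subst₂ ℚ._≤_
      (sym (trans e (swap ℚ.∣ p ∣ ℚ.∣ q ∣)))
      (trans (cong ℚ.∣_∣ (sym (swap p q))) (ℚ.∣-p∣≡∣p∣ (p ℚ.- q)))
      (one-sided q p)

  eventually-bounded : ∀ {x} → Cauchy x →
    ∃[ B ] ∃[ N ] (ℚ.Positive B × (∀ n → N ℕ.≤ n → ℚ.∣ x n ∣ ℚ.≤ B))
  eventually-bounded {x} cx with cx 1ℚ (ℚ.positive⁻¹ 1ℚ)
  ... | N , h = 1ℚ ℚ.+ ℚ.∣ x N ∣ , N ,
    ℚ.pos+nonNeg⇒pos 1ℚ ℚ.∣ x N ∣ {{ℚ.∣-∣-nonNeg (x N)}} , λ n hn → begin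
      ℚ.∣ x n ∣                          ≡⟨ cong ℚ.∣_∣ (split (x n) (x N)) ⟩
      ℚ.∣ (x n ℚ.- x N) ℚ.+ x N ∣        ≤⟨ ℚ.∣p+q∣≤∣p∣+∣q∣ (x n ℚ.- x N) (x N) ⟩
      ℚ.∣ x n ℚ.- x N ∣ ℚ.+ ℚ.∣ x N ∣    ≤⟨ ℚ.+-monoˡ-≤ ℚ.∣ x N ∣ (h n N hn ℕ.≤-refl) ⟩
      1ℚ ℚ.+ ℚ.∣ x N ∣                   ∎
    where
    open ℚ.≤-Reasoning
    open +-*-Solver
    split : ∀ a b → a ≡ (a ℚ.- b) ℚ.+ b
    split = solve 2 (λ a b → a := (a :- b) :+ b) refl

  *-mono-bound : ∀ {p q b d} → ℚ.∣ p ∣ ℚ.≤ b → ℚ.∣ q ∣ ℚ.≤ d → ℚ.Positive b →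
                 ℚ.∣ p ℚ.* q ∣ ℚ.≤ b ℚ.* d
  *-mono-bound {p} {q} {b} {d} p≤b q≤d b>0 = begin
    ℚ.∣ p ℚ.* q ∣          ≡⟨ ℚ.∣p*q∣≡∣p∣*∣q∣ p q ⟩
    ℚ.∣ p ∣ ℚ.* ℚ.∣ q ∣    ≤⟨ ℚ.*-monoʳ-≤-nonNeg ℚ.∣ q ∣ {{ℚ.∣-∣-nonNeg q}} p≤b ⟩
    b ℚ.* ℚ.∣ q ∣          ≤⟨ ℚ.*-monoˡ-≤-nonNeg b {{ℚ.pos⇒nonNeg b {{b>0}}}} q≤d ⟩
    b ℚ.* d                ∎
    where open ℚ.≤-Reasoning

  weighted-half : ∀ B C ε → ℚ.Positive B → ℚ.Positive C → 0ℚ ℚ.< ε →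
                  ∃[ δ ] (0ℚ ℚ.< δ × B ℚ.* δ ℚ.+ C ℚ.* δ ≡ ε)
  weighted-half B C ε B>0 C>0 ε>0 = divide (B ℚ.+ C) (ℚ.pos+pos⇒pos B {{B>0}} C {{C>0}}) refl
    where
    divide : ∀ S → ℚ.Positive S → B ℚ.+ C ≡ S → ∃[ δ ] (0ℚ ℚ.< δ × B ℚ.* δ ℚ.+ C ℚ.* δ ≡ ε)
    divide S S>0 eq = S⁻¹ ℚ.* ε , ℚ.positive⁻¹ (S⁻¹ ℚ.* ε) {{δ>0}} , (begin
      B ℚ.* (S⁻¹ ℚ.* ε) ℚ.+ C ℚ.* (S⁻¹ ℚ.* ε) ≡⟨ ℚ.*-distribʳ-+ (S⁻¹ ℚ.* ε) B C ⟨
      (B ℚ.+ C) ℚ.* (S⁻¹ ℚ.* ε)               ≡⟨ cong (ℚ._* (S⁻¹ ℚ.* ε)) eq ⟩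
      S ℚ.* (S⁻¹ ℚ.* ε)                       ≡⟨ ℚ.*-assoc S S⁻¹ ε ⟨
      S ℚ.* S⁻¹ ℚ.* ε                         ≡⟨ cong (ℚ._* ε) (ℚ.*-inverseʳ S {{S≢0}}) ⟩
      1ℚ ℚ.* ε                                ≡⟨ ℚ.*-identityˡ ε ⟩
      ε                                       ∎)
      where
      open ≡-Reasoning
      S≢0 : ℚ.NonZero S
      S≢0 = ℚ.pos⇒nonZero S {{S>0}}
      S⁻¹ : ℚ
      S⁻¹ = (ℚ.1/ S) {{S≢0}}
      δ>0 : ℚ.Positive (S⁻¹ ℚ.* ε)
      δ>0 = ℚ.pos*pos⇒pos S⁻¹ {{ℚ.1/pos⇒pos S {{S>0}}}} ε {{ℚ.positive ε>0}}

  product-bound : ∀ {B C δ} a b c d → ℚ.Positive B → ℚ.Positive C →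
                  ℚ.∣ a ∣ ℚ.≤ B → ℚ.∣ d ∣ ℚ.≤ C →
                  ℚ.∣ a ℚ.- c ∣ ℚ.≤ δ → ℚ.∣ b ℚ.- d ∣ ℚ.≤ δ →
                  ℚ.∣ a ℚ.* b ℚ.- c ℚ.* d ∣ ℚ.≤ B ℚ.* δ ℚ.+ C ℚ.* δ
  product-bound {B} {C} {δ} a b c d B>0 C>0 a≤B d≤C ac bd = begin
    ℚ.∣ a ℚ.* b ℚ.- c ℚ.* d ∣
      ≡⟨ cong ℚ.∣_∣ (rearrange a b c d) ⟩
    ℚ.∣ a ℚ.* (b ℚ.- d) ℚ.+ d ℚ.* (a ℚ.- c) ∣
      ≤⟨ ℚ.∣p+q∣≤∣p∣+∣q∣ (a ℚ.* (b ℚ.- d)) (d ℚ.* (a ℚ.- c)) ⟩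
    ℚ.∣ a ℚ.* (b ℚ.- d) ∣ ℚ.+ ℚ.∣ d ℚ.* (a ℚ.- c) ∣
      ≤⟨ ℚ.+-mono-≤ (*-mono-bound {a} {b ℚ.- d} a≤B bd B>0)
                    (*-mono-bound {d} {a ℚ.- c} d≤C ac C>0) ⟩
    B ℚ.* δ ℚ.+ C ℚ.* δ ∎
    where
    open ℚ.≤-Reasoning
    open +-*-Solver
    rearrange : ∀ a b c d → a ℚ.* b ℚ.- c ℚ.* d ≡ a ℚ.* (b ℚ.- d) ℚ.+ d ℚ.* (a ℚ.- c)
    rearrange = solve 4 (λ a b c d → a :* b :- c :* d := a :* (b :- d) :+ d :* (a :- c)) refl

  *-cauchy : ∀ {x y} → Cauchy x → Cauchy y → Cauchy (λ n → x n ℚ.* y n)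
  *-cauchy {x} {y} cx cy ε ε>0 =
    let B , M₀ , B>0 , hB = eventually-bounded cx
        C , N₀ , C>0 , hC = eventually-bounded cy
        δ , δ>0 , eq      = weighted-half B C ε B>0 C>0 ε>0
        M₁ , hx           = cx δ δ>0
        N₁ , hy           = cy δ δ>0
        M≤ : ∀ {i} → (M₀ ℕ.⊔ N₀) ℕ.⊔ (M₁ ℕ.⊔ N₁) ℕ.≤ i → M₀ ℕ.⊔ N₀ ℕ.≤ i
        M≤ = ℕ.m⊔n≤o⇒m≤o (M₀ ℕ.⊔ N₀) (M₁ ℕ.⊔ N₁)
        N≤ : ∀ {i} → (M₀ ℕ.⊔ N₀) ℕ.⊔ (M₁ ℕ.⊔ N₁) ℕ.≤ i → M₁ ℕ.⊔ N₁ ℕ.≤ i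
        N≤ = ℕ.m⊔n≤o⇒n≤o (M₀ ℕ.⊔ N₀) (M₁ ℕ.⊔ N₁)
    in (M₀ ℕ.⊔ N₀) ℕ.⊔ (M₁ ℕ.⊔ N₁) , λ m n hm hn →
      subst (ℚ.∣ x m ℚ.* y m ℚ.- x n ℚ.* y n ∣ ℚ.≤_) eq
        (product-bound (x m) (y m) (x n) (y n) B>0 C>0
          (hB m (ℕ.m⊔n≤o⇒m≤o M₀ N₀ (M≤ hm)))
          (hC n (ℕ.m⊔n≤o⇒n≤o M₀ N₀ (M≤ hn)))
          (hx m n (ℕ.m⊔n≤o⇒m≤o M₁ N₁ (N≤ hm)) (ℕ.m⊔n≤o⇒m≤o M₁ N₁ (N≤ hn)))
          (hy m n (ℕ.m⊔n≤o⇒n≤o M₁ N₁ (N≤ hm)) (ℕ.m⊔n≤o⇒n≤o M₁ N₁ (N≤ hn))))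

infixl 7 _*_
infixl 6 _+_ _-_
infixr 8 _^_

fromℚ : ℚ → ℝ
fromℚ q = mkℝ (λ _ → q) λ ε ε>0 →
  0 , λ _ _ _ _ → subst (λ r → ℚ.∣ r ∣ ℚ.≤ ε) (sym (ℚ.+-inverseʳ q)) (ℚ.<⇒≤ ε>0)

fromℕ : ℕ → ℝ
fromℕ n = fromℚ (+ n / 1)

_+_ : ℝ → ℝ → ℝ
x + y = mkℝ (λ n → approx x n ℚ.+ approx y n) (+-cauchy {approx x} {approx y} (cauchy x) (cauchy y))

-_ : ℝ → ℝ
- x = mkℝ (λ n → ℚ.- approx x n) (neg-cauchy {approx x} (cauchy x))

_-_ : ℝ → ℝ → ℝ
x - y = x + (- y)

_*_ : ℝ → ℝ → ℝ
x * y = mkℝ (λ n → approx x n ℚ.* approx y n) (*-cauchy {approx x} {approx y} (cauchy x) (cauchy y))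

_^_ : ℝ → ℕ → ℝ
x ^ zero  = fromℚ 1ℚ
x ^ suc n = x * x ^ n

∣_∣ : ℝ → ℝ
∣ x ∣ = mkℝ (λ n → ℚ.∣ approx x n ∣) (∣∣-cauchy {approx x} (cauchy x))

private
  fromℚᵘ-mono-≤ : ∀ {p q} → p ℚᵘ.≤ q → ℚ.fromℚᵘ p ℚ.≤ ℚ.fromℚᵘ q
  fromℚᵘ-mono-≤ {p} {q} p≤q = ℚ.toℚᵘ-cancel-≤
    (ℚᵘ.≤-respˡ-≃ (ℚᵘ.≃-sym (ℚ.toℚᵘ-fromℚᵘ p)) (ℚᵘ.≤-respʳ-≃ (ℚᵘ.≃-sym (ℚ.toℚᵘ-fromℚᵘ q)) p≤q))

  fromℚᵘ-* : ∀ p q → ℚ.toℚᵘ (ℚ.fromℚᵘ p ℚ.* ℚ.fromℚᵘ q) ℚᵘ.≃ p ℚᵘ.* q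
  fromℚᵘ-* p q = ℚᵘ.≃-trans (ℚ.toℚᵘ-homo-* (ℚ.fromℚᵘ p) (ℚ.fromℚᵘ q))
    (ℚᵘ.*-cong (ℚ.toℚᵘ-fromℚᵘ p) (ℚ.toℚᵘ-fromℚᵘ q))

  1/-antimono : ∀ {m n} → m ℕ.≤ n → + 1 / suc n ℚ.≤ + 1 / suc m
  1/-antimono {m} {n} m≤n = fromℚᵘ-mono-≤ {ℚᵘ.mkℚᵘ (+ 1) n} {ℚᵘ.mkℚᵘ (+ 1) m}
    (ℚᵘ.*≤* (ℤ.*-monoˡ-≤-nonNeg (+ 1) (ℤ.+≤+ (ℕ.s≤s m≤n))))

  1/-nonNeg : ∀ m → 0ℚ ℚ.≤ + 1 / suc m
  1/-nonNeg m = fromℚᵘ-mono-≤ {ℚᵘ.mkℚᵘ (+ 0) 0} {ℚᵘ.mkℚᵘ (+ 1) m} (ℚᵘ.*≤* (ℤ.+≤+ ℕ.z≤n))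

  n*1/n≡1 : ∀ m → + suc m / 1 ℚ.* (+ 1 / suc m) ≡ 1ℚ
  n*1/n≡1 m = ℚ.toℚᵘ-injective (ℚᵘ.≃-trans (fromℚᵘ-* (ℚᵘ.mkℚᵘ (+ suc m) 0) (ℚᵘ.mkℚᵘ (+ 1) m))
    (ℚᵘ.*≡* (trans (ℤ.*-identityʳ (+ suc m ℤ.* + 1))
      (trans (ℤ.*-comm (+ suc m) (+ 1)) (cong (λ d → + 1 ℤ.* + suc d) (sym (ℕ.+-identityʳ m)))))))

  archimedean : ∀ n ε → 0ℚ ℚ.< ε → ∃[ N ] + 1 / suc N ℚ.* (+ n / 1) ℚ.≤ ε
  archimedean n (ℚ.mkℚ (+ 0)       d c) (ℚ.*<* (ℤ.+<+ ()))
  archimedean n (ℚ.mkℚ ℤ.-[1+ p ]  d c) (ℚ.*<* ())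
  archimedean n (ℚ.mkℚ ℤ.+[1+ p ]  d c) _ = n ℕ.* suc d , ℚ.toℚᵘ-cancel-≤
    (ℚᵘ.≤-respˡ-≃
      (ℚᵘ.≃-sym (fromℚᵘ-* (ℚᵘ.mkℚᵘ (+ 1) (n ℕ.* suc d)) (ℚᵘ.mkℚᵘ (+ n) 0)))
      (ℚᵘ.*≤* (subst₂ ℤ._≤_ (lhs n) (rhs (suc (n ℕ.* suc d)))
        (ℤ.+≤+ (ℕ.≤-trans (ℕ.n≤1+n (n ℕ.* suc d)) (ℕ.m≤n*m (suc (n ℕ.* suc d)) (suc p)))))))
    where
    lhs : ∀ n → + (n ℕ.* suc d) ≡ (+ 1 ℤ.* + n) ℤ.* + suc d
    lhs n = trans (ℤ.pos-* n (suc d)) (cong (ℤ._* + suc d) (sym (ℤ.*-identityˡ (+ n))))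
    rhs : ∀ m → + (suc p ℕ.* m) ≡ + suc p ℤ.* + (m ℕ.* 1)
    rhs m = trans (ℤ.pos-* (suc p) m) (cong (λ r → + suc p ℤ.* + r) (sym (ℕ.*-identityʳ m)))

  *-nonNeg : ∀ {p q} → 0ℚ ℚ.≤ p → 0ℚ ℚ.≤ q → 0ℚ ℚ.≤ p ℚ.* q
  *-nonNeg {p} {q} hp hq = ℚ.nonNegative⁻¹ _
    {{ℚ.nonNeg*nonNeg⇒nonNeg p {{ℚ.nonNegative hp}} q {{ℚ.nonNegative hq}}}}

  p≤p+q : ∀ p {q} → 0ℚ ℚ.≤ q → p ℚ.≤ p ℚ.+ q
  p≤p+q p hq = subst (ℚ._≤ p ℚ.+ _) (ℚ.+-identityʳ p) (ℚ.+-monoʳ-≤ p hq)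

  difference-≤ : ∀ {b e u v} → u ℚ.≤ b ℚ.+ e → b ℚ.≤ v → u ℚ.- v ℚ.≤ e
  difference-≤ {b} {e} {u} {v} hu hv = begin
    u ℚ.- v             ≤⟨ ℚ.+-mono-≤ hu (ℚ.neg-antimono-≤ hv) ⟩
    b ℚ.+ e ℚ.- b       ≡⟨ solve 2 (λ b e → b :+ e :- b := e) refl b e ⟩
    e                   ∎
    where
    open ℚ.≤-Reasoning
    open +-*-Solver

  within : ∀ {b e u v} → b ℚ.≤ u → u ℚ.≤ b ℚ.+ e → b ℚ.≤ v → v ℚ.≤ b ℚ.+ e →
           ℚ.∣ u ℚ.- v ∣ ℚ.≤ e
  within {b} {e} {u} {v} b≤u u≤ b≤v v≤ with ℚ.∣p∣≡p∨∣p∣≡-p (u ℚ.- v)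
  ... | inj₁ eq = subst (ℚ._≤ e) (sym eq) (difference-≤ u≤ b≤v)
  ... | inj₂ eq = subst (ℚ._≤ e) (sym (trans eq (swap u v))) (difference-≤ v≤ b≤u)
    where
    open +-*-Solver
    swap : ∀ p q → ℚ.- (p ℚ.- q) ≡ q ℚ.- p
    swap = solve 2 (λ a b → :- (a :- b) := b :- a) refl

power : ℚ → ℕ → ℚ
power x zero    = 1ℚ
power x (suc i) = x ℚ.* power x i

mercatorSum : ℚ → ℕ → ℚ
mercatorSum x zero    = 0ℚ
mercatorSum x (suc m) = mercatorSum x m ℚ.+ power x (suc m) ℚ.* (+ 1 / suc m)

module _ (x n : ℚ) (0≤x : 0ℚ ℚ.≤ x) (x≤1 : x ℚ.≤ 1ℚ) (0≤n : 0ℚ ℚ.≤ n)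
         (1+nx≡n : 1ℚ ℚ.+ n ℚ.* x ≡ n) where

  private
    power-nonNeg : ∀ i → 0ℚ ℚ.≤ power x i
    power-nonNeg zero    = ℚ.nonNegative⁻¹ 1ℚ
    power-nonNeg (suc i) = *-nonNeg 0≤x (power-nonNeg i)

    power≤1 : ∀ i → power x i ℚ.≤ 1ℚ
    power≤1 zero    = ℚ.≤-refl
    power≤1 (suc i) = begin
      x ℚ.* power x i  ≤⟨ ℚ.*-monoˡ-≤-nonNeg x {{ℚ.nonNegative 0≤x}} (power≤1 i) ⟩
      x ℚ.* 1ℚ         ≡⟨ ℚ.*-identityʳ x ⟩
      x                ≤⟨ x≤1 ⟩
      1ℚ               ∎
      where open ℚ.≤-Reasoning

    S : ℕ → ℚ
    S = mercatorSum x

    monotone : ∀ M d → S M ℚ.≤ S (d ℕ.+ M)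
    monotone M zero    = ℚ.≤-refl
    monotone M (suc d) = ℚ.≤-trans (monotone M d)
      (p≤p+q (S (d ℕ.+ M)) (*-nonNeg (power-nonNeg (suc (d ℕ.+ M))) (1/-nonNeg (d ℕ.+ M))))

    tail : ∀ M d → S (d ℕ.+ M) ℚ.+ (+ 1 / suc M) ℚ.* (n ℚ.* power x (suc (d ℕ.+ M)))
                   ℚ.≤ S M ℚ.+ (+ 1 / suc M) ℚ.* (n ℚ.* power x (suc M))
    tail M zero    = ℚ.≤-refl
    tail M (suc d) = ℚ.≤-trans (step (S (d ℕ.+ M)) (power x (suc (d ℕ.+ M)))
                                     (+ 1 / suc (d ℕ.+ M)) (+ 1 / suc M)
                                     (power-nonNeg (suc (d ℕ.+ M))) (1/-antimono (ℕ.m≤n+m M d)))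
                               (tail M d)
      where
      open +-*-Solver
      step : ∀ s p r c → 0ℚ ℚ.≤ p → r ℚ.≤ c →
             (s ℚ.+ p ℚ.* r) ℚ.+ c ℚ.* (n ℚ.* (x ℚ.* p)) ℚ.≤ s ℚ.+ c ℚ.* (n ℚ.* p)
      step s p r c 0≤p r≤c = begin
        (s ℚ.+ p ℚ.* r) ℚ.+ c ℚ.* (n ℚ.* (x ℚ.* p))
          ≤⟨ ℚ.+-monoˡ-≤ _ (ℚ.+-monoʳ-≤ s (ℚ.*-monoˡ-≤-nonNeg p {{ℚ.nonNegative 0≤p}} r≤c)) ⟩
        (s ℚ.+ p ℚ.* c) ℚ.+ c ℚ.* (n ℚ.* (x ℚ.* p))
          ≡⟨ solve 5 (λ s p c n x → (s :+ p :* c) :+ c :* (n :* (x :* p))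
                                 := s :+ c :* ((con 1ℚ :+ n :* x) :* p)) refl s p c n x ⟩
        s ℚ.+ c ℚ.* ((1ℚ ℚ.+ n ℚ.* x) ℚ.* p)
          ≡⟨ cong (λ y → s ℚ.+ c ℚ.* (y ℚ.* p)) 1+nx≡n ⟩
        s ℚ.+ c ℚ.* (n ℚ.* p) ∎
        where open ℚ.≤-Reasoning

    tail-≤ : ∀ M d → S (d ℕ.+ M) ℚ.≤ S M ℚ.+ (+ 1 / suc M) ℚ.* n
    tail-≤ M d = begin
      S (d ℕ.+ M)
        ≤⟨ p≤p+q _ (*-nonNeg (1/-nonNeg M) (*-nonNeg 0≤n (power-nonNeg (suc (d ℕ.+ M))))) ⟩
      S (d ℕ.+ M) ℚ.+ (+ 1 / suc M) ℚ.* (n ℚ.* power x (suc (d ℕ.+ M)))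
        ≤⟨ tail M d ⟩
      S M ℚ.+ (+ 1 / suc M) ℚ.* (n ℚ.* power x (suc M))
        ≤⟨ ℚ.+-monoʳ-≤ (S M) (ℚ.*-monoˡ-≤-nonNeg (+ 1 / suc M) {{ℚ.nonNegative (1/-nonNeg M)}}
             (ℚ.*-monoˡ-≤-nonNeg n {{ℚ.nonNegative 0≤n}} (power≤1 (suc M)))) ⟩
      S M ℚ.+ (+ 1 / suc M) ℚ.* (n ℚ.* 1ℚ)
        ≡⟨ cong (λ y → S M ℚ.+ (+ 1 / suc M) ℚ.* y) (ℚ.*-identityʳ n) ⟩
      S M ℚ.+ (+ 1 / suc M) ℚ.* n ∎
      where open ℚ.≤-Reasoning

  mercator-cauchy : (∀ ε → 0ℚ ℚ.< ε → ∃[ N ] + 1 / suc N ℚ.* n ℚ.≤ ε) →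
                    Cauchy (mercatorSum x)
  mercator-cauchy arch ε ε>0 =
    let N , h = arch ε ε>0
        lower : ∀ {m} → N ℕ.≤ m → S N ℚ.≤ S m
        lower {m} N≤m = subst (λ i → S N ℚ.≤ S i) (ℕ.m∸n+n≡m N≤m) (monotone N (m ∸ N))
        upper : ∀ {m} → N ℕ.≤ m → S m ℚ.≤ S N ℚ.+ (+ 1 / suc N) ℚ.* n
        upper {m} N≤m = subst (λ i → S i ℚ.≤ S N ℚ.+ (+ 1 / suc N) ℚ.* n)
                              (ℕ.m∸n+n≡m N≤m) (tail-≤ N (m ∸ N))
    in N , λ m m′ hm hm′ →
      ℚ.≤-trans (within (lower hm) (upper hm) (lower hm′) (upper hm′)) h

-- Mercator's series  -log (1 - x) = ∑_{i ≥ 1} xⁱ / i  (0 ≤ x < 1)  at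
-- x = 1 - 1/n, where the left-hand side is log n.
log : (n : ℕ) .{{_ : NonZero n}} → ℝ
log n@(suc m) = mkℝ (mercatorSum (1ℚ ℚ.- + 1 / n))
  (mercator-cauchy (1ℚ ℚ.- + 1 / n) (+ n / 1) 0≤x x≤1 0≤n 1+nx≡n (archimedean n))
  where
  r : ℚ
  r = + 1 / suc m
  0≤x : 0ℚ ℚ.≤ 1ℚ ℚ.- r
  0≤x = subst (ℚ._≤ 1ℚ ℚ.- r) (ℚ.+-inverseʳ r) (ℚ.+-monoˡ-≤ (ℚ.- r) (1/-antimono {0} {m} ℕ.z≤n))
  x≤1 : 1ℚ ℚ.- r ℚ.≤ 1ℚ
  x≤1 = ℚ.+-monoʳ-≤ 1ℚ (ℚ.neg-antimono-≤ {0ℚ} {r} (1/-nonNeg m))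
  0≤n : 0ℚ ℚ.≤ + n / 1
  0≤n = fromℚᵘ-mono-≤ {ℚᵘ.mkℚᵘ (+ 0) 0} {ℚᵘ.mkℚᵘ (+ n) 0} (ℚᵘ.*≤* (ℤ.+≤+ ℕ.z≤n))
  1+nx≡n : 1ℚ ℚ.+ (+ n / 1) ℚ.* (1ℚ ℚ.- r) ≡ + n / 1
  1+nx≡n = abstractly (+ n / 1) r (n*1/n≡1 m)
    where
    open +-*-Solver
    abstractly : ∀ y r → y ℚ.* r ≡ 1ℚ → 1ℚ ℚ.+ y ℚ.* (1ℚ ℚ.- r) ≡ y
    abstractly y r yr≡1 = begin
      1ℚ ℚ.+ y ℚ.* (1ℚ ℚ.- r)
        ≡⟨ solve 2 (λ y r → con 1ℚ :+ y :* (con 1ℚ :- r) := y :+ (con 1ℚ :- y :* r)) refl y r ⟩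
      y ℚ.+ (1ℚ ℚ.- y ℚ.* r)   ≡⟨ cong (λ z → y ℚ.+ (1ℚ ℚ.- z)) yr≡1 ⟩
      y ℚ.+ (1ℚ ℚ.- 1ℚ)        ≡⟨ ℚ.+-identityʳ y ⟩
      y                        ∎
      where open ≡-Reasoning

-- Since μ is strict, whether a partition contains μ depends only on the set
-- d₁ < d₂ < … of its part sizes (d₀ = 0).  With more than k sizes μ is contained;
-- with exactly k sizes μ is avoided iff dᵢ = dᵢ₋₁ + 1 for every i ≤ k that is
-- not a part of μ; partitions with fewer than k sizes are negligible.
--
-- Let c = k - ℓ, the largest rank i ≤ k that is not a part of μ.  For fixed sizes
-- the number of solutions of ∑ mᵢ dᵢ = n is n ^ (k-1) / ((k-1)! ∏ dᵢ) up to a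
-- controlled error: the forced pair d_c = d_{c-1} + 1 makes the count smooth in n.
-- Summing 1 / (d₁ ⋯ d_c) telescopes to 1 / ∏ (c - aⱼ - j), and the remaining ℓ
-- sizes are free and contribute Hₙ ^ ℓ / ℓ!, where Hₙ is the harmonic number.
-- The sizes with d_c beyond a power of log n are cut off; they contribute little
-- because t and t + 1 together represent n in few ways when t is large.
-- Finally |log n - Hₙ| ≤ 1.
module Submission where

-- For arbitrary sizes the number of solutions of ∑ mᵢ dᵢ = n is a quasi-polynomial, and its
-- periodic part has no useful uniform bound. For two consecutive sizes, m₁ t + m₂ (t + 1) = x has x
-- / (t (t + 1)) + O(1) solutions, and the other sizes only average this. The price is a relative
-- error of order t² / n, so t has to stay below a bound T. With L the binary length of n, T = L ^
-- (k + 1) serves every purpose: T² L = O(n) makes this error O(1 / L), while 1 / T absorbs all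
-- powers of L that crude counts produce. The ℓ free sizes above rank c range up to n and need not
-- be small against n. But d · (1 / d) = 1, so weighting by the sum of the sizes trades a factor log
-- n for a factor n, which is again a relative error O(1 / log n). Solutions are counted in ℕ with
-- denominators cleared; reciprocals and harmonic numbers enter only for the sums over the sizes.
-- The final inequality is proved for every partial sum of Mercator's series from index n on.

module FiniteSums where

  open import Data.Nat.Base
  open import Data.Nat.Properties
  open import Data.Nat.Tactic.RingSolver using (solve-∀)
  open import Data.Nat.ListAction using (sum; product)
  open import Data.Nat.ListAction.Properties using (sum-++; product-++)
  open import Data.List.Base using (List; []; _∷_; _++_; length; map; concatMap)
  open import Data.List.Properties using (length-++)
  open import Data.List.Relation.Unary.All using (All; []; _∷_)
  open import Data.Sum.Base using (inj₁; inj₂)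
  open import Function.Base using (_∘_)
  open import Relation.Nullary using (yes; no; contradiction)
  open import Relation.Binary.Definitions using (tri<; tri≈; tri>)
  open import Relation.Binary.PropositionalEquality hiding (J)

  private variable
    A B : Set

  -- Finite sums over lists.

  ∑ : List A → (A → ℕ) → ℕ
  ∑ []       f = 0
  ∑ (x ∷ xs) f = f x + ∑ xs f

  infixr 5 ∑
  syntax ∑ xs (λ x → e) = ∑[ x ∈ xs ] e

  ∑-cong : ∀ {f g : A → ℕ} (xs : List A) → (∀ x → f x ≡ g x) → ∑ xs f ≡ ∑ xs g
  ∑-cong []       h = refl
  ∑-cong (x ∷ xs) h = cong₂ _+_ (h x) (∑-cong xs h)

  ∑-mono : ∀ {f g : A → ℕ} (xs : List A) → (∀ x → f x ≤ g x) → ∑ xs f ≤ ∑ xs g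
  ∑-mono []       h = z≤n
  ∑-mono (x ∷ xs) h = +-mono-≤ (h x) (∑-mono xs h)

  ∑-zero : ∀ (xs : List A) → ∑ xs (λ _ → 0) ≡ 0
  ∑-zero []       = refl
  ∑-zero (x ∷ xs) = ∑-zero xs

  +-interchange : ∀ a b c d → (a + b) + (c + d) ≡ (a + c) + (b + d)
  +-interchange = solve-∀

  ∑-+ : ∀ (f g : A → ℕ) xs → ∑ xs (λ x → f x + g x) ≡ ∑ xs f + ∑ xs g
  ∑-+ f g []       = refl
  ∑-+ f g (x ∷ xs) = trans (cong (f x + g x +_) (∑-+ f g xs))
    (+-interchange (f x) (g x) (∑ xs f) (∑ xs g))

  ∑-*ˡ : ∀ c (f : A → ℕ) xs → ∑ xs (λ x → c * f x) ≡ c * ∑ xs f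
  ∑-*ˡ c f []       = sym (*-zeroʳ c)
  ∑-*ˡ c f (x ∷ xs) = trans (cong (c * f x +_) (∑-*ˡ c f xs)) (sym (*-distribˡ-+ c (f x) (∑ xs f)))

  ∑-swap : ∀ (f : A → B → ℕ) xs ys →
           (∑[ x ∈ xs ] ∑[ y ∈ ys ] f x y) ≡ (∑[ y ∈ ys ] ∑[ x ∈ xs ] f x y)
  ∑-swap f []       ys = sym (∑-zero ys)
  ∑-swap f (x ∷ xs) ys = trans (cong (∑ ys (f x) +_) (∑-swap f xs ys))
    (sym (∑-+ (f x) (λ y → ∑ xs (λ x → f x y)) ys))

  ∑-++ : ∀ (f : A → ℕ) xs ys → ∑ (xs ++ ys) f ≡ ∑ xs f + ∑ ys f
  ∑-++ f []       ys = refl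
  ∑-++ f (x ∷ xs) ys = trans (cong (f x +_) (∑-++ f xs ys)) (sym (+-assoc (f x) _ _))

  ∑-map : ∀ (f : B → ℕ) (g : A → B) xs → ∑ (map g xs) f ≡ ∑ xs (f ∘ g)
  ∑-map f g []       = refl
  ∑-map f g (x ∷ xs) = cong (f (g x) +_) (∑-map f g xs)

  ∑-concatMap : ∀ (f : B → ℕ) (g : A → List B) xs →
                ∑ (concatMap g xs) f ≡ (∑[ x ∈ xs ] ∑ (g x) f)
  ∑-concatMap f g []       = refl
  ∑-concatMap f g (x ∷ xs) = trans (∑-++ f (g x) (concatMap g xs))
    (cong (∑ (g x) f +_) (∑-concatMap f g xs))

  length-concatMap : ∀ (g : A → List B) xs → length (concatMap g xs) ≡ (∑[ x ∈ xs ] length (g x))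
  length-concatMap g []       = refl
  length-concatMap g (x ∷ xs) = trans (length-++ (g x)) (cong (length (g x) +_) (length-concatMap g xs))

  -- Intervals and telescoping.

  interval : ℕ → ℕ → List ℕ
  interval u zero    = []
  interval u (suc f) = suc u ∷ interval (suc u) f

  -- Discrete comparison of a sum with a decreasing primitive `ψ`; one inequality per step suffices,
  -- so no closed form of the sum is needed.
  telescope-≤ : ∀ (φ ψ : ℕ → ℕ) → (∀ m → φ (suc m) + ψ (suc m) ≤ ψ m) →
                ∀ u f → ∑ (interval u f) φ + ψ (u + f) ≤ ψ u
  telescope-≤ φ ψ h u zero    = ≤-reflexive (cong ψ (+-identityʳ u))
  telescope-≤ φ ψ h u (suc f) = begin
    φ (suc u) + S + ψ (u + suc f)  ≡⟨ cong (λ v → φ (suc u) + S + ψ v) (+-suc u f) ⟩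
    φ (suc u) + S + ψ (suc u + f)  ≡⟨ +-assoc (φ (suc u)) S _ ⟩
    φ (suc u) + (S + ψ (suc u + f))  ≤⟨ +-monoʳ-≤ (φ (suc u)) (telescope-≤ φ ψ h (suc u) f) ⟩
    φ (suc u) + ψ (suc u)  ≤⟨ h u ⟩
    ψ u ∎
    where
    open ≤-Reasoning
    S = ∑ (interval (suc u) f) φ

  telescope-≥ : ∀ (φ ψ : ℕ → ℕ) → (∀ m → ψ m ≤ φ (suc m) + ψ (suc m)) →
                ∀ u f → ψ u ≤ ∑ (interval u f) φ + ψ (u + f)
  telescope-≥ φ ψ h u zero    = ≤-reflexive (cong ψ (sym (+-identityʳ u)))
  telescope-≥ φ ψ h u (suc f) = begin
    ψ u  ≤⟨ h u ⟩
    φ (suc u) + ψ (suc u)  ≤⟨ +-monoʳ-≤ (φ (suc u)) (telescope-≥ φ ψ h (suc u) f) ⟩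
    φ (suc u) + (S + ψ (suc u + f))  ≡⟨ +-assoc (φ (suc u)) S _ ⟨
    φ (suc u) + S + ψ (suc u + f)  ≡⟨ cong (λ v → φ (suc u) + S + ψ v) (+-suc u f) ⟨
    φ (suc u) + S + ψ (u + suc f)  ∎
    where
    open ≤-Reasoning
    S = ∑ (interval (suc u) f) φ

  -- Truncated powers and Bernoulli's inequality.

  -- x ^ j with the convention 0 ^ 0 = 0, so that p 0 is the indicator of x > 0.
  p : ℕ → ℕ → ℕ
  p j zero    = 0
  p j (suc x) = suc x ^ j

  p≤^ : ∀ j x → p j x ≤ x ^ j
  p≤^ j zero    = z≤n
  p≤^ j (suc x) = ≤-refl

  p-suc : ∀ j x → p (suc j) x ≡ x ^ suc j
  p-suc j zero    = refl
  p-suc j (suc x) = refl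

  p1 : ∀ x → p 1 x ≡ x
  p1 x = trans (p-suc 0 x) (*-identityʳ x)

  p0-mono : ∀ {x y} → x ≤ y → p 0 x ≤ p 0 y
  p0-mono z≤n     = z≤n
  p0-mono (s≤s h) = ≤-refl

  bernoulli-≤ : ∀ j y d → y ^ suc j + suc j * d * y ^ j ≤ (y + d) ^ suc j
  bernoulli-≤ zero    y d = ≤-reflexive (lem y d)
    where
    lem : ∀ y d → y * 1 + (d + 0) * 1 ≡ (y + d) * 1
    lem = solve-∀
  bernoulli-≤ (suc j) y d = begin
    y * Y + suc (suc j) * d * Y  ≤⟨ m≤m+n _ (d * (suc j * d * y ^ j)) ⟩
    y * Y + suc (suc j) * d * Y + d * (suc j * d * y ^ j) ≡⟨ lem y d (y ^ j) j ⟩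
    (y + d) * (Y + suc j * d * y ^ j)  ≤⟨ *-monoʳ-≤ (y + d) (bernoulli-≤ j y d) ⟩
    (y + d) * (y + d) ^ suc j ∎
    where
    open ≤-Reasoning
    Y = y ^ suc j
    lem : ∀ y d Y j → y * (y * Y) + suc (suc j) * d * (y * Y) + d * (suc j * d * Y)
                    ≡ (y + d) * (y * Y + suc j * d * Y)
    lem = solve-∀

  bernoulli-≥ : ∀ j {x z d} → z ≤ x → x ≤ z + d → x ^ suc j ≤ z ^ suc j + suc j * d * x ^ j
  bernoulli-≥ zero    {x} {z} {d} z≤x x≤z+d = begin
    x * 1  ≡⟨ *-identityʳ x ⟩
    x  ≤⟨ x≤z+d ⟩
    z + d  ≡⟨ lem z d ⟩
    z * 1 + (d + 0) * 1  ∎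
    where
    open ≤-Reasoning
    lem : ∀ z d → z + d ≡ z * 1 + (d + 0) * 1
    lem = solve-∀
  bernoulli-≥ (suc j) {x} {z} {d} z≤x x≤z+d = begin
    x * x ^ suc j  ≤⟨ *-monoʳ-≤ x (bernoulli-≥ j z≤x x≤z+d) ⟩
    x * (z ^ suc j + suc j * d * x ^ j)  ≡⟨ lem₁ x (z ^ suc j) j d (x ^ j) ⟩
    x * z ^ suc j + suc j * d * X  ≤⟨ +-monoˡ-≤ _ (*-monoˡ-≤ (z ^ suc j) x≤z+d) ⟩
    (z + d) * z ^ suc j + suc j * d * X  ≡⟨ cong (_+ suc j * d * X) (*-distribʳ-+ (z ^ suc j) z d) ⟩
    z * z ^ suc j + d * z ^ suc j + suc j * d * X  ≤⟨ +-monoˡ-≤ _ (+-monoʳ-≤ (z * z ^ suc j)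
                                                              (*-monoʳ-≤ d (^-monoˡ-≤ (suc j) z≤x))) ⟩
    z * z ^ suc j + d * X + suc j * d * X  ≡⟨ lem₂ (z * z ^ suc j) d X j ⟩
    z * z ^ suc j + suc (suc j) * d * X  ∎
    where
    open ≤-Reasoning
    X = x ^ suc j
    lem₁ : ∀ x Z j d X → x * (Z + suc j * d * X) ≡ x * Z + suc j * d * (x * X)
    lem₁ = solve-∀
    lem₂ : ∀ a d X j → a + d * X + suc j * d * X ≡ a + suc (suc j) * d * X
    lem₂ = solve-∀

  -- For `x ≤ d` the left side vanishes, also when `j = 0`, because `p j 0 = 0`; otherwise this is
  -- Bernoulli's inequality at `x ∸ d`.
  p-step-≤ : ∀ j x d → suc j * d * p j (x ∸ d) + p (suc j) (x ∸ d) ≤ p (suc j) x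
  p-step-≤ j x d with x ∸ d in eq
  ... | zero  = subst (_≤ p (suc j) x) (sym (trans (+-identityʳ _) (*-zeroʳ (suc j * d)))) z≤n
  ... | suc y = subst₂ _≤_ (+-comm (suc y ^ suc j) _)
      (trans (cong (_^ suc j) (sym x≡)) (sym (p-suc j x))) (bernoulli-≤ j (suc y) d)
    where
    x≡ : x ≡ suc y + d
    x≡ = trans (sym (m∸n+n≡m {x} {d} (<⇒≤ (m∸n≢0⇒n<m λ e → 0≢1+n (trans (sym e) eq))))) (cong (_+ d) eq)

  p-step-≥ : ∀ j x d → p (suc j) x ≤ suc j * d * p j x + p (suc j) (x ∸ d)
  p-step-≥ j zero      d = z≤n
  p-step-≥ j x@(suc _) d = subst (x ^ suc j ≤_)
    (trans (+-comm ((x ∸ d) ^ suc j) _) (cong (suc j * d * x ^ j +_) (sym (p-suc j (x ∸ d)))))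
    (bernoulli-≥ j (m∸n≤m x d) (m≤n+m∸n' ))
    where
    m≤n+m∸n' : x ≤ x ∸ d + d
    m≤n+m∸n' = subst (x ≤_) (+-comm d (x ∸ d)) (m≤n+m∸n x d)

  -- Translation operators.

  module Shifts (n : ℕ) where

    -- The operator ∑_{m ≥ 1} (translation by m d), cut off at m = n: harmless for
    -- d ≥ 1 and functions vanishing beyond n.
    act : ℕ → (ℕ → ℕ) → ℕ → ℕ
    act d g y = ∑[ m ∈ interval 0 n ] g (y + m * d)

    act-cong : ∀ d {g h} → (∀ y → g y ≡ h y) → ∀ y → act d g y ≡ act d h y
    act-cong d e y = ∑-cong (interval 0 n) λ m → e (y + m * d)

    act-mono : ∀ d {g h} → (∀ y → g y ≤ h y) → ∀ y → act d g y ≤ act d h y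
    act-mono d e y = ∑-mono (interval 0 n) λ m → e (y + m * d)

    act-∑ : ∀ d (xs : List A) (g : A → ℕ → ℕ) y →
            act d (λ z → ∑[ x ∈ xs ] g x z) y ≡ (∑[ x ∈ xs ] act d (g x) y)
    act-∑ d xs g y = ∑-swap (λ m x → g x (y + m * d)) (interval 0 n) xs

    act-comm : ∀ d e g y → act d (act e g) y ≡ act e (act d g) y
    act-comm d e g y = trans
      (∑-swap (λ m m′ → g (y + m * d + m′ * e)) (interval 0 n) (interval 0 n))
      (∑-cong (interval 0 n) λ m′ → ∑-cong (interval 0 n) λ m → cong g (lem y (m * d) (m′ * e)))
      where
      lem : ∀ y a b → y + a + b ≡ y + b + a
      lem = solve-∀

    act-*ˡ : ∀ d c g y → act d (λ z → c * g z) y ≡ c * act d g y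
    act-*ˡ d c g y = ∑-*ˡ c (λ m → g (y + m * d)) (interval 0 n)

    P : ℕ → ℕ → ℕ
    P j y = p j (n ∸ y)

    private
      shift : ∀ y m d a → n ∸ (y + suc m * d + a) ≡ n ∸ (y + m * d + a) ∸ d
      shift y m d a = trans (cong (n ∸_) (lem y m d a)) (sym (∸-+-assoc n (y + m * d + a) d))
        where
        lem : ∀ y m d a → y + suc m * d + a ≡ y + m * d + a + d
        lem = solve-∀

    -- A Riemann sum of the decreasing function `P j` over right end points, compared with its
    -- integral.
    act-P-≤ : ∀ j d y → suc j * d * act d (P j) y ≤ P (suc j) y
    act-P-≤ j d y = begin
      suc j * d * act d (P j) y  ≡⟨ ∑-*ˡ (suc j * d) _ (interval 0 n) ⟨
      ∑ (interval 0 n) φ  ≤⟨ m≤m+n _ (ψ n) ⟩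
      ∑ (interval 0 n) φ + ψ n  ≤⟨ telescope-≤ φ ψ step 0 n ⟩
      ψ 0  ≡⟨ cong (P (suc j)) (+-identityʳ y) ⟩
      P (suc j) y  ∎
      where
      open ≤-Reasoning
      φ ψ : ℕ → ℕ
      φ m = suc j * d * P j (y + m * d)
      ψ m = P (suc j) (y + m * d)
      step : ∀ m → φ (suc m) + ψ (suc m) ≤ ψ m
      step m = subst (λ x → suc j * d * p j x + p (suc j) x ≤ ψ m) (sym e) (p-step-≤ j (n ∸ (y + m * d)) d)
        where
        e : n ∸ (y + suc m * d) ≡ n ∸ (y + m * d) ∸ d
        e = subst₂ (λ a b → n ∸ a ≡ n ∸ b ∸ d) (+-identityʳ (y + suc m * d)) (+-identityʳ (y + m * d)) (shift y m d 0)

    -- The same Riemann sum dominates the integral from `y + d` on. The translation `a` carries the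
    -- shift already lost to the sizes summed before, so that the bound can be iterated.
    act-P-≥ : ∀ j d a y → 1 ≤ d → P (suc j) (y + d + a) ≤ suc j * d * act d (λ z → P j (z + a)) y
    act-P-≥ j d a y 1≤d = begin
      P (suc j) (y + d + a)  ≡⟨ cong (λ e → P (suc j) (y + e + a)) (sym (+-identityʳ d)) ⟩
      ψ 0  ≤⟨ telescope-≥ φ ψ step 0 n ⟩
      ∑ (interval 0 n) φ + ψ n  ≡⟨ cong (∑ (interval 0 n) φ +_) ψn≡0 ⟩
      ∑ (interval 0 n) φ + 0  ≡⟨ +-identityʳ _ ⟩
      ∑ (interval 0 n) φ  ≡⟨ ∑-*ˡ (suc j * d) _ (interval 0 n) ⟩
      suc j * d * act d (λ z → P j (z + a)) y  ∎
      where
      open ≤-Reasoning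
      φ ψ : ℕ → ℕ
      φ m = suc j * d * P j (y + m * d + a)
      ψ m = P (suc j) (y + suc m * d + a)
      step : ∀ m → ψ m ≤ φ (suc m) + ψ (suc m)
      step m = subst (λ x → ψ m ≤ φ (suc m) + p (suc j) x) (sym (shift y (suc m) d a))
                 (p-step-≥ j (n ∸ (y + suc m * d + a)) d)
      -- The truncation of `act` at n is invisible, as (n + 1) d > n.
      ψn≡0 : ψ n ≡ 0
      ψn≡0 = cong (p (suc j)) (m≤n⇒m∸n≡0 (begin
        n  ≤⟨ n≤1+n n ⟩
        suc n  ≡⟨ *-identityʳ (suc n) ⟨
        suc n * 1  ≤⟨ *-monoʳ-≤ (suc n) 1≤d ⟩
        suc n * d  ≤⟨ m≤n+m _ y ⟩
        y + suc n * d  ≤⟨ m≤m+n _ a ⟩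
        y + suc n * d + a  ∎))

    -- For positive sizes and the indicator of n as `g`, this is the number of ways to write n - y
    -- as ∑ mᵢ dᵢ with all mᵢ ≥ 1. A general `g` allows the sizes to be summed out one at a time.
    cnt : List ℕ → (ℕ → ℕ) → ℕ → ℕ
    cnt []       g = g
    cnt (d ∷ ds) g = act d (cnt ds g)

    cnt-mono : ∀ ds {g h} → (∀ y → g y ≤ h y) → ∀ y → cnt ds g y ≤ cnt ds h y
    cnt-mono []       e = e
    cnt-mono (d ∷ ds) e = act-mono d (cnt-mono ds e)

    cnt-cong : ∀ ds {g h} → (∀ y → g y ≡ h y) → ∀ y → cnt ds g y ≡ cnt ds h y
    cnt-cong []       e = e
    cnt-cong (d ∷ ds) e = act-cong d (cnt-cong ds e)

    cnt-++ : ∀ ds es g y → cnt (ds ++ es) g y ≡ cnt ds (cnt es g) y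
    cnt-++ []       es g y = refl
    cnt-++ (d ∷ ds) es g y = act-cong d (cnt-++ ds es g) y

    cnt-act : ∀ ds d g y → act d (cnt ds g) y ≡ cnt ds (act d g) y
    cnt-act []       d g y = refl
    cnt-act (e ∷ ds) d g y = trans (act-comm d e (cnt ds g) y) (act-cong e (cnt-act ds d g) y)

    cnt-*ˡ : ∀ ds c g y → cnt ds (λ z → c * g z) y ≡ c * cnt ds g y
    cnt-*ˡ []       c g y = refl
    cnt-*ˡ (d ∷ ds) c g y = trans (act-cong d (cnt-*ˡ ds c g) y) (act-*ˡ d c (cnt ds g) y)

    cnt-+ : ∀ ds g h y → cnt ds (λ z → g z + h z) y ≡ cnt ds g y + cnt ds h y
    cnt-+ []       g h y = refl
    cnt-+ (d ∷ ds) g h y = trans (act-cong d (cnt-+ ds g h) y) (∑-+ _ _ (interval 0 n))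

    cnt-∑ : ∀ ds (xs : List A) (g : A → ℕ → ℕ) y →
            cnt ds (λ z → ∑[ x ∈ xs ] g x z) y ≡ (∑[ x ∈ xs ] cnt ds (g x) y)
    cnt-∑ []       xs g y = refl
    cnt-∑ (d ∷ ds) xs g y = trans (act-cong d (cnt-∑ ds xs g) y) (act-∑ d xs (λ x → cnt ds (g x)) y)

  ∑-interval-mono : ∀ {f g : ℕ → ℕ} u k → (∀ d → f (suc d) ≤ g (suc d)) →
                    ∑ (interval u k) f ≤ ∑ (interval u k) g
  ∑-interval-mono u zero    h = z≤n
  ∑-interval-mono u (suc k) h = +-mono-≤ (h u) (∑-interval-mono (suc u) k h)

  ∑-interval-suc : ∀ (f : ℕ → ℕ) u k → ∑ (interval (suc u) k) f ≡ ∑ (interval u k) (f ∘ suc)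
  ∑-interval-suc f u zero    = refl
  ∑-interval-suc f u (suc k) = cong (f (suc (suc u)) +_) (∑-interval-suc f (suc u) k)

  ∑-interval-last : ∀ (f : ℕ → ℕ) u k → ∑ (interval u (suc k)) f ≡ ∑ (interval u k) f + f (suc (u + k))
  ∑-interval-last f u zero    = trans (+-identityʳ _) (cong (f ∘ suc) (sym (+-identityʳ u)))
  ∑-interval-last f u (suc k) = begin
    f (suc u) + ∑ (interval (suc u) (suc k)) f
      ≡⟨ cong (f (suc u) +_) (∑-interval-last f (suc u) k) ⟩
    f (suc u) + (∑ (interval (suc u) k) f + f (suc (suc u + k)))
      ≡⟨ +-assoc (f (suc u)) _ _ ⟨
    f (suc u) + ∑ (interval (suc u) k) f + f (suc (suc u + k))
      ≡⟨ cong (λ v → f (suc u) + ∑ (interval (suc u) k) f + f (suc v)) (+-suc u k) ⟨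
    f (suc u) + ∑ (interval (suc u) k) f + f (suc (u + suc k)) ∎
    where open ≡-Reasoning

  -- The lists whose i-th entry from the right is drawn from `ext i` of the list
  -- of the entries to its right.
  chains : (ℕ → List ℕ → List ℕ) → ℕ → List (List ℕ)
  chains ext zero    = [] ∷ []
  chains ext (suc i) = concatMap (λ xs → map (_∷ xs) (ext (suc i) xs)) (chains ext i)

  ∑-chains : ∀ ext i (f : List ℕ → ℕ) →
             ∑ (chains ext (suc i)) f ≡ (∑[ xs ∈ chains ext i ] ∑[ d ∈ ext (suc i) xs ] f (d ∷ xs))
  ∑-chains ext i f = trans (∑-concatMap f _ (chains ext i))
    (∑-cong (chains ext i) λ xs → ∑-map f (_∷ xs) (ext (suc i) xs))

  -- Lattice points in simplices.

  module Counting (n : ℕ) where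
    open Shifts n public

    -- Lattice points against volume: each size divides by its length and raises the degree by one.
    cnt-P-≤ : ∀ os j y → (length os + j) ! * product os * cnt os (P j) y ≤ j ! * P (length os + j) y
    cnt-P-≤ []       j y = ≤-reflexive (cong (_* P j y) (*-identityʳ (j !)))
    cnt-P-≤ (d ∷ os) j y = begin
      suc r * r ! * (d * product os) * act d (cnt os (P j)) y
        ≡⟨ lem (suc r) (r !) d (product os) _ ⟩
      suc r * d * (r ! * product os * act d (cnt os (P j)) y)
        ≡⟨ cong (suc r * d *_) (act-*ˡ d (r ! * product os) (cnt os (P j)) y) ⟨
      suc r * d * act d (λ z → r ! * product os * cnt os (P j) z) y
        ≤⟨ *-monoʳ-≤ (suc r * d) (act-mono d (cnt-P-≤ os j) y) ⟩
      suc r * d * act d (λ z → j ! * P r z) y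
        ≡⟨ cong (suc r * d *_) (act-*ˡ d (j !) (P r) y) ⟩
      suc r * d * (j ! * act d (P r) y)
        ≡⟨ lem′ (suc r * d) (j !) _ ⟩
      j ! * (suc r * d * act d (P r) y)
        ≤⟨ *-monoʳ-≤ (j !) (act-P-≤ r d y) ⟩
      j ! * P (suc r) y ∎
      where
      open ≤-Reasoning
      r = length os + j
      lem : ∀ a b c d e → a * b * (c * d) * e ≡ a * c * (b * d * e)
      lem = solve-∀
      lem′ : ∀ a b c → a * (b * c) ≡ b * (a * c)
      lem′ = solve-∀

    -- Rounding a point of the smaller simplex up to a counted one moves it by at most `sum os`,
    -- hence the shifted argument.
    cnt-P-≥ : ∀ os j y → All (1 ≤_) os →
              j ! * P (length os + j) (y + sum os) ≤ (length os + j) ! * product os * cnt os (P j) y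
    cnt-P-≥ []       j y [] = ≤-reflexive (cong₂ (λ a b → a * P j b) (sym (*-identityʳ (j !))) (+-identityʳ y))
    cnt-P-≥ (d ∷ os) j y (1≤d ∷ pos) = begin
      j ! * P (suc r) (y + (d + sum os))
        ≡⟨ cong (λ v → j ! * P (suc r) v) (+-assoc y d (sum os)) ⟨
      j ! * P (suc r) (y + d + sum os)
        ≤⟨ *-monoʳ-≤ (j !) (act-P-≥ r d (sum os) y 1≤d) ⟩
      j ! * (suc r * d * act d (λ z → P r (z + sum os)) y)
        ≡⟨ lem′ (suc r * d) (j !) _ ⟨
      suc r * d * (j ! * act d (λ z → P r (z + sum os)) y)
        ≡⟨ cong (suc r * d *_) (act-*ˡ d (j !) (λ z → P r (z + sum os)) y) ⟨
      suc r * d * act d (λ z → j ! * P r (z + sum os)) y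
        ≤⟨ *-monoʳ-≤ (suc r * d) (act-mono d (λ z → cnt-P-≥ os j z pos) y) ⟩
      suc r * d * act d (λ z → r ! * product os * cnt os (P j) z) y
        ≡⟨ cong (suc r * d *_) (act-*ˡ d (r ! * product os) (cnt os (P j)) y) ⟩
      suc r * d * (r ! * product os * act d (cnt os (P j)) y)
        ≡⟨ lem (suc r) (r !) d (product os) _ ⟨
      suc r * r ! * (d * product os) * act d (cnt os (P j)) y ∎
      where
      open ≤-Reasoning
      r = length os + j
      lem : ∀ a b c d e → a * b * (c * d) * e ≡ a * c * (b * d * e)
      lem = solve-∀
      lem′ : ∀ a b c → a * (b * c) ≡ b * (a * c)
      lem′ = solve-∀

    -- The indicators `δ`, `P 0`, `I` of y = n, y < n, y ≤ n.

    δ : ℕ → ℕ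
    δ y with y ≟ n
    ... | yes _ = 1
    ... | no  _ = 0

    δ-≡ : ∀ {y} → y ≡ n → δ y ≡ 1
    δ-≡ {y} e with y ≟ n
    ... | yes _ = refl
    ... | no ne = contradiction e ne

    δ-≢ : ∀ {y} → y ≢ n → δ y ≡ 0
    δ-≢ {y} ne with y ≟ n
    ... | yes e = contradiction e ne
    ... | no _  = refl

    δ≤1 : ∀ y → δ y ≤ 1
    δ≤1 y with y ≟ n
    ... | yes _ = ≤-refl
    ... | no _  = z≤n

    P-< : ∀ {y} → y < n → P 0 y ≡ 1
    P-< {y} y<n with n ∸ y in eq
    ... | zero  = contradiction (m∸n≡0⇒m≤n eq) (<⇒≱ y<n)
    ... | suc _ = refl

    P-≥ : ∀ j {y} → n ≤ y → P j y ≡ 0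
    P-≥ j n≤y = cong (p j) (m≤n⇒m∸n≡0 n≤y)

    P≤1 : ∀ y → P 0 y ≤ 1
    P≤1 y with n ∸ y
    ... | zero  = z≤n
    ... | suc _ = ≤-refl

    I : ℕ → ℕ
    I y = p 0 (suc n ∸ y)

    I-≤ : ∀ {y} → y ≤ n → I y ≡ 1
    I-≤ {y} y≤n rewrite +-∸-assoc 1 y≤n = refl

    I-> : ∀ {y} → n < y → I y ≡ 0
    I-> n<y = cong (p 0) (m≤n⇒m∸n≡0 n<y)

    P≤I : ∀ y → P 0 y ≤ I y
    P≤I y = p0-mono (∸-monoˡ-≤ y (n≤1+n n))

    P-δ : ∀ z → P 0 z ≡ δ (suc z) + P 0 (suc z)
    P-δ z with <-cmp (suc z) n
    ... | tri< h ne _ = trans (P-< (<⇒≤ h)) (sym (cong₂ _+_ (δ-≢ ne) (P-< h)))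
    ... | tri≈ _ e _  = trans (P-< (≤-reflexive e)) (sym (cong₂ _+_ (δ-≡ e) (P-≥ 0 (≤-reflexive (sym e)))))
    ... | tri> _ ne h = trans (P-≥ 0 (≤-pred h)) (sym (cong₂ _+_ (δ-≢ ne) (P-≥ 0 (<⇒≤ h))))

    act-vanish : ∀ s g y → (∀ z → n < z → g z ≡ 0) → n < y → act s g y ≡ 0
    act-vanish s g y g0 h = trans (∑-cong (interval 0 n) λ m → g0 (y + m * s) (≤-trans h (m≤m+n y (m * s)))) (∑-zero (interval 0 n))

    -- Peels off m = 1. Shifting the truncated sum would add a term with m = n + 1, which is zero
    -- because `g` vanishes beyond n.
    act-unfold : ∀ s g y → 1 ≤ s → (∀ z → n < z → g z ≡ 0) → act s g y ≡ g (y + s) + act s g (y + s)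
    act-unfold s g y 1≤s g0 = begin
      ∑ (interval 0 n) F  ≡⟨ +-identityʳ _ ⟨
      ∑ (interval 0 n) F + 0  ≡⟨ cong (∑ (interval 0 n) F +_) (g0 _ big) ⟨
      ∑ (interval 0 n) F + F (suc n)  ≡⟨ ∑-interval-last F 0 n ⟨
      F 1 + ∑ (interval 1 n) F  ≡⟨ cong (F 1 +_) (∑-interval-suc F 0 n) ⟩
      F 1 + ∑ (interval 0 n) (F ∘ suc)  ≡⟨ cong₂ _+_ (cong (λ v → g (y + v)) (+-identityʳ s))
                                                       (∑-cong (interval 0 n) λ m → cong g (sym (+-assoc y s (m * s)))) ⟩
      g (y + s) + act s g (y + s)  ∎
      where
      open ≡-Reasoning
      F : ℕ → ℕ
      F m = g (y + m * s)
      big : n < y + suc n * s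
      big = ≤-trans (subst (_≤ suc n * s) (*-identityʳ (suc n)) (*-monoʳ-≤ (suc n) 1≤s)) (m≤n+m _ y)

    -- Two consecutive sizes.

    pair : ℕ → ℕ → ℕ
    pair t = act (suc t) (act t δ)

    δ-vanish : ∀ z → n < z → δ z ≡ 0
    δ-vanish z h = δ-≢ (>⇒≢ h)

    P-vanish : ∀ z → n < z → P 0 z ≡ 0
    P-vanish z h = P-≥ 0 (<⇒≤ h)

    I-vanish : ∀ z → n < z → I z ≡ 0
    I-vanish z h = I-> h

    -- With x = n - y and M = m₁ + m₂, the solutions of m₁ t + m₂ (t + 1) = x
    -- correspond to the M with M t < x < M (t + 1).  Both sides satisfy the same
    -- recursion from y to y + t + 1.
    pair-identity : ∀ t y → 1 ≤ t → pair t y + act (suc t) I y ≡ act t (P 0) y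
    pair-identity t y 1≤t = go (suc n) y (≤-trans (n<1+n n) (m≤n+m (suc n) y))
      where
      open ≡-Reasoning
      -- `f` is fuel: y grows by t + 1 in each step, and both sides vanish beyond n.
      go : ∀ f y → n < y + f → pair t y + act (suc t) I y ≡ act t (P 0) y
      go zero    y h = trans (cong₂ _+_ (act-vanish (suc t) _ y (λ z h → act-vanish t δ z δ-vanish h) h′)
                                        (act-vanish (suc t) I y I-vanish h′))
                             (sym (act-vanish t (P 0) y P-vanish h′))
        where h′ = subst (n <_) (+-identityʳ y) h
      go (suc f) y h = begin
        pair t y + act (suc t) I y
          ≡⟨ cong₂ _+_ (act-unfold (suc t) _ y (s≤s z≤n) (λ z h → act-vanish t δ z δ-vanish h))
                       (act-unfold (suc t) I y (s≤s z≤n) I-vanish) ⟩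
        (act t δ y′ + pair t y′) + (I y′ + act (suc t) I y′)
          ≡⟨ lem (act t δ y′) (pair t y′) (I y′) _ ⟩
        I y′ + (act t δ y′ + (pair t y′ + act (suc t) I y′))
          ≡⟨ cong (λ v → I y′ + (act t δ y′ + v)) (go f y′ h′) ⟩
        I y′ + (act t δ y′ + act t (P 0) y′)
          -- Once its argument is a successor, `I (suc (y + t))` computes to `P 0 (y + t)`: z + 1 ≤
          -- n iff z < n.
          ≡⟨ cong (λ v → I v + (act t δ v + act t (P 0) v)) (+-suc y t) ⟩
        P 0 (y + t) + (act t δ (suc (y + t)) + act t (P 0) (suc (y + t)))
          ≡⟨ cong (P 0 (y + t) +_) (∑-+ _ _ (interval 0 n)) ⟨
        P 0 (y + t) + act t (λ z → δ (suc z) + P 0 (suc z)) (y + t)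
          ≡⟨ cong (P 0 (y + t) +_) (act-cong t P-δ (y + t)) ⟨
        P 0 (y + t) + act t (P 0) (y + t)
          ≡⟨ act-unfold t (P 0) y 1≤t P-vanish ⟨
        act t (P 0) y ∎
        where
        y′ = y + suc t
        h′ : n < y′ + f
        h′ = ≤-trans h (≤-trans (≤-reflexive (+-suc y f)) (≤-trans (s≤s (+-monoˡ-≤ f (m≤m+n y t))) (≤-reflexive (cong (_+ f) (sym (+-suc y t))))))
        lem : ∀ a b c d → (a + b) + (c + d) ≡ c + (a + (b + d))
        lem = solve-∀

    lt-≤ : ∀ t y → t * act t (P 0) y ≤ n ∸ y
    lt-≤ t y = subst₂ _≤_ (cong (_* act t (P 0) y) (+-identityʳ t)) (p1 (n ∸ y)) (act-P-≤ 0 t y)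

    lt-≥ : ∀ t y → 1 ≤ t → n ∸ y ≤ t * act t (P 0) y + t
    lt-≥ t y 1≤t = begin
      n ∸ y  ≤⟨ m≤n+m∸n (n ∸ y) t ⟩
      t + (n ∸ y ∸ t)  ≡⟨ +-comm t _ ⟩
      n ∸ y ∸ t + t  ≡⟨ cong (_+ t) (∸-+-assoc n y t) ⟩
      n ∸ (y + t) + t  ≤⟨ +-monoˡ-≤ t h ⟩
      t * act t (P 0) y + t  ∎
      where
      open ≤-Reasoning
      h : n ∸ (y + t) ≤ t * act t (P 0) y
      h = subst₂ _≤_ (trans (cong (P 1) (+-identityʳ (y + t))) (p1 _))
            (cong₂ _*_ (+-identityʳ t) (∑-cong (interval 0 n) λ m → cong (P 0) (+-identityʳ (y + m * t))))
            (act-P-≥ 0 t 0 y 1≤t)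

    private
      I-step : ∀ s z → s * I (z + s) + (n ∸ (z + s)) ≤ n ∸ z
      I-step s z with ≤-<-connex (z + s) n
      ... | inj₁ h rewrite I-≤ h = ≤-reflexive (begin
        s * 1 + (n ∸ (z + s))  ≡⟨ cong₂ _+_ (*-identityʳ s) (sym (∸-+-assoc n z s)) ⟩
        s + (n ∸ z ∸ s)  ≡⟨ m+[n∸m]≡n (subst (_≤ n ∸ z) (m+n∸m≡n z s) (∸-monoˡ-≤ z h)) ⟩
        n ∸ z  ∎)
        where open ≡-Reasoning
      ... | inj₂ h rewrite I-> h | m≤n⇒m∸n≡0 (<⇒≤ h) | *-zeroʳ s = z≤n

    le-≤ : ∀ s y → s * act s I y ≤ n ∸ y
    le-≤ s y = begin
      s * act s I y  ≡⟨ ∑-*ˡ s _ (interval 0 n) ⟨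
      ∑ (interval 0 n) φ  ≤⟨ m≤m+n _ (ψ n) ⟩
      ∑ (interval 0 n) φ + ψ n  ≤⟨ telescope-≤ φ ψ step 0 n ⟩
      ψ 0  ≡⟨ cong (n ∸_) (+-identityʳ y) ⟩
      n ∸ y  ∎
      where
      open ≤-Reasoning
      φ ψ : ℕ → ℕ
      φ m = s * I (y + m * s)
      ψ m = n ∸ (y + m * s)
      step : ∀ m → φ (suc m) + ψ (suc m) ≤ ψ m
      step m = subst (λ v → s * I v + (n ∸ v) ≤ ψ m) (lem y m s) (I-step s (y + m * s))
        where
        lem : ∀ y m s → y + m * s + s ≡ y + suc m * s
        lem = solve-∀

    -- Up to rounding, `pair-identity` reads x / t - x / (t + 1) = x / (t (t + 1)) with x = n - y,
    -- and the rounding costs at most one. The rounding term keeps the factor `P 0 y`, so that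
    -- summing over the other sizes leaves it one degree below the main term.
    pair-≤ : ∀ t y → 1 ≤ t → t * suc t * pair t y ≤ P 1 y + t * suc t * P 0 y
    pair-≤ t y 1≤t with n ∸ y in eq
    ... | zero = ≤-trans (begin
      t * suc t * pair t y  ≡⟨ lem t (pair t y) ⟩
      suc t * (t * pair t y)  ≤⟨ *-monoʳ-≤ (suc t) (*-monoʳ-≤ t (m+n≤o⇒m≤o _ (≤-reflexive (pair-identity t y 1≤t)))) ⟩
      suc t * (t * act t (P 0) y)  ≤⟨ *-monoʳ-≤ (suc t) (≤-trans (lt-≤ t y) (≤-reflexive eq)) ⟩
      suc t * 0  ≡⟨ *-zeroʳ (suc t) ⟩
      0 ∎) z≤n
      where
      open ≤-Reasoning
      lem : ∀ t a → t * suc t * a ≡ suc t * (t * a)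
      lem = solve-∀
    -- t x is t (t + 1) times x / (t + 1); adding it to both sides replaces a subtraction.
    ... | suc x′ = +-cancelʳ-≤ (t * x) _ _ (begin
      t * suc t * pair t y + t * x
        ≤⟨ +-monoʳ-≤ (t * suc t * pair t y) (*-monoʳ-≤ t x≤) ⟩
      t * suc t * pair t y + t * (suc t * act (suc t) I y + suc t)
        ≡⟨ lem t (pair t y) (act (suc t) I y) ⟩
      suc t * (t * (pair t y + act (suc t) I y)) + t * suc t
        ≡⟨ cong (λ v → suc t * (t * v) + t * suc t) (pair-identity t y 1≤t) ⟩
      suc t * (t * act t (P 0) y) + t * suc t
        ≤⟨ +-monoˡ-≤ (t * suc t) (*-monoʳ-≤ (suc t) (≤-trans (lt-≤ t y) (≤-reflexive eq))) ⟩
      suc t * x + t * suc t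
        ≡⟨ lem′ t x ⟩
      x * 1 + t * suc t * 1 + t * x ∎)
      where
      open ≤-Reasoning
      x = suc x′
      lem : ∀ t a b → t * suc t * a + t * (suc t * b + suc t) ≡ suc t * (t * (a + b)) + t * suc t
      lem = solve-∀
      lem′ : ∀ t x → suc t * x + t * suc t ≡ x * 1 + t * suc t * 1 + t * x
      lem′ = solve-∀
      x≤ : x ≤ suc t * act (suc t) I y + suc t
      x≤ = ≤-trans (subst (_≤ suc t * act (suc t) (P 0) y + suc t) eq (lt-≥ (suc t) y (s≤s z≤n)))
        (+-monoˡ-≤ (suc t) (*-monoʳ-≤ (suc t) (act-mono (suc t) P≤I y)))

    pair-≥ : ∀ t y → 1 ≤ t → P 1 y ≤ t * suc t * pair t y + t * suc t * P 0 y
    pair-≥ t y 1≤t with n ∸ y in eq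
    ... | zero   = z≤n
    ... | suc x′ = +-cancelʳ-≤ (t * x) _ _ (begin
      x * 1 + t * x
        ≡⟨ lem t x ⟩
      suc t * x
        ≤⟨ *-monoʳ-≤ (suc t) (subst (_≤ t * act t (P 0) y + t) eq (lt-≥ t y 1≤t)) ⟩
      suc t * (t * act t (P 0) y + t)
        ≡⟨ cong (λ v → suc t * (t * v + t)) (pair-identity t y 1≤t) ⟨
      suc t * (t * (pair t y + act (suc t) I y) + t)
        ≡⟨ lem′ t (pair t y) (act (suc t) I y) ⟩
      t * suc t * pair t y + t * suc t * 1 + t * (suc t * act (suc t) I y)
        ≤⟨ +-monoʳ-≤ _ (*-monoʳ-≤ t (≤-trans (le-≤ (suc t) y) (≤-reflexive eq))) ⟩
      t * suc t * pair t y + t * suc t * 1 + t * x ∎)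
      where
      open ≤-Reasoning
      x = suc x′
      lem : ∀ t x → x * 1 + t * x ≡ suc t * x
      lem = solve-∀
      lem′ : ∀ t a b → suc t * (t * (a + b) + t) ≡ t * suc t * a + t * suc t * 1 + t * (suc t * b)
      lem′ = solve-∀

    n∸y≤nP : ∀ y → n ∸ y ≤ n * P 0 y
    n∸y≤nP y with n ∸ y in eq
    ... | zero  = z≤n
    ... | suc x = ≤-trans (subst (_≤ n) eq (m∸n≤m n y)) (≤-reflexive (sym (*-identityʳ n)))

    -- Since `P 0 ≤ I`, `pair-identity` bounds `pair t` by the difference of `act t (P 0)` and
    -- `act (suc t) (P 0)`. The sum telescopes to its first term, which is at most n / (T + 1).
    ∑-pair-≤ : ∀ T f y → suc T * (∑[ t ∈ interval T f ] pair t y) ≤ n * P 0 y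
    ∑-pair-≤ T f y = begin
      suc T * ∑ (interval T f) φ  ≤⟨ *-monoʳ-≤ (suc T) (m≤m+n _ (ψ (T + f))) ⟩
      suc T * (∑ (interval T f) φ + ψ (T + f))  ≤⟨ *-monoʳ-≤ (suc T) (telescope-≤ φ ψ step T f) ⟩
      suc T * act (suc T) (P 0) y  ≤⟨ lt-≤ (suc T) y ⟩
      n ∸ y  ≤⟨ n∸y≤nP y ⟩
      n * P 0 y  ∎
      where
      open ≤-Reasoning
      φ ψ : ℕ → ℕ
      φ t = pair t y
      ψ t = act (suc t) (P 0) y
      step : ∀ t → φ (suc t) + ψ (suc t) ≤ ψ t
      step t = ≤-trans (+-monoʳ-≤ (φ (suc t)) (act-mono (suc (suc t)) P≤I y))
                       (≤-reflexive (pair-identity (suc t) y (s≤s z≤n)))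

    -- Crude bounds for sums over all tuples of sizes.

    rect : (ℕ → ℕ) → ℕ → ℕ
    rect g y = ∑[ d ∈ interval 0 n ] act d g y

    tuples : ℕ → List (List ℕ)
    tuples = chains (λ _ _ → interval 0 n)

    -- The number of pairs (d, m) with d m < n, of order n log n: the price of one unrestricted
    -- size.
    R : ℕ
    R = rect (P 0) 0

    rect-P : ∀ y → rect (P 0) y ≤ R * P 0 y
    rect-P y with ≤-<-connex n y
    ... | inj₁ n≤y = ≤-trans (≤-reflexive (trans
        (∑-cong (interval 0 n) λ d → trans (∑-cong (interval 0 n) λ m → P-≥ 0 (≤-trans n≤y (m≤m+n y (m * d)))) (∑-zero (interval 0 n)))
        (∑-zero (interval 0 n)))) z≤n
    ... | inj₂ y<n rewrite P-< y<n | *-identityʳ R =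
      ∑-mono (interval 0 n) λ d → ∑-mono (interval 0 n) λ m → p0-mono (∸-monoʳ-≤ n (m≤n+m (m * d) y))

    -- `T` and `G` encode a bound g ≤ (G / T) · `P 0` without division. As `rect-P` reproduces
    -- `P 0`, every further size multiplies the bound by `R`.
    ∑-tuples-≤ : ∀ T G g → (∀ y → T * g y ≤ G * P 0 y) → ∀ j y →
                 T * (∑[ xs ∈ tuples j ] cnt xs g y) ≤ G * R ^ j * P 0 y
    ∑-tuples-≤ T G g h zero    y = subst₂ _≤_ (cong (T *_) (sym (+-identityʳ (g y))))
      (cong (_* P 0 y) (sym (*-identityʳ G))) (h y)
    ∑-tuples-≤ T G g h (suc j) y = begin
      T * (∑[ xs ∈ tuples (suc j) ] cnt xs g y)
        ≡⟨ cong (T *_) (trans (∑-chains _ j (λ xs → cnt xs g y)) (∑-swap _ (tuples j) (interval 0 n))) ⟩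
      T * (∑[ d ∈ interval 0 n ] ∑[ xs ∈ tuples j ] act d (cnt xs g) y)
        ≡⟨ cong (T *_) (∑-cong (interval 0 n) λ d → sym (act-∑ d (tuples j) (λ xs → cnt xs g) y)) ⟩
      T * (∑[ d ∈ interval 0 n ] act d S y)
        ≡⟨ trans (sym (∑-*ˡ T _ (interval 0 n))) (∑-cong (interval 0 n) λ d → sym (act-*ˡ d T S y)) ⟩
      (∑[ d ∈ interval 0 n ] act d (λ z → T * S z) y)
        ≤⟨ ∑-mono (interval 0 n) (λ d → act-mono d (∑-tuples-≤ T G g h j) y) ⟩
      (∑[ d ∈ interval 0 n ] act d (λ z → G * R ^ j * P 0 z) y)
        ≡⟨ trans (∑-cong (interval 0 n) λ d → act-*ˡ d (G * R ^ j) (P 0) y) (∑-*ˡ (G * R ^ j) _ (interval 0 n)) ⟩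
      G * R ^ j * rect (P 0) y
        ≤⟨ *-monoʳ-≤ (G * R ^ j) (rect-P y) ⟩
      G * R ^ j * (R * P 0 y)
        ≡⟨ lem G (R ^ j) R (P 0 y) ⟩
      G * (R * R ^ j) * P 0 y ∎
      where
      open ≤-Reasoning
      S : ℕ → ℕ
      S z = ∑[ xs ∈ tuples j ] cnt xs g z
      lem : ∀ a b c d → a * b * (c * d) ≡ a * (c * b) * d
      lem = solve-∀

    private
      act-δ≤1 : ∀ d y → 1 ≤ d → act d δ y ≤ 1
      act-δ≤1 d y 1≤d = begin
        ∑ (interval 0 n) φ  ≤⟨ m≤m+n _ (ψ n) ⟩
        ∑ (interval 0 n) φ + ψ n  ≤⟨ telescope-≤ φ ψ step 0 n ⟩
        ψ 0  ≤⟨ I≤1 (y + 1 * d) ⟩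
        1  ∎
        where
        open ≤-Reasoning
        φ ψ : ℕ → ℕ
        φ m = δ (y + m * d)
        ψ m = I (y + suc m * d)
        I≤1 : ∀ y → I y ≤ 1
        I≤1 y with suc n ∸ y
        ... | zero  = z≤n
        ... | suc _ = ≤-refl
        one : ∀ x → δ x + I (x + d) ≤ I x
        one x with <-cmp x n
        ... | tri< h ne _ rewrite δ-≢ ne | I-≤ (<⇒≤ h) = I≤1 (x + d)
        ... | tri≈ _ e _ rewrite I-≤ (≤-reflexive e)
                               | I-> {x + d} (subst (_≤ x + d) (trans (+-comm x 1) (cong suc e)) (+-monoʳ-≤ x 1≤d))
                               | +-identityʳ (δ x) = δ≤1 x
        ... | tri> _ ne h rewrite δ-≢ ne | I-> (≤-trans h (m≤m+n x d)) = z≤n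
        step : ∀ m → φ (suc m) + ψ (suc m) ≤ ψ m
        step m = subst (λ v → φ (suc m) + I v ≤ ψ m) (lem y m d) (one (y + suc m * d))
          where
          lem : ∀ y m d → y + suc m * d + d ≡ y + suc (suc m) * d
          lem = solve-∀

      ∑-initial : ∀ T → (∑[ d ∈ interval 0 n ] p 0 (suc T ∸ d)) ≤ T
      ∑-initial T = ≤-trans (m≤m+n _ (T ∸ n)) (telescope-≤ (λ d → p 0 (suc T ∸ d)) (T ∸_) step 0 n)
        where
        step : ∀ m → p 0 (T ∸ m) + (T ∸ suc m) ≤ T ∸ m
        step m = subst (λ v → p 0 (T ∸ m) + v ≤ T ∸ m) (sym (trans (cong (T ∸_) (+-comm 1 m)) (sym (∸-+-assoc T m 1)))) (aux (T ∸ m))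
          where
          aux : ∀ x → p 0 x + (x ∸ 1) ≤ x
          aux zero    = z≤n
          aux (suc x) = ≤-refl

      -- A divisor d of x ≤ n is at most T, or its codivisor m satisfies m T ≤ n.
      split-≤ : ∀ T y m d → δ (y + m * d) ≤ p 0 (suc T ∸ d) * δ (y + m * d) + I (m * T) * δ (y + m * d)
      split-≤ T y m d with y + m * d ≟ n
      ... | no _ = z≤n
      ... | yes e with ≤-<-connex d T
      ...   | inj₁ d≤T rewrite +-∸-assoc 1 d≤T = s≤s z≤n
      ...   | inj₂ T<d rewrite I-≤ {m * T} (≤-trans (*-monoʳ-≤ m (<⇒≤ T<d)) (≤-trans (m≤n+m (m * d) y) (≤-reflexive e))) =
        m≤n+m 1 _

    -- For y < n, `rect δ y` is the number of divisors of n - y. Divisors up to T and divisors whose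
    -- codivisor is at most n / T are counted separately, which gives T + n / T.
    rect-δ : ∀ T y → T * rect δ y ≤ (T * T + n) * P 0 y
    rect-δ T y with ≤-<-connex n y
    ... | inj₁ n≤y rewrite P-≥ 0 n≤y | *-zeroʳ (T * T + n) = begin
        T * rect δ y  ≤⟨ *-monoʳ-≤ T (∑-interval-mono 0 n λ d → ∑-interval-mono 0 n λ m →
                             ≤-reflexive (δ-vanish _ (≤-trans (s≤s n≤y) (subst (_≤ y + suc m * suc d) (+-comm y 1)
                               (+-monoʳ-≤ y (s≤s z≤n)))))) ⟩
        T * (∑[ d ∈ interval 0 n ] ∑[ m ∈ interval 0 n ] 0)
                         ≡⟨ cong (T *_) (trans (∑-cong (interval 0 n) λ _ → ∑-zero (interval 0 n)) (∑-zero (interval 0 n))) ⟩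
        T * 0  ≡⟨ *-zeroʳ T ⟩
        0  ∎
        where open ≤-Reasoning
    ... | inj₂ y<n rewrite P-< y<n | *-identityʳ (T * T + n) = begin
        T * rect δ y
          ≤⟨ *-monoʳ-≤ T (∑-mono J λ d → ∑-mono J λ m → split-≤ T y m d) ⟩
        T * (∑[ d ∈ J ] ∑[ m ∈ J ] (p 0 (suc T ∸ d) * δ (y + m * d) + I (m * T) * δ (y + m * d)))
          ≡⟨ cong (T *_) (trans (∑-cong J λ d → ∑-+ _ _ J) (∑-+ _ _ J)) ⟩
        T * ((∑[ d ∈ J ] ∑[ m ∈ J ] p 0 (suc T ∸ d) * δ (y + m * d)) + (∑[ d ∈ J ] ∑[ m ∈ J ] I (m * T) * δ (y + m * d)))
          ≤⟨ *-monoʳ-≤ T (+-mono-≤ first second) ⟩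
        T * (T + act T I 0)
          ≡⟨ *-distribˡ-+ T T _ ⟩
        T * T + T * act T I 0
          ≤⟨ +-monoʳ-≤ (T * T) (le-≤ T 0) ⟩
        T * T + n ∎
        where
        open ≤-Reasoning
        J = interval 0 n
        first : (∑[ d ∈ J ] ∑[ m ∈ J ] p 0 (suc T ∸ d) * δ (y + m * d)) ≤ T
        first = begin
          (∑[ d ∈ J ] ∑[ m ∈ J ] p 0 (suc T ∸ d) * δ (y + m * d))
            ≡⟨ ∑-cong J (λ d → ∑-*ˡ (p 0 (suc T ∸ d)) _ J) ⟩
          (∑[ d ∈ J ] p 0 (suc T ∸ d) * act d δ y)
            ≤⟨ ∑-interval-mono 0 n (λ d → ≤-trans (*-monoʳ-≤ (p 0 (suc T ∸ suc d)) (act-δ≤1 (suc d) y (s≤s z≤n)))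
                                                   (≤-reflexive (*-identityʳ _))) ⟩
          (∑[ d ∈ J ] p 0 (suc T ∸ d))
            ≤⟨ ∑-initial T ⟩
          T ∎
        second : (∑[ d ∈ J ] ∑[ m ∈ J ] I (m * T) * δ (y + m * d)) ≤ act T I 0
        second = begin
          (∑[ d ∈ J ] ∑[ m ∈ J ] I (m * T) * δ (y + m * d))
            ≡⟨ ∑-swap _ J J ⟩
          (∑[ m ∈ J ] ∑[ d ∈ J ] I (m * T) * δ (y + m * d))
            ≡⟨ ∑-cong J (λ m → trans (∑-*ˡ (I (m * T)) _ J) (cong (I (m * T) *_) (∑-cong J λ d → cong (λ v → δ (y + v)) (*-comm m d)))) ⟩
          (∑[ m ∈ J ] I (m * T) * act m δ y)
            ≤⟨ ∑-interval-mono 0 n (λ m → ≤-trans (*-monoʳ-≤ (I (suc m * T)) (act-δ≤1 (suc m) y (s≤s z≤n)))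
                                                   (≤-reflexive (*-identityʳ _))) ⟩
          act T I 0 ∎

    -- One size divides what the others leave over, so it costs T + n / T instead of `R`.
    ∑-tuples-δ : ∀ T j → T * (∑[ ds ∈ tuples (suc j) ] cnt ds δ 0) ≤ (T * T + n) * R ^ j
    ∑-tuples-δ T j = begin
      T * (∑[ ds ∈ tuples (suc j) ] cnt ds δ 0)
        ≡⟨ cong (T *_) (∑-chains _ j (λ xs → cnt xs δ 0)) ⟩
      T * (∑[ xs ∈ tuples j ] ∑[ d ∈ interval 0 n ] act d (cnt xs δ) 0)
        ≡⟨ cong (T *_) (∑-cong (tuples j) λ xs → trans (∑-cong (interval 0 n) λ d → cnt-act xs d δ 0)
                                                       (sym (cnt-∑ xs (interval 0 n) (λ d → act d δ) 0))) ⟩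
      T * (∑[ xs ∈ tuples j ] cnt xs (rect δ) 0)
        ≤⟨ ∑-tuples-≤ T (T * T + n) (rect δ) (rect-δ T) j 0 ⟩
      (T * T + n) * R ^ j * P 0 0
        ≤⟨ *-monoʳ-≤ ((T * T + n) * R ^ j) (P≤1 0) ⟩
      (T * T + n) * R ^ j * 1
        ≡⟨ *-identityʳ _ ⟩
      (T * T + n) * R ^ j ∎
      where open ≤-Reasoning

    -- The operators commute, so the consecutive sizes can be summed out before all others.
    cnt-pair : ∀ es t fs y → cnt (es ++ suc t ∷ t ∷ fs) δ y ≡ cnt (es ++ fs) (pair t) y
    cnt-pair es t fs y = begin
      cnt (es ++ suc t ∷ t ∷ fs) δ y  ≡⟨ cnt-++ es (suc t ∷ t ∷ fs) δ y ⟩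
      cnt es (act (suc t) (act t (cnt fs δ))) y  ≡⟨ cnt-cong es (act-cong (suc t) (cnt-act fs t δ)) y ⟩
      cnt es (act (suc t) (cnt fs (act t δ))) y  ≡⟨ cnt-cong es (cnt-act fs (suc t) (act t δ)) y ⟩
      cnt es (cnt fs (pair t)) y  ≡⟨ cnt-++ es fs (pair t) y ⟨
      cnt (es ++ fs) (pair t) y  ∎
      where open ≡-Reasoning

    -- The order of the sizes is ignored; the saving of 1 / T comes from `∑-pair-≤` alone.
    ∑-tail-≤ : ∀ T f i j →
      suc T * (∑[ es ∈ tuples i ] ∑[ t ∈ interval T f ] ∑[ fs ∈ tuples j ] cnt (es ++ suc t ∷ t ∷ fs) δ 0)
        ≤ n * R ^ j * R ^ i
    ∑-tail-≤ T f i j = begin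
      suc T * (∑[ es ∈ tuples i ] ∑[ t ∈ interval T f ] ∑[ fs ∈ tuples j ] cnt (es ++ suc t ∷ t ∷ fs) δ 0)
        ≡⟨ cong (suc T *_) (∑-cong (tuples i) inner) ⟩
      suc T * (∑[ es ∈ tuples i ] cnt es g 0)
        ≤⟨ ∑-tuples-≤ (suc T) (n * R ^ j) g (∑-tuples-≤ (suc T) n _ (∑-pair-≤ T f) j) i 0 ⟩
      n * R ^ j * R ^ i * P 0 0
        ≤⟨ *-monoʳ-≤ (n * R ^ j * R ^ i) (P≤1 0) ⟩
      n * R ^ j * R ^ i * 1
        ≡⟨ *-identityʳ _ ⟩
      n * R ^ j * R ^ i ∎
      where
      open ≤-Reasoning
      g : ℕ → ℕ
      g y = ∑[ fs ∈ tuples j ] cnt fs (λ z → ∑[ t ∈ interval T f ] pair t z) y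
      inner : ∀ es → (∑[ t ∈ interval T f ] ∑[ fs ∈ tuples j ] cnt (es ++ suc t ∷ t ∷ fs) δ 0) ≡ cnt es g 0
      inner es = trans (∑-swap _ (interval T f) (tuples j)) (trans
        (∑-cong (tuples j) λ fs → trans
          (∑-cong (interval T f) λ t → trans (cnt-pair es t fs 0) (cnt-++ es fs (pair t) 0))
          (trans (sym (cnt-∑ es (interval T f) (λ t → cnt fs (pair t)) 0))
                 (cnt-cong es (λ y → sym (cnt-∑ fs (interval T f) pair y)) 0)))
        (sym (cnt-∑ es (tuples j) (λ fs → cnt fs (λ z → ∑[ t ∈ interval T f ] pair t z)) 0)))

    -- The count for fixed sizes.

    P0-0≤ : ∀ j → P j 0 ≤ n ^ j
    P0-0≤ j = p≤^ j n

    private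
      -- Bernoulli's inequality for (n - s) ^ j, cleared of denominators.
      power-loss : ∀ j s → n ^ suc j ≤ n * P j s + suc j * s * n ^ j
      power-loss j s = begin
        n ^ suc j  ≡⟨ p-suc j n ⟨
        p (suc j) n  ≤⟨ p-step-≥ j n s ⟩
        suc j * s * p j n + p (suc j) (n ∸ s)  ≤⟨ +-mono-≤ (*-monoʳ-≤ (suc j * s) (p≤^ j n)) (aux (m∸n≤m n s)) ⟩
        suc j * s * n ^ j + n * P j s  ≡⟨ +-comm _ (n * P j s) ⟩
        n * P j s + suc j * s * n ^ j  ∎
        where
        open ≤-Reasoning
        aux : ∀ {x} → x ≤ n → p (suc j) x ≤ n * p j x
        aux {zero}  h = z≤n
        aux {suc x} h = *-monoˡ-≤ (suc x ^ j) h

    -- cnt ds δ 0 = n ^ j / (j ! ∏ ds) · (1 + O((s + w) / n)) for a list ds of j + 1 parts.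
    record Estimate (ds : List ℕ) (j w s : ℕ) : Set where
      field
        upper : n * (j ! * product ds * cnt ds δ 0) ≤ n ^ suc j + w * n ^ j
        lower : n ^ suc j ≤ n * (j ! * product ds * cnt ds δ 0) + suc j * s * n ^ j + w * n ^ j

    estimate-weaken : ∀ {ds j w w′ s s′} → w ≤ w′ → s ≤ s′ → Estimate ds j w s → Estimate ds j w′ s′
    estimate-weaken {ds} {j} {w} {w′} {s} {s′} hw hs e = record
      { upper = ≤-trans upper (+-monoʳ-≤ (n ^ suc j) (*-monoˡ-≤ (n ^ j) hw))
      ; lower = ≤-trans lower (+-mono-≤ (+-monoʳ-≤ (n * (j ! * product ds * cnt ds δ 0))
                  (*-monoˡ-≤ (n ^ j) (*-monoʳ-≤ (suc j) hs))) (*-monoˡ-≤ (n ^ j) hw)) }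
      where open Estimate e

    act-1-δ : ∀ y → act 1 δ y ≡ P 0 y
    act-1-δ y = begin
      ∑ (interval 0 n) φ  ≡⟨ +-identityʳ _ ⟨
      ∑ (interval 0 n) φ + 0  ≡⟨ cong (∑ (interval 0 n) φ +_) (P-≥ 0 (≤-trans (≤-reflexive (sym (*-identityʳ n))) (m≤n+m (n * 1) y))) ⟨
      ∑ (interval 0 n) φ + ψ n  ≡⟨ ≤-antisym (telescope-≤ φ ψ (λ m → ≤-reflexive (sym (step m))) 0 n)
                                                     (telescope-≥ φ ψ (λ m → ≤-reflexive (step m)) 0 n) ⟩
      ψ 0  ≡⟨ cong (P 0) (+-identityʳ y) ⟩
      P 0 y  ∎
      where
      open ≡-Reasoning
      φ ψ : ℕ → ℕ
      φ m = δ (y + m * 1)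
      ψ m = P 0 (y + m * 1)
      step : ∀ m → ψ m ≡ φ (suc m) + ψ (suc m)
      step m = subst (λ v → ψ m ≡ δ v + P 0 v) (sym (+-suc y (m * 1))) (P-δ (y + m * 1))

    -- The case c = 1: the forced size is d₀ + 1 = 1, which by itself turns `δ` into the smooth
    -- function `P 0`.
    estimate-1 : ∀ es → All (1 ≤_) es → Estimate (es ++ 1 ∷ []) (length es) 0 (sum es)
    estimate-1 es pos = record
      { upper = begin
          n * (j ! * product (es ++ 1 ∷ []) * cnt (es ++ 1 ∷ []) δ 0)  ≡⟨ cong (n *_) same ⟩
          n * (j ! * product es * cnt es (P 0) 0)  ≤⟨ *-monoʳ-≤ n bound ⟩
          n * P j 0  ≤⟨ *-monoʳ-≤ n (P0-0≤ j) ⟩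
          n * n ^ j  ≡⟨ +-identityʳ _ ⟨
          n ^ suc j + 0 * n ^ j  ∎
      ; lower = begin
          n ^ suc j  ≤⟨ power-loss j (sum es) ⟩
          n * P j (sum es) + E  ≤⟨ +-monoˡ-≤ E (*-monoʳ-≤ n bound′) ⟩
          n * (j ! * product es * cnt es (P 0) 0) + E  ≡⟨ cong (λ v → n * v + E) same ⟨
          n * (j ! * product (es ++ 1 ∷ []) * cnt (es ++ 1 ∷ []) δ 0) + E  ≡⟨ +-identityʳ _ ⟨
          n * (j ! * product (es ++ 1 ∷ []) * cnt (es ++ 1 ∷ []) δ 0) + E + 0 * n ^ j ∎ }
      where
      open ≤-Reasoning
      j = length es
      E = suc j * sum es * n ^ j
      same : j ! * product (es ++ 1 ∷ []) * cnt (es ++ 1 ∷ []) δ 0 ≡ j ! * product es * cnt es (P 0) 0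
      same = cong₂ (λ a b → j ! * a * b) (trans (product-++ es (1 ∷ [])) (*-identityʳ (product es)))
        (trans (cnt-++ es (1 ∷ []) δ 0) (cnt-cong es act-1-δ 0))
      bound : j ! * product es * cnt es (P 0) 0 ≤ P j 0
      bound = subst (λ i → i ! * product es * cnt es (P 0) 0 ≤ P i 0) (+-identityʳ j)
        (≤-trans (cnt-P-≤ es 0 0) (≤-reflexive (*-identityˡ _)))
      bound′ : P j (sum es) ≤ j ! * product es * cnt es (P 0) 0
      bound′ = subst (λ i → P i (sum es) ≤ i ! * product es * cnt es (P 0) 0) (+-identityʳ j)
        (≤-trans (≤-reflexive (sym (*-identityˡ _))) (cnt-P-≥ es 0 0 pos))

    private
      module Pair (t : ℕ) (1≤t : 1 ≤ t) (os : List ℕ) (pos : All (1 ≤_) os) where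
        open ≤-Reasoning
        r q N : ℕ
        r = length os
        q = t * suc t
        N = suc r ! * product os * (q * cnt os (pair t) 0)

        cnt-P1 : suc r ! * product os * cnt os (P 1) 0 ≤ n ^ suc r
        cnt-P1 = ≤-trans (subst (λ i → i ! * product os * cnt os (P 1) 0 ≤ 1 * P i 0) (+-comm r 1) (cnt-P-≤ os 1 0))
          (≤-trans (≤-reflexive (*-identityˡ _)) (P0-0≤ (suc r)))

        cnt-P0 : suc r ! * product os * (q * cnt os (P 0) 0) ≤ q * suc r * n ^ r
        cnt-P0 = begin
          suc r * r ! * product os * (q * cnt os (P 0) 0)
            ≡⟨ lem (suc r) (r !) (product os) q _ ⟩
          q * suc r * (r ! * product os * cnt os (P 0) 0)
            ≤⟨ *-monoʳ-≤ (q * suc r) (subst (λ i → i ! * product os * cnt os (P 0) 0 ≤ 1 * P i 0) (+-identityʳ r) (cnt-P-≤ os 0 0)) ⟩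
          q * suc r * (1 * P r 0)
            ≤⟨ *-monoʳ-≤ (q * suc r) (≤-trans (≤-reflexive (*-identityˡ _)) (P0-0≤ r)) ⟩
          q * suc r * n ^ r ∎
          where
          lem : ∀ a b c d e → a * b * c * (d * e) ≡ d * a * (b * c * e)
          lem = solve-∀

        pair-upper : N ≤ n ^ suc r + q * suc r * n ^ r
        pair-upper = begin
          N
            ≡⟨ cong (c *_) (cnt-*ˡ os q (pair t) 0) ⟨
          c * cnt os (λ z → q * pair t z) 0
            ≤⟨ *-monoʳ-≤ c (cnt-mono os (λ y → pair-≤ t y 1≤t) 0) ⟩
          c * cnt os (λ z → P 1 z + q * P 0 z) 0
            ≡⟨ cong (c *_) (trans (cnt-+ os _ _ 0) (cong (cnt os (P 1) 0 +_) (cnt-*ˡ os q (P 0) 0))) ⟩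
          c * (cnt os (P 1) 0 + q * cnt os (P 0) 0)
            ≡⟨ *-distribˡ-+ c _ _ ⟩
          c * cnt os (P 1) 0 + c * (q * cnt os (P 0) 0)
            ≤⟨ +-mono-≤ cnt-P1 cnt-P0 ⟩
          n ^ suc r + q * suc r * n ^ r ∎
          where c = suc r ! * product os

        pair-lower : P (suc r) (sum os) ≤ N + q * suc r * n ^ r
        pair-lower = begin
          P (suc r) (sum os)
            ≡⟨ *-identityˡ _ ⟨
          1 * P (suc r) (sum os)
            ≤⟨ subst (λ i → 1 * P i (sum os) ≤ i ! * product os * cnt os (P 1) 0) (+-comm r 1) (cnt-P-≥ os 1 0 pos) ⟩
          c * cnt os (P 1) 0
            ≤⟨ *-monoʳ-≤ c (cnt-mono os (λ y → pair-≥ t y 1≤t) 0) ⟩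
          c * cnt os (λ z → q * pair t z + q * P 0 z) 0
            ≡⟨ cong (c *_) (trans (cnt-+ os _ _ 0) (cong₂ _+_ (cnt-*ˡ os q (pair t) 0) (cnt-*ˡ os q (P 0) 0))) ⟩
          c * (q * cnt os (pair t) 0 + q * cnt os (P 0) 0)
            ≡⟨ *-distribˡ-+ c _ _ ⟩
          N + c * (q * cnt os (P 0) 0)
            ≤⟨ +-monoʳ-≤ N cnt-P0 ⟩
          N + q * suc r * n ^ r ∎
          where c = suc r ! * product os

    -- The forced pair turns `δ` into `P 1` over t (t + 1), up to an error `P 0`. Summing over the r
    -- remaining sizes gives powers n ^ (r + 1) and n ^ r respectively.
    estimate-pair : ∀ t es fs → 1 ≤ t → All (1 ≤_) (es ++ fs) →
      Estimate (es ++ suc t ∷ t ∷ fs) (suc (length (es ++ fs)))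
               (t * suc t * suc (length (es ++ fs))) (sum (es ++ suc t ∷ t ∷ fs))
    estimate-pair t es fs 1≤t pos = record
      { upper = begin
          n * (suc r ! * product ds * cnt ds δ 0)  ≡⟨ cong (n *_) same ⟩
          n * N  ≤⟨ *-monoʳ-≤ n pair-upper ⟩
          n * (n ^ suc r + q * suc r * n ^ r)  ≡⟨ lem n (n ^ suc r) (q * suc r) (n ^ r) ⟩
          n * n ^ suc r + q * suc r * (n * n ^ r)  ∎
      ; lower = begin
          n ^ suc (suc r)  ≤⟨ power-loss (suc r) (sum os) ⟩
          n * P (suc r) (sum os) + suc (suc r) * sum os * n ^ suc r
            ≤⟨ +-mono-≤ (*-monoʳ-≤ n pair-lower) (*-monoˡ-≤ (n ^ suc r) (*-monoʳ-≤ (suc (suc r)) sum≤)) ⟩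
          n * (N + q * suc r * n ^ r) + E  ≡⟨ lem′ n N (q * suc r) (n ^ r) E ⟩
          n * N + E + q * suc r * (n * n ^ r)  ≡⟨ cong (λ v → n * v + E + q * suc r * n ^ suc r) same ⟨
          n * (suc r ! * product ds * cnt ds δ 0) + E + q * suc r * n ^ suc r ∎ }
      where
      os = es ++ fs
      ds = es ++ suc t ∷ t ∷ fs
      open Pair t 1≤t os pos
      open ≤-Reasoning
      E = suc (suc r) * sum ds * n ^ suc r
      lem : ∀ n a b c → n * (a + b * c) ≡ n * a + b * (n * c)
      lem = solve-∀
      lem′ : ∀ n a b c e → n * (a + b * c) + e ≡ n * a + e + b * (n * c)
      lem′ = solve-∀
      sum≤ : sum os ≤ sum ds
      sum≤ = begin
        sum (es ++ fs)  ≡⟨ sum-++ es fs ⟩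
        sum es + sum fs  ≤⟨ +-monoʳ-≤ (sum es) (≤-trans (m≤n+m (sum fs) t) (m≤n+m _ (suc t))) ⟩
        sum es + (suc t + (t + sum fs))  ≡⟨ sum-++ es (suc t ∷ t ∷ fs) ⟨
        sum ds  ∎
      prod : product ds ≡ product os * q
      prod = trans (product-++ es (suc t ∷ t ∷ fs)) (trans (lem″ (product es) t (product fs)) (cong (_* q) (sym (product-++ es fs))))
        where
        lem″ : ∀ a t b → a * (suc t * (t * b)) ≡ a * b * (t * suc t)
        lem″ = solve-∀
      same : suc r ! * product ds * cnt ds δ 0 ≡ N
      same = trans (cong₂ (λ a b → suc r ! * a * b) prod (cnt-pair es t fs 0))
        (lem‴ (suc r !) (product os) q _)
        where
        lem‴ : ∀ a b c d → a * (b * c) * d ≡ a * b * (c * d)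
        lem‴ = solve-∀

module Avoidance where

  open import Data.Bool.Base using (Bool; true; false; T; if_then_else_)
  open import Data.Nat.Base
  open import Data.Nat.Properties
  open import Data.Nat.ListAction using (sum)
  open import Data.Nat.ListAction.Properties using (sum-++)
  open import Data.List.Base using (List; []; _∷_; _++_; length; map; concatMap; filter; replicate)
  open import Data.List.Properties using (length-++; length-map; ++-cancelˡ; filter-accept; ∷-injectiveˡ; ∷-injectiveʳ)
  open import Data.List.Membership.Propositional using (_∈_)
  open import Data.List.Membership.Propositional.Properties
    using (∈-map⁺; ∈-map⁻; ∈-concatMap⁺; ∈-concatMap⁻; ∈-filter⁻; ∈-++⁺ˡ; ∈-++⁺ʳ; ∈-++⁻; ∈-∃++)
  open import Data.List.Relation.Unary.All as All using (All; []; _∷_)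
  import Data.List.Relation.Unary.All.Properties as All
  open import Data.List.Relation.Unary.Any as Any using (Any; here; there)
  open import Data.List.Relation.Unary.AllPairs as AllPairs using (AllPairs; []; _∷_)
  open import Data.List.Relation.Unary.Linked using (Linked; []; [-]; _∷_)
  open import Data.List.Relation.Unary.Linked.Properties using (Linked⇒AllPairs)
  open import Data.List.Relation.Unary.Unique.Propositional using (Unique)
  import Data.List.Relation.Unary.Unique.Propositional.Properties as Unique
  open import Data.Product.Base using (∃-syntax; _×_; _,_; proj₁; proj₂)
  open import Data.Sum.Base using (_⊎_; inj₁; inj₂)
  open import Data.Vec.Base using ([]; _∷_)
  open import Data.Fin.Subset using (Subset)
  open import Function.Base using (_∘_)
  open import Function.Bundles using (Equivalence)
  open import Relation.Nullary using (¬_; yes; no; contradiction)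
  open import Relation.Binary.PropositionalEquality hiding (J)
  open FiniteSums
  open import Defs using (Partition; mkPartition; parts; decreasing; positive; parts-injective; Contains; keepColumns; keepRows; entry; Enumeration; Av)

  private variable
    A B X Y : Set

  -- Membership and uniqueness in lists.

  ∈-interval⁺ : ∀ {d} u f → u < d → d ≤ u + f → d ∈ interval u f
  ∈-interval⁺ {d} u zero    u<d d≤ = contradiction (≤-trans u<d (subst (d ≤_) (+-identityʳ u) d≤)) (<-irrefl refl)
  ∈-interval⁺ {d} u (suc f) u<d d≤ with m≤n⇒m<n∨m≡n u<d
  ... | inj₁ u+1<d = there (∈-interval⁺ (suc u) f u+1<d (subst (d ≤_) (+-suc u f) d≤))
  ... | inj₂ refl  = here refl

  ∈-interval⁻ : ∀ {d} u f → d ∈ interval u f → u < d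
  ∈-interval⁻ u (suc f) (here refl) = ≤-refl
  ∈-interval⁻ u (suc f) (there h)   = <⇒≤ (∈-interval⁻ (suc u) f h)

  ∈-interval⁻-≤ : ∀ {d} u f → d ∈ interval u f → d ≤ u + f
  ∈-interval⁻-≤ u (suc f) (here refl) = ≤-trans (s≤s (m≤m+n u f)) (≤-reflexive (sym (+-suc u f)))
  ∈-interval⁻-≤ u (suc f) (there h)   = ≤-trans (∈-interval⁻-≤ (suc u) f h) (≤-reflexive (sym (+-suc u f)))

  interval-unique : ∀ u f → Unique (interval u f)
  interval-unique u zero    = []
  interval-unique u (suc f) =
    All.tabulate (λ {d} h → <⇒≢ (∈-interval⁻ (suc u) f h)) ∷ interval-unique (suc u) f

  unique-concatMap : ∀ (f : A → List B) {xs} → Unique xs → (∀ {x} → x ∈ xs → Unique (f x)) →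
    (∀ {x y z} → x ∈ xs → y ∈ xs → z ∈ f x → z ∈ f y → x ≡ y) → Unique (concatMap f xs)
  unique-concatMap f []            _   _   = []
  unique-concatMap f {x ∷ xs} (x∉ ∷ u) inner key =
    Unique.++⁺ (inner (here refl)) (unique-concatMap f u (inner ∘ there) λ a b → key (there a) (there b))
      λ (z∈fx , z∈rest) → let y , y∈ , z∈fy = find (∈-concatMap⁻ f z∈rest) in
        All.lookup x∉ y∈ (key (here refl) (there y∈) z∈fx z∈fy)
    where
    find : ∀ {P : A → Set} {xs} → Any P xs → ∃[ y ] (y ∈ xs × P y)
    find (here p)  = _ , here refl , p
    find (there a) = let y , y∈ , p = find a in y , there y∈ , p

  length-⊆ : ∀ {xs ys : List A} → Unique xs → (∀ {x} → x ∈ xs → x ∈ ys) → length xs ≤ length ys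
  length-⊆ {xs = []}     _        _  = z≤n
  length-⊆ {xs = x ∷ xs} (x∉ ∷ u) xs⊆ with ∈-∃++ (xs⊆ (here refl))
  ... | as , bs , refl = begin
    suc (length xs)  ≤⟨ s≤s (length-⊆ u rest) ⟩
    suc (length (as ++ bs))  ≡⟨ cong suc (length-++ as) ⟩
    suc (length as + length bs)  ≡⟨ +-suc (length as) (length bs) ⟨
    length as + suc (length bs)  ≡⟨ length-++ as ⟨
    length (as ++ x ∷ bs)  ∎
    where
    open ≤-Reasoning
    rest : ∀ {y} → y ∈ xs → y ∈ as ++ bs
    rest {y} y∈ with ∈-++⁻ as (xs⊆ (there y∈))
    ... | inj₁ y∈as         = ∈-++⁺ˡ y∈as
    ... | inj₂ (here y≡x)   = contradiction (sym y≡x) (All.lookup x∉ y∈)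
    ... | inj₂ (there y∈bs) = ∈-++⁺ʳ as y∈bs

  -- Sets of part sizes.

  -- Sizes are listed with the largest first. The default is the convention d₀ = 0, which makes 1
  -- the forced value at rank 1.
  head0 : List ℕ → ℕ
  head0 []      = 0
  head0 (x ∷ _) = x

  data Descending : List ℕ → Set where
    []  : Descending []
    _∷_ : ∀ {x xs} → head0 xs < x → Descending xs → Descending (x ∷ xs)

  descending-≤ : ∀ {xs} → Descending xs → All (_≤ head0 xs) xs
  descending-≤ []       = []
  descending-≤ (h ∷ ds) = ≤-refl ∷ All.map (λ p → ≤-trans p (<⇒≤ h)) (descending-≤ ds)

  descending-pos : ∀ {xs} → Descending xs → All (1 ≤_) xs
  descending-pos []       = []
  descending-pos (h ∷ ds) = ≤-trans (s≤s z≤n) h ∷ descending-pos ds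

  -- Ranks are counted from the smallest entry, starting at 1.
  data Good (free : ℕ → Bool) : List ℕ → Set where
    []   : Good free []
    cons : ∀ {x xs} → head0 xs < x → free (suc (length xs)) ≡ true ⊎ x ≡ suc (head0 xs) →
           Good free xs → Good free (x ∷ xs)

  good-descending : ∀ {free xs} → Good free xs → Descending xs
  good-descending []           = []
  good-descending (cons h _ g) = h ∷ good-descending g

  -- Choosing rows and columns.

  keepColumns-zero : ∀ {w} (C : Subset w) → keepColumns C 0 ≡ 0
  keepColumns-zero []      = refl
  keepColumns-zero (c ∷ C) = refl

  keepColumns-mono : ∀ {w} (C : Subset w) {m m′} → m ≤ m′ → keepColumns C m ≤ keepColumns C m′
  keepColumns-mono []          _       = z≤n
  keepColumns-mono (c ∷ C)     z≤n     = z≤n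
  keepColumns-mono (true ∷ C)  (s≤s h) = s≤s (keepColumns-mono C h)
  keepColumns-mono (false ∷ C) (s≤s h) = keepColumns-mono C h

  keepColumns-suc : ∀ {w} (C : Subset w) m → keepColumns C (suc m) ≤ suc (keepColumns C m)
  keepColumns-suc []          m       = z≤n
  keepColumns-suc (true ∷ C)  zero    = s≤s (≤-reflexive (keepColumns-zero C))
  keepColumns-suc (false ∷ C) zero    = ≤-trans (≤-reflexive (keepColumns-zero C)) z≤n
  keepColumns-suc (true ∷ C)  (suc m) = s≤s (keepColumns-suc C m)
  keepColumns-suc (false ∷ C) (suc m) = keepColumns-suc C m

  keepRows-⊆ : ∀ rows R {x} → x ∈ keepRows rows R → x ∈ rows
  keepRows-⊆ []       []          ()
  keepRows-⊆ (x ∷ xs) (true ∷ R)  (here e)  = here e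
  keepRows-⊆ (x ∷ xs) (true ∷ R)  (there h) = there (keepRows-⊆ xs R h)
  keepRows-⊆ (x ∷ xs) (false ∷ R) h         = there (keepRows-⊆ xs R h)

  columns : (ℕ → ℕ) → ∀ w → Subset w
  columns κ zero    = []
  columns κ (suc w) = (κ 0 <ᵇ κ 1) ∷ columns (κ ∘ suc) w

  -- `κ` grows by 0 or 1 at each step, so its jumps form a set of columns with `κ` as counting
  -- function. The summand `κ 0` is there for the induction, which shifts `κ`.
  keepColumns-columns : ∀ w κ → (∀ m → κ m ≤ κ (suc m)) → (∀ m → κ (suc m) ≤ suc (κ m)) →
                        ∀ {m} → m ≤ w → κ 0 + keepColumns (columns κ w) m ≡ κ m
  keepColumns-columns w       κ mono lip {zero}  _ =
    trans (cong (κ 0 +_) (keepColumns-zero (columns κ w))) (+-identityʳ (κ 0))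
  keepColumns-columns (suc w) κ mono lip {suc m} (s≤s h) with κ 0 <ᵇ κ 1 in eq
  ... | true = trans (+-suc (κ 0) _) (trans (cong (_+ keepColumns (columns (κ ∘ suc) w) m) (≤-antisym (<ᵇ⇒< (κ 0) (κ 1) (subst T (sym eq) _)) (lip 0)))
                   (keepColumns-columns w (κ ∘ suc) (mono ∘ suc) (lip ∘ suc) h))
  ... | false = trans (cong (_+ keepColumns (columns (κ ∘ suc) w) m) (≤-antisym (mono 0) (≮⇒≥ λ lt → subst T eq (<⇒<ᵇ lt))))
                   (keepColumns-columns w (κ ∘ suc) (mono ∘ suc) (lip ∘ suc) h)

  noRows : (xs : List ℕ) → Subset (length xs)
  noRows []       = []
  noRows (x ∷ xs) = false ∷ noRows xs

  keepRows-noRows : ∀ xs → keepRows xs (noRows xs) ≡ []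
  keepRows-noRows []       = refl
  keepRows-noRows (x ∷ xs) = keepRows-noRows xs

  -- Greedy choice from the top: a row is kept iff its image is the next value wanted. As `f` is
  -- monotone and `ys` strictly decreasing, a kept row is not wanted again and a rejected one is not
  -- wanted later.
  select-rows : ∀ (f : ℕ → ℕ) → (∀ {a b} → a ≤ b → f a ≤ f b) → ∀ xs ys →
    AllPairs _≥_ xs → AllPairs _>_ ys → All (0 <_) ys →
    All (λ y → ∃[ x ] (x ∈ xs × f x ≡ y)) ys →
    ∃[ R ] filter (0 <?_) (map f (keepRows xs R)) ≡ ys
  select-rows f f-mono xs [] _ _ _ _ = noRows xs , cong (filter (0 <?_) ∘ map f) (keepRows-noRows xs)
  select-rows f f-mono [] (y ∷ ys) _ _ _ ((_ , () , _) ∷ _)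
  select-rows f f-mono (x ∷ xs) (y ∷ ys) (x≥ ∷ dx) (y> ∷ dy) (0<y ∷ 0<ys) (hit ∷ hits) with f x ≟ y
  ... | yes refl = true ∷ proj₁ rec , equation (proj₂ rec)
    where
    later : ∀ {z} → z ∈ ys → ∃[ w ] (w ∈ x ∷ xs × f w ≡ z) → ∃[ w ] (w ∈ xs × f w ≡ z)
    later z∈ (w , here refl , e) = contradiction (sym e) (<⇒≢ (All.lookup y> z∈))
    later z∈ (w , there w∈ , e)  = w , w∈ , e
    rec = select-rows f f-mono xs ys dx dy 0<ys (All.tabulate λ z∈ → later z∈ (All.lookup hits z∈))
    equation : ∀ {R} → filter (0 <?_) (map f (keepRows xs R)) ≡ ys →
               filter (0 <?_) (f x ∷ map f (keepRows xs R)) ≡ f x ∷ ys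
    equation e = trans (filter-accept (0 <?_) 0<y) (cong (f x ∷_) e)
  ... | no fx≢y = false ∷ proj₁ rec , proj₂ rec
    where
    first : ∃[ w ] (w ∈ x ∷ xs × f w ≡ y) → ∃[ w ] (w ∈ xs × f w ≡ y)
    first (w , here refl , e) = contradiction e fx≢y
    first (w , there w∈ , e)  = w , w∈ , e
    hit′ = first hit
    later : ∀ {z} → z ∈ ys → ∃[ w ] (w ∈ x ∷ xs × f w ≡ z) → ∃[ w ] (w ∈ xs × f w ≡ z)
    later z∈ (w , there w∈ , e)  = w , w∈ , e
    later z∈ (w , here refl , e) with hit′
    ... | v , v∈ , e′ = contradiction (≤-trans (≤-reflexive (sym e′)) (≤-trans (f-mono (All.lookup x≥ v∈)) (≤-reflexive e)))
                          (<⇒≱ (All.lookup y> z∈))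
    rec = select-rows f f-mono xs (y ∷ ys) dx (y> ∷ dy) (0<y ∷ 0<ys)
            (hit′ ∷ All.tabulate λ z∈ → later z∈ (All.lookup hits z∈))

  parts-≥ : ∀ α → AllPairs _≥_ (parts α)
  parts-≥ α = Linked⇒AllPairs (λ a b → ≤-trans b a) (decreasing α)

  parts≤part0 : ∀ xs → AllPairs _≥_ xs → All (_≤ entry xs 0) xs
  parts≤part0 []       _       = []
  parts≤part0 (x ∷ xs) (h ∷ _) = ≤-refl ∷ h

  -- Containment in terms of the set of part sizes.

  module Containment (μ : Partition) (strict : Unique (parts μ)) (k : ℕ)
                     (parts≤ : All (_≤ suc k) (parts μ)) (top : suc k ∈ parts μ)
                     (free : ℕ → Bool)
                     (free-true : ∀ {i} → free i ≡ true → i ∈ parts μ)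
                     (free-false : ∀ {i} → free i ≡ false → ¬ i ∈ parts μ) where

    private
      μ-descending : AllPairs _>_ (parts μ)
      μ-descending = AllPairs.zipWith (λ (y≤x , x≢y) → ≤∧≢⇒< y≤x (x≢y ∘ sym)) (parts-≥ μ , strict)

    -- κ m stands for the number of kept columns among the first m.
    record Reach (ds : List ℕ) (s : ℕ) : Set where
      field
        κ      : ℕ → ℕ
        κ-zero : κ 0 ≡ 0
        mono   : ∀ m → κ m ≤ κ (suc m)
        lip    : ∀ m → κ (suc m) ≤ suc (κ m)
        stable : ∀ m → head0 ds ≤ m → κ m ≡ s
        hits   : ∀ i → i ∈ parts μ → i ≤ s → ∃[ d ] (d ∈ ds × κ d ≡ i)

    reach-[] : Reach [] 0
    reach-[] = record
      { κ = λ _ → 0 ; κ-zero = refl ; mono = λ _ → z≤n ; lip = λ _ → z≤n ; stable = λ _ _ → refl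
      ; hits = λ i i∈ i≤0 → contradiction (≤-trans (All.lookup (positive μ) i∈) i≤0) λ () }

    -- The last `suc g` columns up to the new size are kept, which sends this size to `s + suc g`;
    -- the earlier sizes end at or before `b` and are unaffected. The conclusion `s ≡ i` contradicts
    -- `s < i`, so the hypothesis says that no part of μ is jumped over.
    reach-∷ : ∀ {ds s} b g → Descending ds → head0 ds ≤ b → (∀ i → i ∈ parts μ → s < i → i < s + suc g → s ≡ i) →
              Reach ds s → Reach (b + suc g ∷ ds) (s + suc g)
    reach-∷ {ds} {s} b g desc h≤b skip r = record
      { κ = κ′
      ; κ-zero = trans (cong₂ _+_ κ-zero (cong (suc g ⊓_) (0∸n≡0 b))) refl
      ; mono = λ m → +-mono-≤ (mono m) (⊓-monoʳ-≤ (suc g) (∸-monoˡ-≤ b (n≤1+n m)))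
      ; lip = lip′
      ; stable = λ m h → cong₂ _+_ (stable m (≤-trans h≤b (≤-trans (m≤m+n b (suc g)) h)))
          (m≤n⇒m⊓n≡m (subst (_≤ m ∸ b) (m+n∸m≡n b (suc g)) (∸-monoˡ-≤ b h)))
      ; hits = hits′ }
      where
      open Reach r
      κ′ : ℕ → ℕ
      κ′ m = κ m + (suc g ⊓ (m ∸ b))
      lip′ : ∀ m → κ′ (suc m) ≤ suc (κ′ m)
      lip′ m with ≤-<-connex b m
      ... | inj₁ b≤m rewrite +-∸-assoc 1 b≤m | stable m (≤-trans h≤b b≤m) | stable (suc m) (≤-trans h≤b (≤-trans b≤m (n≤1+n m))) =
        ≤-trans (+-monoʳ-≤ s (s≤s (⊓-monoˡ-≤ (m ∸ b) (n≤1+n g)))) (≤-reflexive (+-suc s _))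
      ... | inj₂ m<b rewrite m≤n⇒m∸n≡0 m<b | m≤n⇒m∸n≡0 (<⇒≤ m<b) | +-identityʳ (κ (suc m)) | +-identityʳ (κ m) = lip m
      hits′ : ∀ i → i ∈ parts μ → i ≤ s + suc g → ∃[ d ] (d ∈ b + suc g ∷ ds × κ′ d ≡ i)
      hits′ i i∈ i≤ with ≤-<-connex i s
      ... | inj₁ i≤s = let d , d∈ , e = hits i i∈ i≤s in d , there d∈ ,
        trans (cong (λ v → κ d + (suc g ⊓ v)) (m≤n⇒m∸n≡0 (≤-trans (All.lookup (descending-≤ desc) d∈) h≤b))) (trans (+-identityʳ (κ d)) e)
      ... | inj₂ s<i with m≤n⇒m<n∨m≡n i≤
      ...   | inj₁ i< = contradiction (skip i i∈ s<i i<) (<⇒≢ s<i)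
      ...   | inj₂ refl = b + suc g , here refl ,
        cong₂ _+_ (stable (b + suc g) (≤-trans h≤b (m≤m+n b (suc g)))) (trans (cong (suc g ⊓_) (m+n∸m≡n b (suc g))) (⊓-idem (suc g)))

    private
      reach-suc : ∀ {x ds s} → Descending ds → head0 ds < x → Reach ds s → Reach (x ∷ ds) (suc s)
      reach-suc {suc x} {ds} {s} desc (s≤s h) r = subst₂ (λ a b → Reach (a ∷ ds) b) (+-comm x 1) (+-comm s 1)
        (reach-∷ x 0 desc h (λ i i∈ s<i i< → contradiction (≤-trans i< (≤-reflexive (+-comm s 1))) (<⇒≱ (s≤s s<i))) r)

      reach-skip : ∀ {x ds s} → Descending ds → suc (head0 ds) < x → ¬ suc s ∈ parts μ → Reach ds s → Reach (x ∷ ds) (suc (suc s))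
      reach-skip {suc (suc x)} {ds} {s} desc (s≤s (s≤s h)) s∉ r = subst₂ (λ a b → Reach (a ∷ ds) b) (+-comm x 2) (+-comm s 2)
        (reach-∷ x 1 desc h (λ i i∈ s<i i< → contradiction
          (subst (_∈ parts μ) (≤-antisym (≤-pred (≤-trans i< (≤-reflexive (+-comm s 2)))) s<i) i∈) s∉) r)

    reach-length : ∀ {ds} → Descending ds → Reach ds (length ds)
    reach-length []      = reach-[]
    reach-length (h ∷ d) = reach-suc d h (reach-length d)

    -- At a rank that is not a part of μ, a jump of at least 2 leaves room to keep two columns,
    -- skipping the missing value. From there on the kept columns are one ahead of the number of
    -- sizes.
    good⊎reach : ∀ {ds} → Descending ds → Good free ds ⊎ Reach ds (suc (length ds))
    good⊎reach [] = inj₁ []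
    good⊎reach {x ∷ xs} (h ∷ d) with good⊎reach d
    ... | inj₂ r = inj₂ (reach-suc d h r)
    ... | inj₁ g with free (suc (length xs)) in eq
    ...   | true  = inj₁ (cons h (inj₁ eq) g)
    ...   | false with m≤n⇒m<n∨m≡n h
    ...     | inj₁ jump = inj₂ (reach-skip d jump (free-false eq) (reach-length d))
    ...     | inj₂ e    = inj₁ (cons h (inj₂ (sym e)) g)

    reach-contains : ∀ {ds s} α → (∀ {d} → d ∈ ds → d ∈ parts α) → suc k ≤ s → Reach ds s → Contains α μ
    reach-contains {ds} {s} α ds⊆ k<s r = proj₁ rows , C , proj₂ rows
      where
      open Reach r
      w = entry (parts α) 0
      C = columns κ w
      keep : ∀ {m} → m ≤ w → keepColumns C m ≡ κ m
      keep h = trans (cong (_+ keepColumns C _) (sym κ-zero)) (keepColumns-columns w κ mono lip h)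
      hit : ∀ {i} → i ∈ parts μ → ∃[ x ] (x ∈ parts α × keepColumns C x ≡ i)
      hit i∈ = let d , d∈ , e = hits _ i∈ (≤-trans (All.lookup parts≤ i∈) k<s) in
        d , ds⊆ d∈ , trans (keep (All.lookup (parts≤part0 (parts α) (parts-≥ α)) (ds⊆ d∈))) e
      rows = select-rows (keepColumns C) (keepColumns-mono C) (parts α) (parts μ) (parts-≥ α)
               μ-descending (positive μ) (All.tabulate hit)

    -- By induction on i, at most i kept columns lie within the i smallest parts.
    good-avoids : ∀ {ds} α → Good free ds → length ds ≡ k → (∀ {x} → x ∈ parts α → x ∈ ds) → ¬ Contains α μ
    good-avoids {ds} α good len α⊆ (R , C , eq) = finish (realised top)
      where
      κ = keepColumns C
      realised : ∀ {i} → i ∈ parts μ → ∃[ x ] (x ∈ ds × κ x ≡ i)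
      realised {i} i∈ = let x∈map = proj₁ (∈-filter⁻ (0 <?_) {xs = map κ (keepRows (parts α) R)} (subst (i ∈_) (sym eq) i∈))
                            x , x∈ , e = ∈-map⁻ κ x∈map
                        in x , α⊆ (keepRows-⊆ (parts α) R x∈) , sym e
      -- The rows that realise parts may lie beyond the sizes under consideration; in this form the
      -- hypothesis passes to the smaller list.
      bound : ∀ {xs} → Good free xs →
              (∀ {i} → i ∈ parts μ → ∃[ x ] ((x ∈ xs ⊎ head0 xs < x) × κ x ≡ i)) → κ (head0 xs) ≤ length xs
      bound [] _ = ≤-reflexive (keepColumns-zero C)
      bound {x ∷ xs} (cons h (inj₂ refl) g) real =
        ≤-trans (keepColumns-suc C (head0 xs)) (s≤s (bound g λ i∈ → shrink (real i∈)))
        where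
        shrink : ∀ {i} → ∃[ y ] ((y ∈ x ∷ xs ⊎ x < y) × κ y ≡ i) → ∃[ y ] ((y ∈ xs ⊎ head0 xs < y) × κ y ≡ i)
        shrink (y , inj₁ (here refl) , e) = y , inj₂ h , e
        shrink (y , inj₁ (there y∈) , e)  = y , inj₁ y∈ , e
        shrink (y , inj₂ x<y , e)         = y , inj₂ (<-trans h x<y) , e
      -- The rank i of `x` is a part of μ. By induction the sizes below `x` keep at most i - 1
      -- columns, so a row realising i has length at least `x`, and monotonicity bounds `κ x` by i.
      bound {x ∷ xs} (cons h (inj₁ fr) g) real with real (free-true fr)
      ... | y , y-pos , e = ≤-trans (keepColumns-mono C (x≤y y-pos)) (≤-reflexive e)
        where
        shrink : ∀ {i} → ∃[ y ] ((y ∈ x ∷ xs ⊎ x < y) × κ y ≡ i) → ∃[ y ] ((y ∈ xs ⊎ head0 xs < y) × κ y ≡ i)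
        shrink (y , inj₁ (here refl) , e) = y , inj₂ h , e
        shrink (y , inj₁ (there y∈) , e)  = y , inj₁ y∈ , e
        shrink (y , inj₂ x<y , e)         = y , inj₂ (<-trans h x<y) , e
        ih : κ (head0 xs) ≤ length xs
        ih = bound g λ i∈ → shrink (real i∈)
        x≤y : y ∈ x ∷ xs ⊎ x < y → x ≤ y
        x≤y (inj₂ x<y)         = <⇒≤ x<y
        x≤y (inj₁ (here refl)) = ≤-refl
        x≤y (inj₁ (there y∈))  = contradiction
          (≤-trans (≤-reflexive (sym e)) (≤-trans (keepColumns-mono C (All.lookup (descending-≤ (good-descending g)) y∈)) ih))
          (<⇒≱ ≤-refl)
      finish : ∃[ x ] (x ∈ ds × κ x ≡ suc k) → _
      finish (x , x∈ , e) = contradiction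
        (≤-trans (≤-reflexive (sym e)) (≤-trans (keepColumns-mono C (All.lookup (descending-≤ (good-descending good)) x∈))
          (≤-trans (bound good λ i∈ → let y , y∈ , e = realised i∈ in y , inj₁ y∈ , e) (≤-reflexive len))))
        (<⇒≱ ≤-refl)

  ∈-concatMap-intro : ∀ (f : X → List Y) {x y xs} → x ∈ xs → y ∈ f x → y ∈ concatMap f xs
  ∈-concatMap-intro f x∈ y∈ = ∈-concatMap⁺ f (Any.map (λ { refl → y∈ }) x∈)

  ∈-concatMap-elim : ∀ (f : X → List Y) {y xs} → y ∈ concatMap f xs → ∃[ x ] (x ∈ xs × y ∈ f x)
  ∈-concatMap-elim f {xs = xs} y∈ = go (∈-concatMap⁻ f {xs = xs} y∈)
    where
    go : ∀ {P : X → Set} {xs} → Any P xs → ∃[ x ] (x ∈ xs × P x)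
    go (here p)  = _ , here refl , p
    go (there a) = let x , x∈ , p = go a in x , there x∈ , p

  -- Partitions with prescribed part sizes.

  data Runs : List ℕ → List ℕ → Set where
    []  : Runs [] []
    run : ∀ {ds xs} d m → Runs ds xs → Runs (d ∷ ds) (replicate (suc m) d ++ xs)

  runs-∈ : ∀ {ds xs x} → Runs ds xs → x ∈ xs → x ∈ ds
  runs-∈ (run d zero    r) (here e)  = here e
  runs-∈ (run d zero    r) (there h) = there (runs-∈ r h)
  runs-∈ (run d (suc m) r) (here e)  = here e
  runs-∈ (run d (suc m) r) (there h) = runs-∈ (run d m r) h

  runs-∋ : ∀ {ds xs x} → Runs ds xs → x ∈ ds → x ∈ xs
  runs-∋ (run d m r) (here e)  = here e
  runs-∋ (run d m r) (there h) = ∈-++⁺ʳ (replicate (suc m) d) (runs-∋ r h)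

  find-runs : ∀ {xs} → Linked _≥_ xs → All (0 <_) xs → ∃[ ds ] (Descending ds × Runs ds xs)
  find-runs [] [] = [] , [] , []
  find-runs {x ∷ []} [-] (0<x ∷ []) = x ∷ [] , 0<x ∷ [] , run x 0 []
  find-runs {x ∷ y ∷ xs} (y≤x ∷ l) (0<x ∷ pos) with find-runs l pos
  ... | d ∷ ds , desc , run d m r with x ≟ d
  ...   | yes refl = d ∷ ds , desc , run d (suc m) r
  ...   | no  x≢d  = x ∷ d ∷ ds , ≤∧≢⇒< y≤x (x≢d ∘ sym) ∷ desc , run x 0 (run d m r)

  runs-below : ∀ {ds xs b} → Descending ds → Runs ds xs → head0 ds < b → All (_< b) xs
  runs-below desc r h = All.tabulate λ x∈ → ≤-<-trans (All.lookup (descending-≤ desc) (runs-∈ r x∈)) h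

  runs-partition : ∀ {ds xs} → Descending ds → Runs ds xs → Linked _≥_ xs × All (0 <_) xs
  runs-partition [] [] = [] , []
  runs-partition {xs = xs₀} desc@(h ∷ desc′) (run {ds} {xs} d m r) =
    link m , All.tabulate λ x∈ → All.lookup (descending-pos desc) (runs-∈ (run d m r) x∈)
    where
    link-∷ : ∀ {ys} → All (_≤ d) ys → Linked _≥_ ys → Linked _≥_ (d ∷ ys)
    link-∷ []      _ = [-]
    link-∷ (p ∷ _) l = p ∷ l
    link : ∀ m → Linked _≥_ (replicate (suc m) d ++ xs)
    link zero    = link-∷ (All.map <⇒≤ (runs-below desc′ r h)) (proj₁ (runs-partition desc′ r))
    link (suc m) = ≤-refl ∷ link m

  replicate-injective : ∀ {d} m m′ {as bs} → All (_< d) as → All (_< d) bs →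
    replicate m d ++ as ≡ replicate m′ d ++ bs → m ≡ m′ × as ≡ bs
  replicate-injective zero    zero     _        _        e = refl , e
  replicate-injective zero    (suc m′) (h ∷ _)  _        e = contradiction (∷-injectiveˡ e) (<⇒≢ h)
  replicate-injective (suc m) zero     _        (h ∷ _)  e = contradiction (sym (∷-injectiveˡ e)) (<⇒≢ h)
  replicate-injective (suc m) (suc m′) a        b        e =
    let m≡ , as≡ = replicate-injective m m′ a b (∷-injectiveʳ e) in cong suc m≡ , as≡

  -- Separates the partitions that belong to different sets of sizes, so that the main term counts
  -- nothing twice.
  runs-injective : ∀ {ds ds′ xs xs′} → Descending ds → Descending ds′ → Runs ds xs → Runs ds′ xs′ →
                   xs ≡ xs′ → ds ≡ ds′
  runs-injective _ _ [] [] _ = refl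
  runs-injective (h ∷ desc) (h′ ∷ desc′) (run d m r) (run d′ m′ r′) e with ∷-injectiveˡ e
  ... | refl = cong (d ∷_) (runs-injective desc desc′ r r′
    (proj₂ (replicate-injective (suc m) (suc m′) (runs-below desc r h) (runs-below desc′ r′ h′) e)))

  sum-replicate : ∀ m d → sum (replicate m d) ≡ m * d
  sum-replicate zero    d = refl
  sum-replicate (suc m) d = cong (d +_) (sum-replicate m d)

  module Fillings (n : ℕ) where
    open Counting n public

    -- The lists with runs ds and sum n - y.
    fillings : List ℕ → ℕ → List (List ℕ)
    fillings []       y with y ≟ n
    ... | yes _ = [] ∷ []
    ... | no  _ = []
    fillings (d ∷ ds) y = concatMap (λ m → map (replicate m d ++_) (fillings ds (y + m * d))) (interval 0 n)

    length-fillings : ∀ ds y → length (fillings ds y) ≡ cnt ds δ y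
    length-fillings []       y with y ≟ n
    ... | yes _ = refl
    ... | no  _ = refl
    length-fillings (d ∷ ds) y = trans (length-concatMap _ (interval 0 n))
      (∑-cong (interval 0 n) λ m → trans (length-map _ (fillings ds (y + m * d))) (length-fillings ds (y + m * d)))

    length-concatMap-fillings : ∀ (dss : List (List ℕ)) →
      length (concatMap (λ ds → fillings ds 0) dss) ≡ (∑[ ds ∈ dss ] cnt ds δ 0)
    length-concatMap-fillings dss = trans (length-concatMap _ dss) (∑-cong dss λ ds → length-fillings ds 0)

    ∈-fillings⁺ : ∀ {ds xs} y → All (1 ≤_) ds → Runs ds xs → y + sum xs ≡ n → xs ∈ fillings ds y
    ∈-fillings⁺ y [] [] e with y ≟ n
    ... | yes _ = here refl
    ... | no ne = contradiction (trans (sym (+-identityʳ y)) e) ne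
    ∈-fillings⁺ {d ∷ ds} y (1≤d ∷ pos) (run {xs = xs} d m r) e =
      ∈-concatMap-intro _ (∈-interval⁺ 0 n (s≤s z≤n) m<n) (∈-map⁺ _ (∈-fillings⁺ (y + suc m * d) pos r e′))
      where
      e′ : y + suc m * d + sum xs ≡ n
      e′ = trans (+-assoc y (suc m * d) (sum xs)) (trans (cong (y +_)
        (sym (trans (sum-++ (replicate (suc m) d) xs) (cong (_+ sum xs) (sum-replicate (suc m) d))))) e)
      m<n : suc m ≤ n
      m<n = ≤-trans (≤-reflexive (sym (*-identityʳ (suc m)))) (≤-trans (*-monoʳ-≤ (suc m) 1≤d)
        (≤-trans (m≤n+m _ y) (≤-trans (m≤m+n _ (sum xs)) (≤-reflexive e′))))

    ∈-fillings⁻ : ∀ ds {xs} y → xs ∈ fillings ds y → Runs ds xs × y + sum xs ≡ n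
    ∈-fillings⁻ [] y xs∈ with y ≟ n | xs∈
    ... | yes e | here refl = [] , trans (+-identityʳ y) e
    ... | no _  | ()
    ∈-fillings⁻ (d ∷ ds) y xs∈ with ∈-concatMap-elim _ {xs = interval 0 n} xs∈
    ... | zero  , m∈ , xs∈′ = contradiction (∈-interval⁻ 0 n m∈) λ ()
    ... | suc m , m∈ , xs∈′ with ∈-map⁻ _ xs∈′
    ...   | ys , ys∈ , refl = let r , e = ∈-fillings⁻ ds (y + suc m * d) ys∈ in run d m r ,
      trans (cong (y +_) (trans (sum-++ (replicate (suc m) d) ys) (cong (_+ sum ys) (sum-replicate (suc m) d))))
        (trans (sym (+-assoc y (suc m * d) (sum ys))) e)

    fillings-unique : ∀ {ds} y → Descending ds → Unique (fillings ds y)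
    fillings-unique y [] with y ≟ n
    ... | yes _ = [] ∷ []
    ... | no _  = []
    fillings-unique {d ∷ ds} y (h ∷ desc) = unique-concatMap _ (interval-unique 0 n)
      (λ {m} _ → Unique.map⁺ (++-cancelˡ (replicate m d) _ _) (fillings-unique (y + m * d) desc))
      λ {m} {m′} _ _ z∈ z∈′ → same (∈-map⁻ _ z∈) (∈-map⁻ _ z∈′)
      where
      below : ∀ {as} m → as ∈ fillings ds (y + m * d) → All (_< d) as
      below m as∈ = runs-below desc (proj₁ (∈-fillings⁻ ds (y + m * d) as∈)) h
      same : ∀ {m m′ z} → ∃[ as ] (as ∈ fillings ds (y + m * d) × z ≡ replicate m d ++ as) →
             ∃[ bs ] (bs ∈ fillings ds (y + m′ * d) × z ≡ replicate m′ d ++ bs) → m ≡ m′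
      same {m} {m′} (as , as∈ , e) (bs , bs∈ , e′) =
        proj₁ (replicate-injective m m′ (below m as∈) (below m′ bs∈) (trans (sym e) e′))

    ∈-tuples : ∀ {ds} → All (λ d → 0 < d × d ≤ n) ds → ds ∈ tuples (length ds)
    ∈-tuples []              = here refl
    ∈-tuples ((0<d , d≤n) ∷ h) = ∈-concatMap-intro _ (∈-tuples h) (∈-map⁺ _ (∈-interval⁺ 0 n 0<d d≤n))

  -- Chains of sizes and the cutoff.

  module Extension (free : ℕ → Bool) (B : ℕ → ℕ) where

    ext : ℕ → List ℕ → List ℕ
    ext i xs = if free i then interval (head0 xs) (B i ∸ head0 xs) else suc (head0 xs) ∷ []

    -- Only free ranks are bounded; a forced size follows its predecessor wherever that lies.
    data Fits : List ℕ → Set where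
      []  : Fits []
      _∷_ : ∀ {x xs} → (free (suc (length xs)) ≡ true → x ≤ B (suc (length xs))) → Fits xs → Fits (x ∷ xs)

    ∈-chains⁺ : ∀ {ds} → Good free ds → Fits ds → ds ∈ chains ext (length ds)
    ∈-chains⁺ [] [] = here refl
    ∈-chains⁺ {x ∷ xs} (cons h step g) (b ∷ f) =
      ∈-concatMap-intro _ (∈-chains⁺ g f) (∈-map⁺ _ (x∈ step b))
      where
      x∈ : free (suc (length xs)) ≡ true ⊎ x ≡ suc (head0 xs) →
           (free (suc (length xs)) ≡ true → x ≤ B (suc (length xs))) → x ∈ ext (suc (length xs)) xs
      x∈ step b with free (suc (length xs)) | step
      ... | true  | _      = ∈-interval⁺ (head0 xs) _ h
        (≤-trans (b refl) (≤-reflexive (sym (m+[n∸m]≡n (≤-trans (<⇒≤ h) (b refl))))))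
      ... | false | inj₂ e = here e

    ∈-chains⁻ : ∀ i {ds} → ds ∈ chains ext i → Good free ds × length ds ≡ i
    ∈-chains⁻ zero    (here refl) = [] , refl
    ∈-chains⁻ (suc i) ds∈ with ∈-concatMap-elim _ {xs = chains ext i} ds∈
    ... | xs , xs∈ , ds∈′ with ∈-map⁻ _ ds∈′
    ...   | x , x∈ , refl with ∈-chains⁻ i xs∈
    ...     | g , refl = build x∈ , refl
      where
      build : x ∈ ext (suc (length xs)) xs → Good free (x ∷ xs)
      build x∈ with free (suc (length xs)) in eq | x∈
      ... | true  | x∈′       = cons (∈-interval⁻ (head0 xs) _ x∈′) (inj₁ eq) g
      ... | false | here refl = cons ≤-refl (inj₂ refl) g

    chains-unique : ∀ i → Unique (chains ext i)
    chains-unique zero    = [] ∷ []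
    chains-unique (suc i) = unique-concatMap _ (chains-unique i)
      (λ {xs} _ → Unique.map⁺ ∷-injectiveˡ (ext-unique xs))
      λ {xs} {ys} _ _ z∈ z∈′ → let _ , _ , e = ∈-map⁻ _ z∈ ; _ , _ , e′ = ∈-map⁻ _ z∈′ in
        ∷-injectiveʳ (trans (sym e) e′)
      where
      ext-unique : ∀ xs → Unique (ext (suc i) xs)
      ext-unique xs with free (suc i)
      ... | true  = interval-unique (head0 xs) _
      ... | false = [] ∷ []

  split-at : ∀ i {j} (ds : List ℕ) → length ds ≡ i + j →
             ∃[ es ] ∃[ fs ] (ds ≡ es ++ fs × length es ≡ i × length fs ≡ j)
  split-at zero    ds       e = [] , ds , refl , refl , e
  split-at (suc i) (d ∷ ds) e = let es , fs , p , q , r = split-at i ds (suc-injective e) in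
    d ∷ es , fs , cong (d ∷_) p , cong suc q , r

  -- `T₀` applies only up to rank c, since the error in the count for fixed sizes depends on d_c;
  -- the sizes above may be as large as n.
  cutoff : ℕ → ℕ → ℕ → ℕ → ℕ
  cutoff c T₀ n i = if i ≤ᵇ c then T₀ else n

  cutoff-low : ∀ {c T₀ n i} → i ≤ c → cutoff c T₀ n i ≡ T₀
  cutoff-low {c} {i = i} i≤c with i ≤ᵇ c in eq
  ... | true  = refl
  ... | false = contradiction (≤⇒≤ᵇ i≤c) (subst T eq)

  cutoff-high : ∀ {c T₀ n i} → c < i → cutoff c T₀ n i ≡ n
  cutoff-high {c} {i = i} c<i with i ≤ᵇ c in eq
  ... | true  = contradiction (≤ᵇ⇒≤ i c (subst T (sym eq) _)) (<⇒≱ c<i)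
  ... | false = refl

  -- Bounds for the number of avoiders.

  module Counts (μ : Partition) (strict : Unique (parts μ)) (c ℓ : ℕ)
                (parts≤ : All (_≤ suc (ℓ + c)) (parts μ)) (top : suc (ℓ + c) ∈ parts μ)
                (free : ℕ → Bool)
                (free-true : ∀ {i} → free i ≡ true → i ∈ parts μ)
                (free-false : ∀ {i} → free i ≡ false → ¬ i ∈ parts μ)
                (1≤c : 1 ≤ c) (free-c : free c ≡ false)
                (n : ℕ) (1≤n : 1 ≤ n) (T₀ : ℕ) (e : Enumeration (Av μ n)) where

    open Containment μ strict (ℓ + c) parts≤ top free free-true free-false
    open Fillings n
    open Enumeration e

    k : ℕ
    k = ℓ + c

    open Extension free (cutoff c T₀ n)

    -- `mainLists` has to be free of repetitions and to consist of avoiders. The other two enter the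
    -- upper bound only and may list too much.
    mainLists smallLists tailLists : List (List ℕ)
    mainLists = concatMap (λ ds → fillings ds 0) (chains ext k)
    smallLists = concatMap (λ j → concatMap (λ ds → fillings ds 0) (tuples j)) (interval 0 (k ∸ 1))

    -- `suc t` and `t` are the sizes of ranks c and c - 1. For c = 1 the forced size is 1 and
    -- nothing is cut off.
    tail : ℕ → List (List ℕ)
    tail (suc (suc c′)) =
      concatMap (λ es → concatMap (λ t → concatMap (λ fs → fillings (es ++ suc t ∷ t ∷ fs) 0) (tuples c′))
                                  (interval T₀ (n ∸ T₀))) (tuples ℓ)
    tail _ = []
    tailLists = tail c

    tailCount : ℕ → ℕ
    tailCount (suc (suc c′)) =
      ∑[ es ∈ tuples ℓ ] ∑[ t ∈ interval T₀ (n ∸ T₀) ] ∑[ fs ∈ tuples c′ ] cnt (es ++ suc t ∷ t ∷ fs) δ 0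
    tailCount _ = 0

    length-tail : ∀ c → length (tail c) ≡ tailCount c
    length-tail zero             = refl
    length-tail (suc zero)       = refl
    length-tail (suc (suc c′)) = trans (length-concatMap _ (tuples ℓ)) (∑-cong (tuples ℓ) λ es →
      trans (length-concatMap _ (interval T₀ (n ∸ T₀))) (∑-cong (interval T₀ (n ∸ T₀)) λ t →
      trans (length-concatMap _ (tuples c′)) (∑-cong (tuples c′) λ fs → length-fillings (es ++ suc t ∷ t ∷ fs) 0)))

    private
      low-fits : ∀ {fs} → Descending fs → length fs ≤ c → head0 fs ≤ T₀ → Fits fs
      low-fits []      _ _ = []
      low-fits {x ∷ xs} (h ∷ d) len ≤T = (λ _ → subst (x ≤_) (sym (cutoff-low len)) ≤T) ∷
        low-fits d (<⇒≤ len) (≤-trans (<⇒≤ h) ≤T)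

      high-fits : ∀ {fs} es → c ≤ length fs → All (_≤ n) es → Fits fs → Fits (es ++ fs)
      high-fits []       _   _            f = f
      high-fits {fs} (x ∷ es) c≤ (x≤n ∷ es≤) f = (λ _ → subst (x ≤_) (sym (cutoff-high (s≤s (≤-trans c≤
        (≤-trans (m≤n+m (length fs) (length es)) (≤-reflexive (sym (length-++ es)))))))) x≤n) ∷ high-fits es c≤ es≤ f

      entry≤sum : ∀ {x xs} → x ∈ xs → x ≤ sum xs
      entry≤sum (here refl)           = m≤m+n _ _
      entry≤sum {xs = y ∷ xs} (there h) = ≤-trans (entry≤sum h) (m≤n+m _ y)

      good-++ʳ : ∀ es {fs} → Good free (es ++ fs) → Good free fs
      good-++ʳ []       g            = g
      good-++ʳ (x ∷ es) (cons _ _ g) = good-++ʳ es g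

      module _ {ds xs} (good : Good free ds) (len : length ds ≡ k) (r : Runs ds xs)
               (total : sum xs ≡ n) where

        private
          desc = good-descending good
          small : ∀ {d} → d ∈ ds → d ≤ n
          small d∈ = ≤-trans (entry≤sum (runs-∋ r d∈)) (≤-reflexive total)
          in-fillings : xs ∈ fillings ds 0
          in-fillings = ∈-fillings⁺ 0 (descending-pos desc) r total

          main : Fits ds → xs ∈ mainLists ++ tailLists
          main fits = ∈-++⁺ˡ (∈-concatMap-intro _ (subst (λ i → ds ∈ chains ext i) len (∈-chains⁺ good fits)) in-fillings)

          go : ∀ es fs → ds ≡ es ++ fs → length es ≡ ℓ → length fs ≡ c → xs ∈ mainLists ++ tailLists
          go es [] eq _ e = contradiction (subst (1 ≤_) (sym e) 1≤c) λ ()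
          go es (f ∷ []) eq _ e = main (subst Fits (sym eq) (high-fits es (≤-reflexive (sym e))
            (All.tabulate λ d∈ → small (subst (_ ∈_) (sym eq) (∈-++⁺ˡ d∈)))
            ((λ fr → contradiction (trans (sym fr) (trans (cong free e) free-c)) λ ()) ∷ [])))
          go es (f ∷ t ∷ fs) eq le e with good-++ʳ es {f ∷ t ∷ fs} (subst (Good free) eq good)
          ... | cons _ (inj₁ fr) _ = contradiction (trans (sym fr) (trans (cong free e) free-c)) λ ()
          -- Rank c is not free, so the size there is `suc t`. As `t` is the largest of the sizes
          -- below, comparing it with `T₀` decides between main term and tail.
          ... | cons _ (inj₂ refl) g with ≤-<-connex t T₀
          ...   | inj₁ t≤T = main (subst Fits (sym eq) (high-fits es (≤-reflexive (sym e))
            (All.tabulate λ d∈ → small (subst (_ ∈_) (sym eq) (∈-++⁺ˡ d∈)))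
            ((λ fr → contradiction (trans (sym fr) (trans (cong free e) free-c)) λ ()) ∷
              low-fits (good-descending g) (≤-trans (n≤1+n _) (≤-reflexive e)) t≤T)))
          ...   | inj₂ T<t = ∈-++⁺ʳ mainLists (subst (λ c → xs ∈ tail c) e
            (∈-concatMap-intro _ (subst (λ i → es ∈ tuples i) le (∈-tuples (All.tabulate λ d∈ → both (subst (_ ∈_) (sym eq) (∈-++⁺ˡ d∈)))))
              (∈-concatMap-intro _ (∈-interval⁺ T₀ _ T<t (≤-trans t≤n (m≤n+m∸n n T₀)))
                (∈-concatMap-intro _ (∈-tuples (All.tabulate λ d∈ → both (subst (_ ∈_) (sym eq) (∈-++⁺ʳ es (there (there d∈))))))
                  (subst (λ ds → xs ∈ fillings ds 0) eq in-fillings)))))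
            where
            both : ∀ {d} → d ∈ ds → 0 < d × d ≤ n
            both d∈ = All.lookup (descending-pos desc) d∈ , small d∈
            t≤n : t ≤ n
            t≤n = small (subst (t ∈_) (sym eq) (∈-++⁺ʳ es (there (here refl))))

        classify : xs ∈ mainLists ++ tailLists
        classify = let es , fs , p , q , s = split-at ℓ ds len in go es fs p q s

      avoider-listed : ∀ α → Av μ n α → parts α ∈ (mainLists ++ tailLists) ++ smallLists
      avoider-listed α (total , avoids) with find-runs (decreasing α) (positive α)
      ... | ds , desc , r with ≤-<-connex (suc k) (length ds)
      ...   | inj₁ long = contradiction (reach-contains α (runs-∋ r) long (reach-length desc)) avoids
      ...   | inj₂ len with m≤n⇒m<n∨m≡n (≤-pred len)
      ...     | inj₂ len≡k with good⊎reach desc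
      ...       | inj₁ good  = ∈-++⁺ˡ (classify good len≡k r total)
      ...       | inj₂ reach = contradiction (reach-contains α (runs-∋ r) (s≤s (≤-reflexive (sym len≡k))) reach) avoids
      avoider-listed α (total , avoids) | ds , desc , r | inj₂ len | inj₁ len<k =
        ∈-++⁺ʳ (mainLists ++ tailLists) (∈-concatMap-intro _ (∈-interval⁺ 0 (k ∸ 1) (nonempty r total) (≤-pred (≤-trans len<k (m≤n+m∸n k 1))))
          (∈-concatMap-intro _ (∈-tuples (All.tabulate λ d∈ → All.lookup (descending-pos desc) d∈ ,
              ≤-trans (entry≤sum (runs-∋ r d∈)) (≤-reflexive total)))
            (∈-fillings⁺ 0 (descending-pos desc) r total)))
        where
        nonempty : ∀ {ds xs} → Runs ds xs → sum xs ≡ n → 0 < length ds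
        nonempty []          e = ≤-trans 1≤n (≤-reflexive (sym e))
        nonempty (run _ _ _) _ = s≤s z≤n

    mainCount smallCount : ℕ
    mainCount = ∑[ ds ∈ chains ext k ] cnt ds δ 0
    smallCount = ∑[ j ∈ interval 0 (k ∸ 1) ] ∑[ ds ∈ tuples j ] cnt ds δ 0

    avoiders-≤ : length elements ≤ (mainCount + tailCount c) + smallCount
    avoiders-≤ = begin
      length elements
        ≡⟨ length-map parts elements ⟨
      length (map parts elements)
        ≤⟨ length-⊆ (Unique.map⁺ parts-injective unique) (λ xs∈ → let α , α∈ , eq = ∈-map⁻ parts xs∈ in
             subst (_∈ (mainLists ++ tailLists) ++ smallLists) (sym eq) (avoider-listed α (Equivalence.to (exact α) α∈))) ⟩
      length ((mainLists ++ tailLists) ++ smallLists)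
        ≡⟨ trans (length-++ (mainLists ++ tailLists)) (cong (_+ length smallLists) (length-++ mainLists)) ⟩
      length mainLists + length tailLists + length smallLists
        ≡⟨ cong₂ _+_ (cong₂ _+_ (length-concatMap-fillings (chains ext k)) (length-tail c))
             (trans (length-concatMap _ (interval 0 (k ∸ 1))) (∑-cong (interval 0 (k ∸ 1)) λ j → length-concatMap-fillings (tuples j))) ⟩
      mainCount + tailCount c + smallCount ∎
      where open ≤-Reasoning

    avoiders-≥ : mainCount ≤ length elements
    avoiders-≥ = begin
      mainCount  ≡⟨ length-concatMap-fillings (chains ext k) ⟨
      length mainLists  ≤⟨ length-⊆ main-unique main-⊆ ⟩
      length (map parts elements)  ≡⟨ length-map parts elements ⟩
      length elements  ∎
      where
      open ≤-Reasoning
      main-unique : Unique mainLists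
      main-unique = unique-concatMap _ (chains-unique k)
        (λ ds∈ → fillings-unique 0 (good-descending (proj₁ (∈-chains⁻ k ds∈))))
        λ ds∈ ds∈′ z∈ z∈′ → runs-injective
          (good-descending (proj₁ (∈-chains⁻ k ds∈))) (good-descending (proj₁ (∈-chains⁻ k ds∈′)))
          (proj₁ (∈-fillings⁻ _ 0 z∈)) (proj₁ (∈-fillings⁻ _ 0 z∈′)) refl
      main-⊆ : ∀ {xs} → xs ∈ mainLists → xs ∈ map parts elements
      main-⊆ {xs} xs∈ with ∈-concatMap-elim _ {xs = chains ext k} xs∈
      ... | ds , ds∈ , xs∈′ with ∈-chains⁻ k ds∈ | ∈-fillings⁻ ds 0 xs∈′
      ...   | good , len | r , total with runs-partition (good-descending good) r
      ...     | dec , pos = ∈-map⁺ parts {x = mkPartition xs dec pos} (Equivalence.from (exact _)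
        (total , good-avoids (mkPartition xs dec pos) good len (runs-∈ r)))

module RationalEstimates where

  import Data.Nat.Base as ℕ
  import Data.Nat.Properties as ℕ
  import Data.Nat.DivMod as ℕ
  import Data.Nat.Tactic.RingSolver as ℕ-Solver
  open import Data.Nat.Base using (ℕ; zero; suc; _∸_)
  open import Data.Nat.ListAction using (sum; product)
  open import Data.Nat.ListAction.Properties using (sum-++)
  import Data.Integer.Base as ℤ
  import Data.Integer.Properties as ℤ
  open import Data.Rational.Base
  open import Data.Rational.Properties
  import Data.Rational.Unnormalised.Base as ℚᵘ
  import Data.Rational.Unnormalised.Properties as ℚᵘ
  open import Data.Bool.Base using (Bool; true; false; if_then_else_)
  open import Data.List.Base using (List; []; _∷_; _++_; length; map; concatMap)
  open import Data.List.Properties using (length-++)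
  open import Data.List.Membership.Propositional using (_∈_)
  open import Data.List.Membership.Propositional.Properties using (∈-map⁻)
  import Data.List.Membership.DecPropositional as DecMembership
  open import Data.List.Relation.Unary.Any using (here; there)
  open import Data.List.Relation.Unary.All as All using (All; []; _∷_)
  import Data.List.Relation.Unary.All.Properties as All
  open import Data.List.Relation.Unary.AllPairs using ([]; _∷_)
  open import Data.List.Relation.Unary.Linked using (Linked; []; [-]; _∷_)
  open import Data.List.Relation.Unary.Unique.Propositional using (Unique)
  open import Data.Product.Base using (_×_; _,_; proj₁; proj₂; ∃-syntax)
  open import Data.Sum.Base using (_⊎_; inj₁; inj₂)
  open import Function.Base using (_∘_)
  open import Relation.Nullary using (¬_; yes; no; does; contradiction)
  open import Relation.Nullary.Decidable.Core using (dec⇒maybe)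
  open import Relation.Binary.Definitions using (tri<; tri≈; tri>)
  open import Relation.Binary.PropositionalEquality hiding (J)
  open import Tactic.RingSolver using (solve-∀)
  open import Tactic.RingSolver.Core.AlmostCommutativeRing using (AlmostCommutativeRing; fromCommutativeRing)
  open import Defs using (parts; decreasing; entry; Strict; HasForm; factor-positive; denominator; ∏[_]; Av-enumeration; ∣Av∣; power; mercatorSum; log; approx)
  open FiniteSums using (∑; interval; ∑-*ˡ; chains; module Counting)
  open Avoidance using (head0; ∈-interval⁻; ∈-interval⁻-≤; descending-pos; good-descending; parts-≥; parts≤part0; module Extension; ∈-concatMap-elim; module Counts; cutoff; cutoff-low; cutoff-high)

  private variable
    Ix Ix′ : Set

  -- Rational arithmetic.

  ℚ-ring : AlmostCommutativeRing _ _
  ℚ-ring = fromCommutativeRing +-*-commutativeRing (λ x → dec⇒maybe (0ℚ ≟ x))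

  ≤-by : ∀ {x y} z → 0ℚ ≤ z → x + z ≡ y → x ≤ y
  ≤-by {x} z 0≤z e = subst (x ≤_) e (subst (_≤ x + z) (+-identityʳ x) (+-monoʳ-≤ x 0≤z))

  *-nonNeg : ∀ {x y} → 0ℚ ≤ x → 0ℚ ≤ y → 0ℚ ≤ x * y
  *-nonNeg {x} {y} hx hy = nonNegative⁻¹ _ {{nonNeg*nonNeg⇒nonNeg x {{nonNegative hx}} y {{nonNegative hy}}}}

  +-nonNeg : ∀ {x y} → 0ℚ ≤ x → 0ℚ ≤ y → 0ℚ ≤ x + y
  +-nonNeg {x} {y} hx hy = subst (_≤ x + y) (+-identityʳ 0ℚ) (+-mono-≤ hx hy)

  *-mono-left : ∀ {x y z} → 0ℚ ≤ x → y ≤ z → x * y ≤ x * z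
  *-mono-left {x} 0≤x = *-monoˡ-≤-nonNeg x {{nonNegative 0≤x}}

  *-mono-right : ∀ {x y z} → 0ℚ ≤ x → y ≤ z → y * x ≤ z * x
  *-mono-right {x} 0≤x = *-monoʳ-≤-nonNeg x {{nonNegative 0≤x}}

  *-mono-≤ : ∀ {x y z w} → 0ℚ ≤ x → 0ℚ ≤ w → x ≤ y → z ≤ w → x * z ≤ y * w
  *-mono-≤ 0≤x 0≤w x≤y z≤w = ≤-trans (*-mono-left 0≤x z≤w) (*-mono-right 0≤w x≤y)

  0≤1 : 0ℚ ≤ 1ℚ
  0≤1 = nonNegative⁻¹ 1ℚ

  -- Naturals and their reciprocals as rationals.

  abstract
    ι : ℕ → ℚ
    ι n = ℤ.+ n / 1

    ι-≃ : ∀ n → toℚᵘ (ι n) ℚᵘ.≃ ℚᵘ.mkℚᵘ (ℤ.+ n) 0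
    ι-≃ n = toℚᵘ-fromℚᵘ (ℚᵘ.mkℚᵘ (ℤ.+ n) 0)

    ι≡ : ∀ n → ι n ≡ ℤ.+ n / 1
    ι≡ n = refl

    ι-0 : ι 0 ≡ 0ℚ
    ι-0 = refl

    ι-1 : ι 1 ≡ 1ℚ
    ι-1 = refl

    ι-+ : ∀ m n → ι (m ℕ.+ n) ≡ ι m + ι n
    ι-+ m n = toℚᵘ-injective (ℚᵘ.≃-trans (ι-≃ (m ℕ.+ n)) (ℚᵘ.≃-sym (ℚᵘ.≃-trans (toℚᵘ-homo-+ (ι m) (ι n))
      (ℚᵘ.≃-trans (ℚᵘ.+-cong (ι-≃ m) (ι-≃ n))
        (ℚᵘ.*≡* (cong (ℤ._* ℤ.+ 1) (cong₂ ℤ._+_ (ℤ.*-identityʳ (ℤ.+ m)) (ℤ.*-identityʳ (ℤ.+ n)))))))))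

    ι-* : ∀ m n → ι (m ℕ.* n) ≡ ι m * ι n
    ι-* m n = toℚᵘ-injective (ℚᵘ.≃-trans (ι-≃ (m ℕ.* n)) (ℚᵘ.≃-sym (ℚᵘ.≃-trans (toℚᵘ-homo-* (ι m) (ι n))
      (ℚᵘ.≃-trans (ℚᵘ.*-cong (ι-≃ m) (ι-≃ n)) (ℚᵘ.*≡* (cong (ℤ._* ℤ.+ 1) (sym (ℤ.pos-* m n))))))))

    ι-mono : ∀ {m n} → m ℕ.≤ n → ι m ≤ ι n
    ι-mono {m} {n} h = toℚᵘ-cancel-≤ (ℚᵘ.≤-respˡ-≃ (ℚᵘ.≃-sym (ι-≃ m)) (ℚᵘ.≤-respʳ-≃ (ℚᵘ.≃-sym (ι-≃ n))
      (ℚᵘ.*≤* (ℤ.*-monoʳ-≤-nonNeg (ℤ.+ 1) (ℤ.+≤+ h)))))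

    ι-cancel : ∀ {m n} → ι m ≤ ι n → m ℕ.≤ n
    ι-cancel {m} {n} h with ℚᵘ.≤-respˡ-≃ (ι-≃ m) (ℚᵘ.≤-respʳ-≃ (ι-≃ n) (toℚᵘ-mono-≤ h))
    ... | ℚᵘ.*≤* k = ℤ.drop‿+≤+ (subst₂ ℤ._≤_ (ℤ.*-identityʳ (ℤ.+ m)) (ℤ.*-identityʳ (ℤ.+ n)) k)

    0≤ι : ∀ n → 0ℚ ≤ ι n
    0≤ι n = ι-mono {0} {n} ℕ.z≤n

    1≤ι : ∀ {n} → 1 ℕ.≤ n → 1ℚ ≤ ι n
    1≤ι = ι-mono

    ι-suc : ∀ n → ι (suc n) ≡ 1ℚ + ι n
    ι-suc n = ι-+ 1 n

    -- The junk value inv 0 = 0 is never used.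
    inv : ℕ → ℚ
    inv zero    = 0ℚ
    inv (suc n) = ℤ.+ 1 / suc n

    inv≡ : ∀ n → inv (suc n) ≡ ℤ.+ 1 / suc n
    inv≡ n = refl

    inv-1 : inv 1 ≡ 1ℚ
    inv-1 = refl

    ι*inv : ∀ {n} → 1 ℕ.≤ n → ι n * inv n ≡ 1ℚ
    ι*inv {suc m} _ = toℚᵘ-injective (ℚᵘ.≃-trans (toℚᵘ-homo-* (ι (suc m)) (inv (suc m)))
      (ℚᵘ.≃-trans (ℚᵘ.*-cong (ι-≃ (suc m)) (toℚᵘ-fromℚᵘ (ℚᵘ.mkℚᵘ (ℤ.+ 1) m)))
        (ℚᵘ.*≡* (trans (ℤ.*-identityʳ (ℤ.+ suc m ℤ.* ℤ.+ 1)) (trans (ℤ.*-comm (ℤ.+ suc m) (ℤ.+ 1))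
          (cong (λ d → ℤ.+ 1 ℤ.* ℤ.+ suc d) (sym (ℕ.+-identityʳ m))))))))

    0≤inv : ∀ n → 0ℚ ≤ inv n
    0≤inv zero    = ≤-refl
    0≤inv (suc m) = toℚᵘ-cancel-≤ (ℚᵘ.≤-respʳ-≃ (ℚᵘ.≃-sym (toℚᵘ-fromℚᵘ (ℚᵘ.mkℚᵘ (ℤ.+ 1) m)))
      (ℚᵘ.*≤* {ℚᵘ.0ℚᵘ} (ℤ.+≤+ ℕ.z≤n)))

  cancel-ι : ∀ {n x y} → 1 ℕ.≤ n → ι n * x ≤ ι n * y → x ≤ y
  cancel-ι {n} {x} {y} 1≤n h = subst₂ _≤_ (drop x) (drop y) (*-mono-left (0≤inv n) h)
    where
    assoc : ∀ a b c → b * (a * c) ≡ a * b * c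
    assoc = solve-∀ ℚ-ring
    drop : ∀ x → inv n * (ι n * x) ≡ x
    drop x = trans (assoc (ι n) (inv n) x) (trans (cong (_* x) (ι*inv 1≤n)) (*-identityˡ x))

  cancel-ι-≡ : ∀ {n x y} → 1 ℕ.≤ n → ι n * x ≡ ι n * y → x ≡ y
  cancel-ι-≡ h e = ≤-antisym (cancel-ι h (≤-reflexive e)) (cancel-ι h (≤-reflexive (sym e)))

  inv-* : ∀ {m n} → 1 ℕ.≤ m → 1 ℕ.≤ n → inv (m ℕ.* n) ≡ inv m * inv n
  inv-* {m} {n} hm hn = cancel-ι-≡ (ℕ.*-mono-≤ hm hn) (begin
    ι (m ℕ.* n) * inv (m ℕ.* n)  ≡⟨ ι*inv (ℕ.*-mono-≤ hm hn) ⟩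
    1ℚ * 1ℚ  ≡⟨ cong₂ _*_ (ι*inv hm) (ι*inv hn) ⟨
    (ι m * inv m) * (ι n * inv n)  ≡⟨ lem (ι m) (inv m) (ι n) (inv n) ⟩
    ι m * ι n * (inv m * inv n)  ≡⟨ cong (_* (inv m * inv n)) (ι-* m n) ⟨
    ι (m ℕ.* n) * (inv m * inv n)  ∎)
    where
    open ≡-Reasoning
    lem : ∀ a b c d → (a * b) * (c * d) ≡ a * c * (b * d)
    lem = solve-∀ ℚ-ring

  inv-scale : ∀ {m n} → 1 ℕ.≤ m → 1 ℕ.≤ n → inv n ≡ ι m * inv (m ℕ.* n)
  inv-scale {m} {n} hm hn = sym (trans (cong (ι m *_) (inv-* hm hn)) (trans (sym (*-assoc (ι m) (inv m) (inv n)))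
    (trans (cong (_* inv n) (ι*inv hm)) (*-identityˡ (inv n)))))

  inv-antimono : ∀ {m n} → 1 ℕ.≤ m → m ℕ.≤ n → inv n ≤ inv m
  inv-antimono {m} {n} 1≤m m≤n = cancel-ι 1≤m (begin
    ι m * inv n  ≤⟨ *-mono-right (0≤inv n) (ι-mono m≤n) ⟩
    ι n * inv n  ≡⟨ trans (ι*inv (ℕ.≤-trans 1≤m m≤n)) (sym (ι*inv 1≤m)) ⟩
    ι m * inv m  ∎)
    where open ≤-Reasoning

  inv≤1 : ∀ n → inv (suc n) ≤ 1ℚ
  inv≤1 n = subst (inv (suc n) ≤_) inv-1 (inv-antimono {1} {suc n} (ℕ.s≤s ℕ.z≤n) (ℕ.s≤s ℕ.z≤n))

  power-nonNeg : ∀ {x} j → 0ℚ ≤ x → 0ℚ ≤ power x j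
  power-nonNeg zero    h = 0≤1
  power-nonNeg (suc j) h = *-nonNeg h (power-nonNeg j h)

  power-mono : ∀ {x y} j → 0ℚ ≤ x → x ≤ y → power x j ≤ power y j
  power-mono zero    h x≤y = ≤-refl
  power-mono (suc j) h x≤y = *-mono-≤ h (power-nonNeg j (≤-trans h x≤y)) x≤y (power-mono j h x≤y)

  1≤power : ∀ {x} j → 1ℚ ≤ x → 1ℚ ≤ power x j
  1≤power zero    h = ≤-refl
  1≤power (suc j) h = *-mono-≤ 0≤1 (power-nonNeg j (≤-trans 0≤1 h)) h (1≤power j h)

  ι-^ : ∀ m j → ι (m ℕ.^ j) ≡ power (ι m) j
  ι-^ m zero    = ι-1
  ι-^ m (suc j) = trans (ι-* m (m ℕ.^ j)) (cong (ι m *_) (ι-^ m j))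

  -- Rational sums.

  Σ : List Ix → (Ix → ℚ) → ℚ
  Σ []       f = 0ℚ
  Σ (x ∷ xs) f = f x + Σ xs f

  infixr 5 Σ
  syntax Σ xs (λ x → e) = Σ[ x ∈ xs ] e

  Σ-cong : ∀ {f g : Ix → ℚ} (xs : List Ix) → (∀ {x} → x ∈ xs → f x ≡ g x) → Σ xs f ≡ Σ xs g
  Σ-cong []       h = refl
  Σ-cong (x ∷ xs) h = cong₂ _+_ (h (here refl)) (Σ-cong xs (h ∘ there))

  Σ-mono : ∀ {f g : Ix → ℚ} (xs : List Ix) → (∀ {x} → x ∈ xs → f x ≤ g x) → Σ xs f ≤ Σ xs g
  Σ-mono []       h = ≤-refl
  Σ-mono (x ∷ xs) h = +-mono-≤ (h (here refl)) (Σ-mono xs (h ∘ there))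

  Σ-nonNeg : ∀ {f : Ix → ℚ} (xs : List Ix) → (∀ {x} → x ∈ xs → 0ℚ ≤ f x) → 0ℚ ≤ Σ xs f
  Σ-nonNeg []       h = ≤-refl
  Σ-nonNeg (x ∷ xs) h = +-nonNeg (h (here refl)) (Σ-nonNeg xs (h ∘ there))

  +-interchangeℚ : ∀ a b c d → (a + b) + (c + d) ≡ (a + c) + (b + d)
  +-interchangeℚ = solve-∀ ℚ-ring

  Σ-+ : ∀ (f g : Ix → ℚ) xs → Σ xs (λ x → f x + g x) ≡ Σ xs f + Σ xs g
  Σ-+ f g []       = refl
  Σ-+ f g (x ∷ xs) = trans (cong (λ r → f x + g x + r) (Σ-+ f g xs)) (+-interchangeℚ (f x) (g x) (Σ xs f) (Σ xs g))

  Σ-*ˡ : ∀ c (f : Ix → ℚ) xs → Σ xs (λ x → c * f x) ≡ c * Σ xs f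
  Σ-*ˡ c f []       = sym (*-zeroʳ c)
  Σ-*ˡ c f (x ∷ xs) = trans (cong (λ r → c * f x + r) (Σ-*ˡ c f xs)) (sym (*-distribˡ-+ c (f x) (Σ xs f)))

  Σ-++ : ∀ (f : Ix → ℚ) xs ys → Σ (xs ++ ys) f ≡ Σ xs f + Σ ys f
  Σ-++ f []       ys = sym (+-identityˡ _)
  Σ-++ f (x ∷ xs) ys = trans (cong (f x +_) (Σ-++ f xs ys)) (sym (+-assoc (f x) _ _))

  Σ-map : ∀ (f : Ix′ → ℚ) (g : Ix → Ix′) xs → Σ (map g xs) f ≡ Σ xs (f ∘ g)
  Σ-map f g []       = refl
  Σ-map f g (x ∷ xs) = cong (f (g x) +_) (Σ-map f g xs)

  Σ-concatMap : ∀ (f : Ix′ → ℚ) (g : Ix → List Ix′) xs → Σ (concatMap g xs) f ≡ (Σ[ x ∈ xs ] Σ (g x) f)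
  Σ-concatMap f g []       = refl
  Σ-concatMap f g (x ∷ xs) = trans (Σ-++ f (g x) (concatMap g xs)) (cong (Σ (g x) f +_) (Σ-concatMap f g xs))

  Σ-chains : ∀ ext i (f : List ℕ → ℚ) →
             Σ (chains ext (suc i)) f ≡ (Σ[ xs ∈ chains ext i ] Σ[ d ∈ ext (suc i) xs ] f (d ∷ xs))
  Σ-chains ext i f = trans (Σ-concatMap f _ (chains ext i))
    (Σ-cong (chains ext i) λ {xs} _ → Σ-map f (_∷ xs) (ext (suc i) xs))

  ι-∑ : ∀ (f : Ix → ℕ) xs → ι (∑ xs f) ≡ Σ xs (ι ∘ f)
  ι-∑ f []       = ι-0
  ι-∑ f (x ∷ xs) = trans (ι-+ (f x) (∑ xs f)) (cong (ι (f x) +_) (ι-∑ f xs))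

  Σ-interval-≤ : ∀ {φ ψ : ℕ → ℚ} u f → (∀ m → u ℕ.≤ m → m ℕ.< u ℕ.+ f → φ (suc m) + ψ (suc m) ≤ ψ m) →
                 Σ (interval u f) φ + ψ (u ℕ.+ f) ≤ ψ u
  Σ-interval-≤ {φ} {ψ} u zero h = ≤-reflexive (trans (+-identityˡ _) (cong ψ (ℕ.+-identityʳ u)))
  Σ-interval-≤ {φ} {ψ} u (suc f) h = begin
    φ (suc u) + S + ψ (u ℕ.+ suc f)  ≡⟨ cong (λ v → φ (suc u) + S + ψ v) (ℕ.+-suc u f) ⟩
    φ (suc u) + S + ψ (suc u ℕ.+ f)  ≡⟨ +-assoc (φ (suc u)) S _ ⟩
    φ (suc u) + (S + ψ (suc u ℕ.+ f))  ≤⟨ +-monoʳ-≤ (φ (suc u)) (Σ-interval-≤ (suc u) f λ m u< m< → h m (ℕ.<⇒≤ u<) (ℕ.≤-trans m< (ℕ.≤-reflexive (sym (ℕ.+-suc u f))))) ⟩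
    φ (suc u) + ψ (suc u)  ≤⟨ h u ℕ.≤-refl (ℕ.m<m+n u (ℕ.s≤s ℕ.z≤n)) ⟩
    ψ u  ∎
    where
    open ≤-Reasoning
    S = Σ (interval (suc u) f) φ

  Σ-interval-≥ : ∀ {φ ψ : ℕ → ℚ} u f → (∀ m → u ℕ.≤ m → m ℕ.< u ℕ.+ f → ψ m ≤ φ (suc m) + ψ (suc m)) →
                 ψ u ≤ Σ (interval u f) φ + ψ (u ℕ.+ f)
  Σ-interval-≥ {φ} {ψ} u zero h = ≤-reflexive (sym (trans (+-identityˡ _) (cong ψ (ℕ.+-identityʳ u))))
  Σ-interval-≥ {φ} {ψ} u (suc f) h = begin
    ψ u  ≤⟨ h u ℕ.≤-refl (ℕ.m<m+n u (ℕ.s≤s ℕ.z≤n)) ⟩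
    φ (suc u) + ψ (suc u)  ≤⟨ +-monoʳ-≤ (φ (suc u)) (Σ-interval-≥ (suc u) f λ m u< m< → h m (ℕ.<⇒≤ u<) (ℕ.≤-trans m< (ℕ.≤-reflexive (sym (ℕ.+-suc u f))))) ⟩
    φ (suc u) + (S + ψ (suc u ℕ.+ f))  ≡⟨ +-assoc (φ (suc u)) S _ ⟨
    φ (suc u) + S + ψ (suc u ℕ.+ f)  ≡⟨ cong (λ v → φ (suc u) + S + ψ v) (ℕ.+-suc u f) ⟨
    φ (suc u) + S + ψ (u ℕ.+ suc f)  ∎
    where
    open ≤-Reasoning
    S = Σ (interval (suc u) f) φ

  -- Harmonic numbers and weights of sets of sizes.

  harmonic : ℕ → ℚ
  harmonic zero    = 0ℚ
  harmonic (suc n) = harmonic n + inv (suc n)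

  harmonic-mono : ∀ {m n} → m ℕ.≤ n → harmonic m ≤ harmonic n
  harmonic-mono {m} {n} m≤n = subst (λ v → harmonic m ≤ harmonic v) (ℕ.m∸n+n≡m m≤n) (go (n ∸ m))
    where
    go : ∀ d → harmonic m ≤ harmonic (d ℕ.+ m)
    go zero    = ≤-refl
    go (suc d) = ≤-trans (go d) (≤-by (inv (suc (d ℕ.+ m))) (0≤inv (suc (d ℕ.+ m))) refl)

  0≤harmonic : ∀ n → 0ℚ ≤ harmonic n
  0≤harmonic n = harmonic-mono {0} {n} ℕ.z≤n

  Σ-inv : ∀ u f → Σ (interval u f) inv + harmonic u ≡ harmonic (u ℕ.+ f)
  Σ-inv u zero    = trans (+-identityˡ _) (cong harmonic (sym (ℕ.+-identityʳ u)))
  Σ-inv u (suc f) = trans (lem (inv (suc u)) (Σ (interval (suc u) f) inv) (harmonic u))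
    (trans (Σ-inv (suc u) f) (cong harmonic (sym (ℕ.+-suc u f))))
    where
    lem : ∀ a b c → a + b + c ≡ b + (c + a)
    lem = solve-∀ ℚ-ring

  -- 1 / ∏ dᵢ, the weight with which a set of sizes enters the main term.
  v : List ℕ → ℚ
  v []       = 1ℚ
  v (d ∷ ds) = inv d * v ds

  0≤v : ∀ ds → 0ℚ ≤ v ds
  0≤v []       = 0≤1
  0≤v (d ∷ ds) = *-nonNeg (0≤inv d) (0≤v ds)

  v*product : ∀ {ds} → All (1 ℕ.≤_) ds → v ds * ι (product ds) ≡ 1ℚ
  v*product [] = trans (*-identityˡ (ι 1)) ι-1
  v*product {d ∷ ds} (h ∷ hs) = begin
    inv d * v ds * ι (d ℕ.* product ds)  ≡⟨ cong (inv d * v ds *_) (ι-* d (product ds)) ⟩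
    inv d * v ds * (ι d * ι (product ds))  ≡⟨ lem (inv d) (v ds) (ι d) (ι (product ds)) ⟩
    (ι d * inv d) * (v ds * ι (product ds))  ≡⟨ cong₂ _*_ (ι*inv h) (v*product hs) ⟩
    1ℚ * 1ℚ  ≡⟨⟩
    1ℚ  ∎
    where
    open ≡-Reasoning
    lem : ∀ a b c d → a * b * (c * d) ≡ (c * a) * (b * d)
    lem = solve-∀ ℚ-ring

  -- Reciprocals of rising products.

  -- The rising product (u + 1) (u + 2) ⋯ (u + r).
  rise : ℕ → ℕ → ℕ
  rise u zero    = 1
  rise u (suc r) = suc u ℕ.* rise (suc u) r

  rise-last : ∀ u r → rise u (suc r) ≡ rise u r ℕ.* (u ℕ.+ suc r)
  rise-last u zero    = trans (ℕ.*-identityʳ (suc u)) (trans (ℕ.+-comm 1 u) (sym (ℕ.*-identityˡ (u ℕ.+ 1))))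
  rise-last u (suc r) = trans (cong (suc u ℕ.*_) (rise-last (suc u) r)) (trans (sym (ℕ.*-assoc (suc u) (rise (suc u) r) _))
    (cong (suc u ℕ.* rise (suc u) r ℕ.*_) (sym (ℕ.+-suc u (suc r)))))

  1≤rise : ∀ u r → 1 ℕ.≤ rise u r
  1≤rise u zero    = ℕ.s≤s ℕ.z≤n
  1≤rise u (suc r) = ℕ.*-mono-≤ {1} {suc u} (ℕ.s≤s ℕ.z≤n) (1≤rise (suc u) r)

  -- 1 / (d (d+1) … (d+r)) = 1/r (1 / (d … (d+r-1)) - 1 / ((d+1) … (d+r)))
  telescope-rise : ∀ K r u → 1 ℕ.≤ K → 1 ℕ.≤ r →
    inv (suc u) * inv (K ℕ.* rise (suc u) r) + inv (r ℕ.* K ℕ.* rise (suc u) r) ≡ inv (r ℕ.* K ℕ.* rise u r)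
  telescope-rise K r u 1≤K 1≤r = begin
    inv (suc u) * inv (K ℕ.* rise (suc u) r) + inv (r ℕ.* K ℕ.* rise (suc u) r)
      ≡⟨ cong₂ _+_ first second ⟩
    ι r * inv N + ι (suc u) * inv N
      ≡⟨ *-distribʳ-+ (inv N) (ι r) (ι (suc u)) ⟨
    (ι r + ι (suc u)) * inv N
      ≡⟨ cong (_* inv N) (trans (sym (ι-+ r (suc u))) (cong ι (trans (ℕ.+-suc r u) (trans (cong suc (ℕ.+-comm r u)) (sym (ℕ.+-suc u r)))))) ⟩
    ι (u ℕ.+ suc r) * inv N
      ≡⟨ third ⟨
    inv (r ℕ.* K ℕ.* rise u r) ∎
    where
    open ≡-Reasoning
    N = r ℕ.* K ℕ.* rise u (suc r)
    1≤rK : 1 ℕ.≤ r ℕ.* K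
    1≤rK = ℕ.*-mono-≤ 1≤r 1≤K
    first : inv (suc u) * inv (K ℕ.* rise (suc u) r) ≡ ι r * inv N
    first = trans (sym (inv-* {suc u} (ℕ.s≤s ℕ.z≤n) (ℕ.*-mono-≤ 1≤K (1≤rise (suc u) r))))
      (trans (inv-scale {r} 1≤r (ℕ.*-mono-≤ {1} {suc u} (ℕ.s≤s ℕ.z≤n) (ℕ.*-mono-≤ 1≤K (1≤rise (suc u) r))))
        (cong (λ x → ι r * inv x) (lem r (suc u) K (rise (suc u) r))))
      where
      lem : ∀ r s K R → r ℕ.* (s ℕ.* (K ℕ.* R)) ≡ r ℕ.* K ℕ.* (s ℕ.* R)
      lem = ℕ-Solver.solve-∀
    second : inv (r ℕ.* K ℕ.* rise (suc u) r) ≡ ι (suc u) * inv N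
    second = trans (inv-scale {suc u} (ℕ.s≤s ℕ.z≤n) (ℕ.*-mono-≤ 1≤rK (1≤rise (suc u) r)))
      (cong (λ x → ι (suc u) * inv x) (lem (suc u) (r ℕ.* K) (rise (suc u) r)))
      where
      lem : ∀ s K R → s ℕ.* (K ℕ.* R) ≡ K ℕ.* (s ℕ.* R)
      lem = ℕ-Solver.solve-∀
    third : inv (r ℕ.* K ℕ.* rise u r) ≡ ι (u ℕ.+ suc r) * inv N
    third = trans (inv-scale {u ℕ.+ suc r} (ℕ.≤-trans (ℕ.s≤s ℕ.z≤n) (ℕ.m≤n+m (suc r) u)) (ℕ.*-mono-≤ 1≤rK (1≤rise u r)))
      (cong (λ x → ι (u ℕ.+ suc r) * inv x) (trans (lem (u ℕ.+ suc r) (r ℕ.* K) (rise u r)) (cong (r ℕ.* K ℕ.*_) (sym (rise-last u r)))))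
      where
      lem : ∀ s K R → s ℕ.* (K ℕ.* R) ≡ K ℕ.* (R ℕ.* s)
      lem = ℕ-Solver.solve-∀

  -- Positive parts and power inequalities.

  abstract
    clip : ℚ → ℚ
    clip x = x ⊔ 0ℚ

    0≤clip : ∀ x → 0ℚ ≤ clip x
    0≤clip x = p≤q⊔p x 0ℚ

    x≤clip : ∀ x → x ≤ clip x
    x≤clip x = p≤p⊔q x 0ℚ

    clip-least : ∀ {x y} → x ≤ y → 0ℚ ≤ y → clip x ≤ y
    clip-least = ⊔-lub

    clip-mono : ∀ {x y} → x ≤ y → clip x ≤ clip y
    clip-mono {x} {y} h = clip-least (≤-trans h (x≤clip y)) (0≤clip y)

  power-clip-≤0 : ∀ {x} j → x ≤ 0ℚ → power (clip x) (suc j) ≤ 0ℚ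
  power-clip-≤0 {x} j h = ≤-reflexive (trans (cong (_* power (clip x) j) (≤-antisym (clip-least h ≤-refl) (0≤clip x))) (*-zeroˡ (power (clip x) j)))

  -- Convexity of x ^ (j + 1): the increment over [x, x + y] is at least y times the slope at x.
  -- `power-step-≥` takes the slope at the upper end instead.
  power-step-≤ : ∀ j {x y} → 0ℚ ≤ x → 0ℚ ≤ y →
                 ι (suc j) * (y * power x j) + power x (suc j) ≤ power (x + y) (suc j)
  power-step-≤ zero    {x} {y} hx hy = ≤-reflexive (trans (cong (λ a → a * (y * 1ℚ) + x * 1ℚ) ι-1) (lem x y))
    where
    lem : ∀ x y → 1ℚ * (y * 1ℚ) + x * 1ℚ ≡ (x + y) * 1ℚ
    lem = solve-∀ ℚ-ring
  power-step-≤ (suc j) {x} {y} hx hy = begin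
    ι (suc (suc j)) * (y * X) + x * X
      ≡⟨ cong (λ a → a * (y * X) + x * X) (ι-suc (suc j)) ⟩
    (1ℚ + ι (suc j)) * (y * X) + x * X
      ≤⟨ ≤-by (y * (ι (suc j) * (y * power x j))) (*-nonNeg hy (*-nonNeg (0≤ι (suc j)) (*-nonNeg hy (power-nonNeg j hx))))
           (lem x y (power x j) (ι (suc j))) ⟩
    (x + y) * (ι (suc j) * (y * power x j) + X)
      ≤⟨ *-mono-left (+-nonNeg hx hy) (power-step-≤ j hx hy) ⟩
    (x + y) * power (x + y) (suc j) ∎
    where
    open ≤-Reasoning
    X = power x (suc j)
    lem : ∀ x y X s → (1ℚ + s) * (y * (x * X)) + x * (x * X) + y * (s * (y * X)) ≡ (x + y) * (s * (y * X) + x * X)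
    lem = solve-∀ ℚ-ring

  power-step-≥ : ∀ j {x y z} → 0ℚ ≤ z → z ≤ x → 0ℚ ≤ y → x ≤ z + y →
                 power x (suc j) ≤ ι (suc j) * (y * power x j) + power z (suc j)
  power-step-≥ zero    {x} {y} {z} hz z≤x hy h = begin
    x * 1ℚ  ≡⟨ *-identityʳ x ⟩
    x  ≤⟨ h ⟩
    z + y  ≡⟨ trans (lem z y) (cong (λ a → a * (y * 1ℚ) + z * 1ℚ) (sym ι-1)) ⟩
    ι 1 * (y * 1ℚ) + z * 1ℚ  ∎
    where
    open ≤-Reasoning
    lem : ∀ z y → z + y ≡ 1ℚ * (y * 1ℚ) + z * 1ℚ
    lem = solve-∀ ℚ-ring
  power-step-≥ (suc j) {x} {y} {z} hz z≤x hy h = begin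
    x * X  ≤⟨ *-mono-left hx (power-step-≥ j hz z≤x hy h) ⟩
    x * (s * (y * power x j) + Z)  ≡⟨ *-distribˡ-+ x _ Z ⟩
    x * (s * (y * power x j)) + x * Z  ≤⟨ +-monoʳ-≤ (x * (s * (y * power x j))) (*-mono-right (power-nonNeg (suc j) hz) h) ⟩
    x * (s * (y * power x j)) + (z + y) * Z  ≡⟨ lem x s y (power x j) z Z ⟩
    s * (y * X) + z * Z + y * Z  ≤⟨ +-monoʳ-≤ (s * (y * X) + z * Z) (*-mono-left hy (power-mono (suc j) hz z≤x)) ⟩
    s * (y * X) + z * Z + y * X  ≡⟨ lem′ s (y * X) (z * Z) ⟩
    (1ℚ + s) * (y * X) + z * Z  ≡⟨ cong (λ a → a * (y * X) + z * Z) (ι-suc (suc j)) ⟨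
    ι (suc (suc j)) * (y * X) + z * Z  ∎
    where
    open ≤-Reasoning
    s = ι (suc j)
    X = power x (suc j)
    Z = power z (suc j)
    hx = ≤-trans hz z≤x
    lem : ∀ x s y X z Z → x * (s * (y * X)) + (z + y) * Z ≡ s * (y * (x * X)) + z * Z + y * Z
    lem = solve-∀ ℚ-ring
    lem′ : ∀ s a b → s * a + b + a ≡ (1ℚ + s) * a + b
    lem′ = solve-∀ ℚ-ring

  -- H ^ (ℓ + 1) times Bernoulli's inequality (1 - y / H) ^ ℓ ≥ 1 - ℓ y / H; with the positive part
  -- it also holds for y > H.
  bernoulli-clip : ∀ {H} y ℓ → 0ℚ ≤ H → 0ℚ ≤ y →
                  H * power H ℓ ≤ H * power (clip (H - y)) ℓ + ι ℓ * (y * power H ℓ)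
  bernoulli-clip {H} y zero hH hy = ≤-by (ι 0 * (y * 1ℚ)) (*-nonNeg (0≤ι 0) (*-nonNeg hy 0≤1)) refl
  bernoulli-clip {H} y (suc ℓ) hH hy = begin
    H * (H * Hℓ)
      ≡⟨ lem H y Hℓ ⟩
    (H - y) * (H * Hℓ) + y * (H * Hℓ)
      ≤⟨ +-monoˡ-≤ _ (*-mono-right (*-nonNeg hH hHℓ) (x≤clip (H - y))) ⟩
    q * (H * Hℓ) + y * (H * Hℓ)
      ≤⟨ +-monoˡ-≤ _ (*-mono-left (0≤clip (H - y)) (bernoulli-clip y ℓ hH hy)) ⟩
    q * (H * power q ℓ + ι ℓ * (y * Hℓ)) + y * (H * Hℓ)
      ≡⟨ lem₁ q H (power q ℓ) (ι ℓ) y Hℓ ⟩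
    H * (q * power q ℓ) + ι ℓ * (y * (q * Hℓ)) + y * (H * Hℓ)
      ≤⟨ +-monoˡ-≤ _ (+-monoʳ-≤ (H * (q * power q ℓ)) (*-mono-left (0≤ι ℓ) (*-mono-left hy (*-mono-right hHℓ q≤H)))) ⟩
    H * (q * power q ℓ) + ι ℓ * (y * (H * Hℓ)) + y * (H * Hℓ)
      ≡⟨ lem₂ (H * (q * power q ℓ)) (ι ℓ) (y * (H * Hℓ)) ⟩
    H * (q * power q ℓ) + (1ℚ + ι ℓ) * (y * (H * Hℓ))
      ≡⟨ cong (λ a → H * (q * power q ℓ) + a * (y * (H * Hℓ))) (ι-suc ℓ) ⟨
    H * (q * power q ℓ) + ι (suc ℓ) * (y * (H * Hℓ)) ∎
    where
    open ≤-Reasoning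
    q  = clip (H - y)
    Hℓ = power H ℓ
    hHℓ = power-nonNeg ℓ hH
    q≤H : q ≤ H
    q≤H = clip-least {H - y} (≤-by y hy (lem′ H y)) hH
      where
      lem′ : ∀ H y → H - y + y ≡ H
      lem′ = solve-∀ ℚ-ring
    lem : ∀ H y X → H * (H * X) ≡ (H - y) * (H * X) + y * (H * X)
    lem = solve-∀ ℚ-ring
    lem₁ : ∀ q H Q l y X → q * (H * Q + l * (y * X)) + y * (H * X) ≡ H * (q * Q) + l * (y * (q * X)) + y * (H * X)
    lem₁ = solve-∀ ℚ-ring
    lem₂ : ∀ a l b → a + l * b + b ≡ a + (1ℚ + l) * b
    lem₂ = solve-∀ ℚ-ring

  -- The free sizes above rank c.

  module FreeTail (n : ℕ) where

    H : ℚ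
    H = harmonic n

    -- harmonic n - harmonic u, truncated at 0.
    G : ℕ → ℚ
    G u = Σ (interval u (n ∸ u)) inv

    0≤G : ∀ u → 0ℚ ≤ G u
    0≤G u = Σ-nonNeg (interval u (n ∸ u)) λ {d} _ → 0≤inv d

    G-step : ∀ {m} → m ℕ.< n → G m ≡ inv (suc m) + G (suc m)
    G-step {m} m<n = cong (λ f → Σ (interval m f) inv) (ℕ.+-∸-assoc 1 m<n)

    G-end : ∀ u → G (u ℕ.+ (n ∸ u)) ≡ 0ℚ
    G-end u = cong (λ f → Σ (interval (u ℕ.+ (n ∸ u)) f) inv) (ℕ.m≤n⇒m∸n≡0 (ℕ.m≤n+m∸n n u))

    private
      inside : ∀ {u m} → u ℕ.≤ m → m ℕ.< u ℕ.+ (n ∸ u) → m ℕ.< n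
      inside {u} {m} u≤m m< with ℕ.≤-<-connex n u
      ... | inj₁ n≤u = contradiction (ℕ.≤-trans m< (ℕ.≤-reflexive (trans (cong (u ℕ.+_) (ℕ.m≤n⇒m∸n≡0 n≤u)) (ℕ.+-identityʳ u)))) (ℕ.<⇒≱ (ℕ.s≤s u≤m))
      ... | inj₂ u<n = ℕ.≤-trans m< (ℕ.≤-reflexive (ℕ.m+[n∸m]≡n (ℕ.<⇒≤ u<n)))

    G≤H : ∀ u → G u ≤ H
    G≤H u with ℕ.≤-<-connex n u
    ... | inj₁ n≤u = ≤-trans (≤-reflexive (cong (λ f → Σ (interval u f) inv) (ℕ.m≤n⇒m∸n≡0 n≤u))) (0≤harmonic n)
    ... | inj₂ u<n = ≤-by (harmonic u) (0≤harmonic u)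
      (trans (Σ-inv u (n ∸ u)) (cong harmonic (ℕ.m+[n∸m]≡n (ℕ.<⇒≤ u<n))))

    H-≤G : ∀ u → H - harmonic u ≤ G u
    H-≤G u = begin
      H - harmonic u  ≤⟨ +-monoˡ-≤ (- harmonic u) (harmonic-mono (ℕ.m≤n+m∸n n u)) ⟩
      harmonic (u ℕ.+ (n ∸ u)) - harmonic u  ≡⟨ cong (_- harmonic u) (Σ-inv u (n ∸ u)) ⟨
      G u + harmonic u - harmonic u  ≡⟨ lem (G u) (harmonic u) ⟩
      G u  ∎
      where
      open ≤-Reasoning
      lem : ∀ a b → a + b - b ≡ a
      lem = solve-∀ ℚ-ring

    T∞ : (ℕ → ℚ) → ℕ → ℚ
    T∞ g u = Σ[ d ∈ interval u (n ∸ u) ] inv d * g d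

    T∞-const : ∀ u → T∞ (λ _ → 1ℚ) u ≤ H
    T∞-const u = ≤-trans (≤-reflexive (Σ-cong (interval u (n ∸ u)) λ {d} _ → *-identityʳ (inv d))) (G≤H u)

    -- ∑ 1 / (d₁ ⋯ d_j) over u < d₁ < ... < d_j ≤ n: an elementary symmetric function of
    -- reciprocals.
    V : ℕ → ℕ → ℚ
    V zero    _ = 1ℚ
    V (suc j)   = T∞ (V j)

    private
      expand : ∀ j u → ι (suc j ℕ.!) * V (suc j) u ≡ (Σ[ d ∈ interval u (n ∸ u) ] ι (suc j) * (inv d * (ι (j ℕ.!) * V j d)))
      expand j u = trans (sym (Σ-*ˡ (ι (suc j ℕ.!)) _ (interval u (n ∸ u)))) (Σ-cong (interval u (n ∸ u)) λ {d} _ →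
        trans (cong (_* (inv d * V j d)) (ι-* (suc j) (j ℕ.!))) (lem (ι (suc j)) (ι (j ℕ.!)) (inv d) (V j d)))
        where
        lem : ∀ a b c d → a * b * (c * d) ≡ a * (c * (b * d))
        lem = solve-∀ ℚ-ring

    V-≤ : ∀ j u → ι (j ℕ.!) * V j u ≤ power (G u) j
    V-≤ zero    u = ≤-reflexive (trans (*-identityʳ (ι 1)) ι-1)
    V-≤ (suc j) u = begin
      ι (suc j ℕ.!) * V (suc j) u  ≡⟨ expand j u ⟩
      (Σ[ d ∈ J ] ι (suc j) * (inv d * (ι (j ℕ.!) * V j d)))
        ≤⟨ Σ-mono J (λ {d} _ → *-mono-left (0≤ι (suc j)) (*-mono-left (0≤inv d) (V-≤ j d))) ⟩
      Σ J φ  ≤⟨ ≤-by (ψ (u ℕ.+ (n ∸ u))) (power-nonNeg (suc j) (0≤G (u ℕ.+ (n ∸ u)))) refl ⟩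
      Σ J φ + ψ (u ℕ.+ (n ∸ u))  ≤⟨ Σ-interval-≤ {φ} {ψ} u (n ∸ u) step ⟩
      ψ u  ∎
      where
      open ≤-Reasoning
      J = interval u (n ∸ u)
      φ ψ : ℕ → ℚ
      φ d = ι (suc j) * (inv d * power (G d) j)
      ψ m = power (G m) (suc j)
      step : ∀ m → u ℕ.≤ m → m ℕ.< u ℕ.+ (n ∸ u) → φ (suc m) + ψ (suc m) ≤ ψ m
      step m u≤m m< = ≤-trans (power-step-≤ j (0≤G (suc m)) (0≤inv (suc m)))
        (≤-reflexive (cong (λ a → power a (suc j)) (trans (+-comm (G (suc m)) (inv (suc m))) (sym (G-step (inside u≤m m<))))))

    -- Tuples with repeated entries separate j! times the symmetric function from the j-th power of
    -- the sum. All reciprocals are at most 1, so lowering the sum by j makes up for them.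
    V-≥ : ∀ j u → power (clip (G u - ι j)) j ≤ ι (j ℕ.!) * V j u
    V-≥ zero    u = ≤-reflexive (sym (trans (*-identityʳ (ι 1)) ι-1))
    V-≥ (suc j) u = begin
      ψ u  ≤⟨ Σ-interval-≥ {φ} {ψ} u (n ∸ u) step ⟩
      Σ J φ + ψ (u ℕ.+ (n ∸ u))  ≤⟨ +-monoʳ-≤ (Σ J φ) ψ-end ⟩
      Σ J φ + 0ℚ  ≡⟨ +-identityʳ (Σ J φ) ⟩
      Σ J φ  ≤⟨ Σ-mono J (λ {d} _ → *-mono-left (0≤ι (suc j)) (*-mono-left (0≤inv d) (V-≥ j d))) ⟩
      (Σ[ d ∈ J ] ι (suc j) * (inv d * (ι (j ℕ.!) * V j d)))
                                                  ≡⟨ expand j u ⟨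
      ι (suc j ℕ.!) * V (suc j) u  ∎
      where
      open ≤-Reasoning
      J = interval u (n ∸ u)
      s = ι (suc j)
      φ ψ : ℕ → ℚ
      φ d = s * (inv d * power (clip (G d - ι j)) j)
      ψ m = power (clip (G m - s)) (suc j)
      ψ-end : ψ (u ℕ.+ (n ∸ u)) ≤ 0ℚ
      ψ-end = power-clip-≤0 {G (u ℕ.+ (n ∸ u)) - s} j (≤-by s (0≤ι (suc j)) (trans (cong (λ g → g - s + s) (G-end u)) (lem s)))
        where
        lem : ∀ s → 0ℚ - s + s ≡ 0ℚ
        lem = solve-∀ ℚ-ring
      step : ∀ m → u ℕ.≤ m → m ℕ.< u ℕ.+ (n ∸ u) → ψ m ≤ φ (suc m) + ψ (suc m)
      step m u≤m m< = begin
        power x (suc j)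
          ≤⟨ power-step-≥ j (0≤clip _) (clip-mono (+-monoˡ-≤ (- s) G≤)) (0≤inv (suc m)) x≤ ⟩
        s * (y * power x j) + ψ (suc m)
          ≤⟨ +-monoˡ-≤ (ψ (suc m)) (*-mono-left (0≤ι (suc j)) (*-mono-left (0≤inv (suc m)) (power-mono j (0≤clip _) (clip-mono shift)))) ⟩
        φ (suc m) + ψ (suc m) ∎
        where
        g = G (suc m)
        y = inv (suc m)
        x = clip (G m - s)
        Gm : G m ≡ y + g
        Gm = G-step (inside u≤m m<)
        G≤ : g ≤ G m
        G≤ = ≤-by y (0≤inv (suc m)) (trans (+-comm g y) (sym Gm))
        x≤ : x ≤ clip (g - s) + y
        x≤ = clip-least {G m - s} (begin
          G m - s  ≡⟨ cong (_- s) Gm ⟩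
          y + g - s  ≡⟨ lem y g s ⟩
          (g - s) + y  ≤⟨ +-monoˡ-≤ y (x≤clip (g - s)) ⟩
          clip (g - s) + y  ∎) (+-nonNeg (0≤clip (g - s)) (0≤inv (suc m)))
          where
          lem : ∀ y g s → y + g - s ≡ (g - s) + y
          lem = solve-∀ ℚ-ring
        -- The offset grows by one with each size, which pays for the step 1 / (m + 1) ≤ 1 from
        -- `G (suc m)` to `G m`.
        shift : G m - s ≤ g - ι j
        shift = begin
          G m - s  ≡⟨ cong₂ _-_ Gm (ι-suc j) ⟩
          y + g - (1ℚ + ι j)  ≤⟨ +-monoˡ-≤ (- (1ℚ + ι j)) (+-monoˡ-≤ g (inv≤1 m)) ⟩
          1ℚ + g - (1ℚ + ι j)  ≡⟨ lem g (ι j) ⟩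
          g - ι j  ∎
          where
          lem : ∀ g a → 1ℚ + g - (1ℚ + a) ≡ g - a
          lem = solve-∀ ℚ-ring

    0≤H : 0ℚ ≤ H
    0≤H = 0≤harmonic n

    V-upper : ∀ j u → ι (j ℕ.!) * V j u ≤ power H j
    V-upper j u = ≤-trans (V-≤ j u) (power-mono j (0≤G u) (G≤H u))

    -- The loss is linear in `harmonic u`, so only the weighted sum of `harmonic` over the chains
    -- below remains to be bounded.
    V-lower : ∀ j u → H * power H j ≤ H * (ι (j ℕ.!) * V j u) + ι j * ((harmonic u + ι j) * power H j)
    V-lower j u = begin
      H * power H j
        ≤⟨ bernoulli-clip (harmonic u + ι j) j 0≤H (+-nonNeg (0≤harmonic u) (0≤ι j)) ⟩
      H * power (clip (H - (harmonic u + ι j))) j + E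
        ≤⟨ +-monoˡ-≤ E (*-mono-left 0≤H (≤-trans (power-mono j (0≤clip _) (clip-mono below)) (V-≥ j u))) ⟩
      H * (ι (j ℕ.!) * V j u) + E ∎
      where
      open ≤-Reasoning
      E = ι j * ((harmonic u + ι j) * power H j)
      below : H - (harmonic u + ι j) ≤ G u - ι j
      below = subst (_≤ G u - ι j) (lem H (harmonic u) (ι j)) (+-monoˡ-≤ (- ι j) (H-≤G u))
        where
        lem : ∀ a b c → a - b - c ≡ a - (b + c)
        lem = solve-∀ ℚ-ring

  -- Weighted sums over chains by transfer operators.

  module Weighted (free : ℕ → Bool) (B : ℕ → ℕ) where
    open Extension free B public

    -- One step of a chain as an operator on functions of the largest size so far. Freeness and
    -- cutoff are arguments, so that the two kinds of steps can be treated apart from the rank.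
    TrB : Bool → ℕ → (ℕ → ℚ) → ℕ → ℚ
    TrB b m g u = if b then (Σ[ d ∈ interval u (m ∸ u) ] inv d * g d) else inv (suc u) * g (suc u)

    Tr : ℕ → (ℕ → ℚ) → ℕ → ℚ
    Tr i = TrB (free i) (B i)

    X : (ℕ → ℚ) → ℕ → ℚ
    X g i = Σ[ ds ∈ chains ext i ] v ds * g (head0 ds)

    Σ-ext : ∀ i xs (g : ℕ → ℚ) → (Σ[ d ∈ ext i xs ] inv d * g d) ≡ Tr i g (head0 xs)
    Σ-ext i xs g with free i
    ... | true  = refl
    ... | false = +-identityʳ _

    -- Summing out the largest size moves one step of the chain onto the test function. Iterated,
    -- this reduces sums over chains to pointwise inequalities for `Tr`.
    X-suc : ∀ g i → X g (suc i) ≡ X (Tr (suc i) g) i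
    X-suc g i = trans (Σ-chains ext i (λ ds → v ds * g (head0 ds))) (Σ-cong (chains ext i) λ {xs} _ →
      trans (Σ-cong (ext (suc i) xs) λ {d} _ → lem (inv d) (v xs) (g d))
        (trans (Σ-*ˡ (v xs) _ (ext (suc i) xs)) (cong (v xs *_) (Σ-ext (suc i) xs g))))
      where
      lem : ∀ a b c → a * b * c ≡ b * (a * c)
      lem = solve-∀ ℚ-ring

    X-zero : ∀ g → X g 0 ≡ g 0
    X-zero g = trans (+-identityʳ _) (*-identityˡ (g 0))

    X-mono : ∀ {g h} i → (∀ u → g u ≤ h u) → X g i ≤ X h i
    X-mono i e = Σ-mono (chains ext i) λ {ds} _ → *-mono-left (0≤v ds) (e (head0 ds))

    X-cong : ∀ {g h} i → (∀ u → g u ≡ h u) → X g i ≡ X h i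
    X-cong i e = Σ-cong (chains ext i) λ {ds} _ → cong (v ds *_) (e (head0 ds))

    X-*ˡ : ∀ a g i → X (λ u → a * g u) i ≡ a * X g i
    X-*ˡ a g i = trans (Σ-cong (chains ext i) λ {ds} _ → lem (v ds) a (g (head0 ds))) (Σ-*ˡ a _ (chains ext i))
      where
      lem : ∀ a b c → a * (b * c) ≡ b * (a * c)
      lem = solve-∀ ℚ-ring

    X-+ : ∀ g h i → X (λ u → g u + h u) i ≡ X g i + X h i
    X-+ g h i = trans (Σ-cong (chains ext i) λ {ds} _ → *-distribˡ-+ (v ds) _ _) (Σ-+ _ _ (chains ext i))

    one : ℕ → ℚ
    one _ = 1ℚ

    X-const : ∀ a i → X (λ _ → a) i ≡ a * X one i
    X-const a i = trans (X-cong i λ _ → sym (*-identityʳ a)) (X-*ˡ a one i)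

    Σ-v : ∀ i → Σ (chains ext i) v ≡ X one i
    Σ-v i = Σ-cong (chains ext i) λ {ds} _ → sym (*-identityʳ (v ds))

  -- The sizes up to rank c.

  module Prefix (free : ℕ → Bool) (B : ℕ → ℕ) (n T c : ℕ)
                (B-low : ∀ {i} → i ℕ.≤ c → B i ≡ T)
                (free-c : free c ≡ false) (T≤n : T ℕ.≤ n) (1≤T : 1 ℕ.≤ T) where
    open Weighted free B public
    open FreeTail n public

    -- For i = c - s: the number of forced steps among the ranks i+1, …, c, and the
    -- product of these numbers over the free ranks passed.
    r K : ℕ → ℕ
    r zero    = 0
    r (suc s) = if free (c ∸ s) then r s else suc (r s)
    K zero    = 1
    K (suc s) = if free (c ∸ s) then r s ℕ.* K s else K s

    -- Rank c is forced, so every lower rank has a forced step above it. This r ≥ 1 makes the sums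
    -- over free sizes converge.
    r-pos : ∀ s → 1 ℕ.≤ r (suc s)
    r-pos zero rewrite free-c = ℕ.s≤s ℕ.z≤n
    r-pos (suc s) with free (c ∸ suc s)
    ... | true  = r-pos s
    ... | false = ℕ.s≤s ℕ.z≤n

    r-pos′ : ∀ s → free (c ∸ s) ≡ true → 1 ℕ.≤ r s
    r-pos′ zero    e = contradiction (trans (sym e) free-c) λ ()
    r-pos′ (suc s) _ = r-pos s

    K-pos : ∀ s → 1 ℕ.≤ K s
    K-pos zero    = ℕ.s≤s ℕ.z≤n
    K-pos (suc s) with free (c ∸ s) in eq
    ... | true  = ℕ.*-mono-≤ (r-pos′ s eq) (K-pos s)
    ... | false = K-pos s

    -- The limit as T → ∞ of the sum of 1 / (d_{i+1} … d_c) over the continuations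
    -- of a chain with d_i = u.
    ρ : ℕ → ℕ → ℚ
    ρ s u = inv (K s ℕ.* rise u (r s))

    private
      ρB : Bool → ℕ → ℕ → ℚ
      ρB b s u = inv ((if b then r s ℕ.* K s else K s) ℕ.* rise u (if b then r s else suc (r s)))

      forced : ∀ s u → inv (suc u) * ρ s (suc u) ≡ inv (K s ℕ.* rise u (suc (r s)))
      forced s u = trans (sym (inv-* {suc u} (ℕ.s≤s ℕ.z≤n) (ℕ.*-mono-≤ (K-pos s) (1≤rise (suc u) (r s)))))
        (cong inv (lem (suc u) (K s) (rise (suc u) (r s))))
        where
        lem : ∀ a b c → a ℕ.* (b ℕ.* c) ≡ b ℕ.* (a ℕ.* c)
        lem = ℕ-Solver.solve-∀

      -- A forced step lengthens the rising product by one factor; a free step telescopes and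
      -- divides by r.
      Tr-≤ : ∀ b m s u → (b ≡ true → 1 ℕ.≤ r s) → TrB b m (ρ s) u ≤ ρB b s u
      Tr-≤ false m s u _ = ≤-reflexive (forced s u)
      Tr-≤ true  m s u h = ≤-trans (≤-by (ψ (u ℕ.+ (m ∸ u))) (0≤inv _) refl)
        (Σ-interval-≤ {λ d → inv d * ρ s d} {ψ} u (m ∸ u) λ w _ _ → ≤-reflexive (telescope-rise (K s) (r s) w (K-pos s) (h refl)))
        where
        ψ : ℕ → ℚ
        ψ = ρB true s

      Tr-≥ : ∀ b s u → (b ≡ true → 1 ℕ.≤ r s) → ρB b s u ≤ TrB b T (ρ s) u + inv T
      Tr-≥ false s u _ = ≤-trans (≤-reflexive (sym (forced s u))) (≤-by (inv T) (0≤inv T) refl)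
      Tr-≥ true  s u h = ≤-trans
        (Σ-interval-≥ {λ d → inv d * ρ s d} {ψ} u (T ∸ u) λ w _ _ → ≤-reflexive (sym (telescope-rise (K s) (r s) w (K-pos s) (h refl))))
        -- The end term of the telescope sits at e ≥ T and, as r ≥ 1, is at most 1 / T: the cost of
        -- the cutoff.
        (+-monoʳ-≤ (Σ (interval u (T ∸ u)) (λ d → inv d * ρ s d)) (inv-antimono 1≤T (begin
          T  ≤⟨ ℕ.m≤n+m∸n T u ⟩
          e  ≤⟨ ℕ.n≤1+n e ⟩
          suc e  ≡⟨ ℕ.*-identityʳ (suc e) ⟨
          suc e ℕ.* 1  ≤⟨ below (r s) (h refl) ⟩
          rise e (r s)  ≡⟨ ℕ.*-identityˡ _ ⟨
          1 ℕ.* rise e (r s)  ≤⟨ ℕ.*-monoˡ-≤ (rise e (r s)) (ℕ.*-mono-≤ (h refl) (K-pos s)) ⟩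
          r s ℕ.* K s ℕ.* rise e (r s)  ∎)))
        where
        open ℕ.≤-Reasoning
        e = u ℕ.+ (T ∸ u)
        ψ : ℕ → ℚ
        ψ = ρB true s
        below : ∀ r → 1 ℕ.≤ r → suc e ℕ.* 1 ℕ.≤ rise e r
        below (suc r) _ = ℕ.*-monoʳ-≤ (suc e) (1≤rise (suc e) r)

      rank : ∀ {i s} → suc i ℕ.+ s ≡ c → c ∸ s ≡ suc i
      rank {i} {s} e = trans (cong (_∸ s) (sym e)) (ℕ.m+n∸n≡m (suc i) s)

      suc-rank : ∀ {i s} → suc i ℕ.+ s ≡ c → i ℕ.+ suc s ≡ c
      suc-rank {i} {s} e = trans (ℕ.+-suc i s) e

      low : ∀ {i s} → suc i ℕ.+ s ≡ c → B (suc i) ≡ T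
      low {i} {s} e = B-low (subst (suc i ℕ.≤_) e (ℕ.m≤m+n (suc i) s))

    Tr-ρ-≤ : ∀ {i s} → suc i ℕ.+ s ≡ c → ∀ u → Tr (suc i) (ρ s) u ≤ ρ (suc s) u
    Tr-ρ-≤ {i} {s} e u = subst (λ j → TrB (free j) (B (suc i)) (ρ s) u ≤ ρ (suc s) u) (rank {i} {s} e)
      (Tr-≤ (free (c ∸ s)) (B (suc i)) s u (r-pos′ s))

    Tr-ρ-≥ : ∀ {i s} → suc i ℕ.+ s ≡ c → ∀ u → ρ (suc s) u ≤ Tr (suc i) (ρ s) u + inv T
    Tr-ρ-≥ {i} {s} e u = subst₂ (λ j m → ρ (suc s) u ≤ TrB (free j) m (ρ s) u + inv T) (rank {i} {s} e) (sym (low {i} {s} e))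
      (Tr-≥ (free (c ∸ s)) s u (r-pos′ s))

    -- ∑ 1 / (d_1 … d_c) in the limit T → ∞.
    P : ℚ
    P = ρ c 0

    X-ρ-≤ : ∀ i s → i ℕ.+ s ≡ c → X (ρ s) i ≤ P
    X-ρ-≤ zero    s e = ≤-reflexive (trans (X-zero (ρ s)) (cong (λ s → ρ s 0) e))
    X-ρ-≤ (suc i) s e = ≤-trans (≤-reflexive (X-suc (ρ s) i))
      (≤-trans (X-mono i (Tr-ρ-≤ {i} {s} e)) (X-ρ-≤ i (suc s) (suc-rank {i} {s} e)))

    X-one-≤P : X one c ≤ P
    X-one-≤P = subst (_≤ P) (X-cong c λ u → inv-1) (X-ρ-≤ c 0 (ℕ.+-identityʳ c))

    module _ (L : ℚ) (H≤L : H ≤ L) (1≤L : 1ℚ ≤ L) where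

      0≤L = ≤-trans 0≤1 1≤L

      private
        Σ-inv-≤ : ∀ u → (Σ[ d ∈ interval u (T ∸ u) ] inv d * 1ℚ) ≤ L
        Σ-inv-≤ u = begin
          (Σ[ d ∈ interval u (T ∸ u) ] inv d * 1ℚ)  ≡⟨ Σ-cong (interval u (T ∸ u)) (λ {d} _ → *-identityʳ (inv d)) ⟩
          Σ (interval u (T ∸ u)) inv  ≤⟨ FreeTail.G≤H T u ⟩
          harmonic T  ≤⟨ harmonic-mono T≤n ⟩
          H  ≤⟨ H≤L ⟩
          L  ∎
          where open ≤-Reasoning

        Tr-one-≤ : ∀ b u → TrB b T one u ≤ L
        Tr-one-≤ true  u = Σ-inv-≤ u
        Tr-one-≤ false u = ≤-trans (≤-reflexive (*-identityʳ (inv (suc u)))) (≤-trans (inv≤1 u) 1≤L)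

      -- Serves only inside an error term, where 1 / T outweighs the power of L.
      X-one-crude : ∀ i → i ℕ.≤ c → X one i ≤ power L i
      X-one-crude zero    _ = ≤-reflexive (X-zero one)
      X-one-crude (suc i) h = begin
        X one (suc i)  ≡⟨ X-suc one i ⟩
        X (Tr (suc i) one) i  ≤⟨ X-mono i (λ u → subst (λ m → TrB (free (suc i)) m one u ≤ L) (sym (B-low h)) (Tr-one-≤ (free (suc i)) u)) ⟩
        X (λ _ → L) i  ≡⟨ X-const L i ⟩
        L * X one i  ≤⟨ *-mono-left 0≤L (X-one-crude i (ℕ.<⇒≤ h)) ⟩
        L * power L i  ∎
        where open ≤-Reasoning

      power-L-mono : ∀ {i j} → i ℕ.≤ j → power L i ≤ power L j
      power-L-mono {j = j} ℕ.z≤n       = 1≤power j 1≤L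
      power-L-mono         (ℕ.s≤s h) = *-mono-left 0≤L (power-L-mono h)

      -- Each of the i steps loses 1 / T at its cutoff, weighted by the chains below it.
      P-≤X : ∀ i s → i ℕ.+ s ≡ c → P ≤ X (ρ s) i + ι i * (inv T * power L c)
      P-≤X zero s e = ≤-trans (≤-reflexive (sym (trans (X-zero (ρ s)) (cong (λ s → ρ s 0) e))))
        (≤-by _ (*-nonNeg (0≤ι 0) (*-nonNeg (0≤inv T) (power-nonNeg c 0≤L))) refl)
      P-≤X (suc i) s e = begin
        P
          ≤⟨ P-≤X i (suc s) (suc-rank {i} {s} e) ⟩
        X (ρ (suc s)) i + ι i * ε
          ≤⟨ +-monoˡ-≤ (ι i * ε) (X-mono i (Tr-ρ-≥ {i} {s} e)) ⟩
        X (λ u → Tr (suc i) (ρ s) u + inv T) i + ι i * ε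
          ≡⟨ cong (_+ ι i * ε) (trans (X-+ (Tr (suc i) (ρ s)) (λ _ → inv T) i) (cong₂ _+_ (sym (X-suc (ρ s) i)) (X-const (inv T) i))) ⟩
        X (ρ s) (suc i) + inv T * X one i + ι i * ε
          ≤⟨ +-monoˡ-≤ (ι i * ε) (+-monoʳ-≤ (X (ρ s) (suc i)) (*-mono-left (0≤inv T)
               (≤-trans (X-one-crude i i≤c) (power-L-mono i≤c)))) ⟩
        X (ρ s) (suc i) + ε + ι i * ε
          ≡⟨ lem (X (ρ s) (suc i)) ε (ι i) ⟩
        X (ρ s) (suc i) + (1ℚ + ι i) * ε
          ≡⟨ cong (λ a → X (ρ s) (suc i) + a * ε) (ι-suc i) ⟨
        X (ρ s) (suc i) + ι (suc i) * ε ∎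
        where
        open ≤-Reasoning
        ε = inv T * power L c
        i≤c : i ℕ.≤ c
        i≤c = ℕ.≤-trans (ℕ.n≤1+n i) (subst (suc i ℕ.≤_) e (ℕ.m≤m+n (suc i) s))
        lem : ∀ a b c → a + b + c * b ≡ a + (1ℚ + c) * b
        lem = solve-∀ ℚ-ring

      P-≤X-one : P ≤ X one c + ι c * (inv T * power L c)
      P-≤X-one = subst (λ x → P ≤ x + ι c * (inv T * power L c)) (X-cong c λ u → inv-1) (P-≤X c 0 (ℕ.+-identityʳ c))

    private
      -- A majorant of `harmonic` after s transfers. The forced step at rank c brings in 1 / (u +
      -- 1), and the sum of H_d / (d (d + 1)) over d > u is again (H_u + O(1)) / (u + 1).
      M : ℕ → ℕ → ℚ
      M zero    u = harmonic u
      M (suc s) u = (harmonic u + ι (2 ℕ.* suc s)) * inv (suc u)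

      two : ∀ s → ι (2 ℕ.* suc (suc s)) ≡ ι (2 ℕ.* suc s) + (1ℚ + 1ℚ)
      two s = trans (cong ι (lem s)) (trans (ι-+ (2 ℕ.* suc s) 2) (cong (ι (2 ℕ.* suc s) +_) (trans (ι-suc 1) (cong (1ℚ +_) ι-1))))
        where
        lem : ∀ s → 2 ℕ.* suc (suc s) ≡ 2 ℕ.* suc s ℕ.+ 2
        lem = ℕ-Solver.solve-∀

      Tr-M-c : ∀ m u → TrB false m (M 0) u ≤ M 1 u
      Tr-M-c m u = begin
        inv (suc u) * (harmonic u + inv (suc u))
          ≤⟨ *-mono-left (0≤inv (suc u)) (+-monoʳ-≤ (harmonic u) (≤-trans (inv≤1 u) (1≤ι {2} (ℕ.s≤s ℕ.z≤n)))) ⟩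
        inv (suc u) * (harmonic u + ι 2)
          ≡⟨ *-comm (inv (suc u)) _ ⟩
        (harmonic u + ι 2) * inv (suc u) ∎
        where open ≤-Reasoning

      0≤M : ∀ s u → 0ℚ ≤ M s u
      0≤M zero    u = 0≤harmonic u
      0≤M (suc s) u = *-nonNeg (+-nonNeg (0≤harmonic u) (0≤ι (2 ℕ.* suc s))) (0≤inv (suc u))

      consecutive : ∀ u → inv (suc u) ≡ inv (suc (suc u)) + inv (suc u) * inv (suc (suc u))
      consecutive u = begin
        x  ≡⟨ *-identityʳ x ⟨
        x * 1ℚ  ≡⟨ cong (x *_) (trans (cong (_* y) (sym (ι-suc (suc u)))) (ι*inv {suc (suc u)} (ℕ.s≤s ℕ.z≤n))) ⟨
        x * ((1ℚ + ι (suc u)) * y)  ≡⟨ lem x y (ι (suc u)) ⟩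
        ι (suc u) * x * y + x * y  ≡⟨ cong (λ a → a * y + x * y) (ι*inv {suc u} (ℕ.s≤s ℕ.z≤n)) ⟩
        1ℚ * y + x * y  ≡⟨ cong (_+ x * y) (*-identityˡ y) ⟩
        y + x * y  ∎
        where
        open ≡-Reasoning
        x = inv (suc u)
        y = inv (suc (suc u))
        lem : ∀ x y z → x * ((1ℚ + z) * y) ≡ z * x * y + x * y
        lem = solve-∀ ℚ-ring

      M-step : ∀ s u → inv (suc u) * M (suc s) (suc u) + M (suc (suc s)) (suc u) ≤ M (suc (suc s)) u
      M-step s u = ≤-by z 0≤z (begin
        x * ((h + x + a) * y) + (h + x + ι (2 ℕ.* suc (suc s))) * y + z
          ≡⟨ cong (λ b → x * ((h + x + a) * y) + (h + x + b) * y + z) (two s) ⟩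
        x * ((h + x + a) * y) + (h + x + (a + (1ℚ + 1ℚ))) * y + x * (y - x * y)
          ≡⟨ lem h a x y ⟩
        (h + (a + (1ℚ + 1ℚ))) * (y + x * y) + x * ((y + x * y) - (y + x * y)) + x * (x * y) + x * y - x * (y + x * y)
          ≡⟨ cong (λ w → (h + (a + (1ℚ + 1ℚ))) * w + x * (w - w) + x * (x * y) + x * y - x * w) (consecutive u) ⟨
        (h + (a + (1ℚ + 1ℚ))) * x + x * (x - x) + x * (x * y) + x * y - x * x
          ≡⟨ lem′ (h + (a + (1ℚ + 1ℚ))) x y ⟩
        (h + (a + (1ℚ + 1ℚ))) * x + x * (y + x * y) - x * x
          ≡⟨ cong (λ w → (h + (a + (1ℚ + 1ℚ))) * x + x * w - x * x) (consecutive u) ⟨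
        (h + (a + (1ℚ + 1ℚ))) * x + x * x - x * x
          ≡⟨ lem″ ((h + (a + (1ℚ + 1ℚ))) * x) (x * x) ⟩
        (h + (a + (1ℚ + 1ℚ))) * x
          ≡⟨ cong (λ b → (h + b) * x) (two s) ⟨
        (h + ι (2 ℕ.* suc (suc s))) * x ∎)
        where
        open ≡-Reasoning
        h = harmonic u
        a = ι (2 ℕ.* suc s)
        x = inv (suc u)
        y = inv (suc (suc u))
        -- The exact slack. An increment b of the offset would leave x y (b - 1 - x); b = 2 is
        -- enough because x ≤ 1.
        z = x * (y - x * y)
        0≤z : 0ℚ ≤ z
        0≤z = *-nonNeg (0≤inv (suc u)) (subst (_≤ y - x * y) (+-inverseʳ (x * y)) (+-monoˡ-≤ (- (x * y))
          (≤-trans (*-mono-right (0≤inv (suc (suc u))) (inv≤1 u)) (≤-reflexive (*-identityˡ y)))))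
        lem : ∀ h a x y → x * ((h + x + a) * y) + (h + x + (a + (1ℚ + 1ℚ))) * y + x * (y - x * y)
            ≡ (h + (a + (1ℚ + 1ℚ))) * (y + x * y) + x * ((y + x * y) - (y + x * y)) + x * (x * y) + x * y - x * (y + x * y)
        lem = solve-∀ ℚ-ring
        lem′ : ∀ q x y → q * x + x * (x - x) + x * (x * y) + x * y - x * x ≡ q * x + x * (y + x * y) - x * x
        lem′ = solve-∀ ℚ-ring
        lem″ : ∀ a b → a + b - b ≡ a
        lem″ = solve-∀ ℚ-ring

      Tr-M : ∀ b m s u → TrB b m (M (suc s)) u ≤ M (suc (suc s)) u
      Tr-M true m s u = ≤-trans (≤-by (ψ (u ℕ.+ (m ∸ u))) (0≤M (suc (suc s)) (u ℕ.+ (m ∸ u))) refl)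
        (Σ-interval-≤ {λ d → inv d * M (suc s) d} {ψ} u (m ∸ u) λ w _ _ → M-step s w)
        where
        ψ = M (suc (suc s))
      Tr-M false m s u = ≤-trans (≤-by (ψ (suc u)) (0≤M (suc (suc s)) (suc u)) refl) (M-step s u)
        where
        ψ = M (suc (suc s))

      Tr-M′ : ∀ {i} s → suc i ℕ.+ s ≡ c → ∀ u → Tr (suc i) (M s) u ≤ M (suc s) u
      Tr-M′ {i} zero    e u = subst (λ b → TrB b (B (suc i)) (M 0) u ≤ M 1 u)
        (trans (sym free-c) (cong free (trans (sym e) (ℕ.+-identityʳ (suc i))))) (Tr-M-c (B (suc i)) u)
      Tr-M′ {i} (suc s) e u = Tr-M (free (suc i)) (B (suc i)) s u

      X-M : ∀ i s → i ℕ.+ s ≡ c → X (M s) i ≤ M c 0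
      X-M zero    s e = ≤-reflexive (trans (X-zero (M s)) (cong (λ s → M s 0) e))
      X-M (suc i) s e = ≤-trans (≤-reflexive (X-suc (M s) i))
        (≤-trans (X-mono i (Tr-M′ s e)) (X-M i (suc s) (suc-rank {i} {s} e)))

      M-0 : ∀ s → M s 0 ≤ ι (2 ℕ.* s)
      M-0 zero    = 0≤ι 0
      M-0 (suc s) = ≤-reflexive (trans (cong (λ a → (0ℚ + ι (2 ℕ.* suc s)) * a) inv-1) (lem (ι (2 ℕ.* suc s))))
        where
        lem : ∀ a → (0ℚ + a) * 1ℚ ≡ a
        lem = solve-∀ ℚ-ring

    -- The harmonic number of d_c is bounded on weighted average, so starting the free sizes at d_c
    -- instead of 0 costs no logarithm.
    X-harmonic : X harmonic c ≤ ι (2 ℕ.* c)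
    X-harmonic = ≤-trans (X-M c 0 (ℕ.+-identityʳ c)) (M-0 c)

  -- Complete chains and the main count.

  module Suffix (free : ℕ → Bool) (B : ℕ → ℕ) (n T c ℓ : ℕ)
                (B-low : ∀ {i} → i ℕ.≤ c → B i ≡ T) (B-high : ∀ {i} → c ℕ.< i → B i ≡ n)
                (1≤c : 1 ℕ.≤ c) (free-c : free c ≡ false)
                (free-high : ∀ {i} → c ℕ.< i → i ℕ.≤ ℓ ℕ.+ c → free i ≡ true)
                (T≤n : T ℕ.≤ n) (1≤T : 1 ℕ.≤ T) where
    open Prefix free B n T c B-low free-c T≤n 1≤T public

    k : ℕ
    k = ℓ ℕ.+ c

    private
      Tr-high : ∀ j → j ℕ.< ℓ → ∀ g u → Tr (suc (j ℕ.+ c)) g u ≡ T∞ g u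
      Tr-high j j<ℓ g u = cong₂ (λ b m → TrB b m g u)
        (free-high (ℕ.s≤s (ℕ.m≤n+m c j)) (ℕ.+-monoˡ-≤ c j<ℓ)) (B-high (ℕ.s≤s (ℕ.m≤n+m c j)))

      X-tail : ∀ a j → j ℕ.≤ ℓ → X (V a) (j ℕ.+ c) ≡ X (V (j ℕ.+ a)) c
      X-tail a zero    _ = refl
      X-tail a (suc j) h = trans (X-suc (V a) (j ℕ.+ c)) (trans (X-cong (j ℕ.+ c) (Tr-high j h (V a)))
        (trans (X-tail (suc a) j (ℕ.<⇒≤ h)) (cong (λ i → X (V i) c) (ℕ.+-suc j a))))

      X-one-V : X one k ≡ X (V ℓ) c
      X-one-V = trans (X-tail 0 ℓ ℕ.≤-refl) (cong (λ i → X (V i) c) (ℕ.+-identityʳ ℓ))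

      0≤Hʲ : ∀ j → 0ℚ ≤ power H j
      0≤Hʲ j = power-nonNeg j 0≤H

    X-upper : ι (ℓ ℕ.!) * X one k ≤ power H ℓ * P
    X-upper = begin
      ι (ℓ ℕ.!) * X one k  ≡⟨ trans (cong (ι (ℓ ℕ.!) *_) X-one-V) (sym (X-*ˡ (ι (ℓ ℕ.!)) (V ℓ) c)) ⟩
      X (λ u → ι (ℓ ℕ.!) * V ℓ u) c  ≤⟨ X-mono c (V-upper ℓ) ⟩
      X (λ _ → power H ℓ) c  ≡⟨ X-const (power H ℓ) c ⟩
      power H ℓ * X one c  ≤⟨ *-mono-left (0≤Hʲ ℓ) X-one-≤P ⟩
      power H ℓ * P  ∎
      where open ≤-Reasoning

    X-lower : H * power H ℓ * X one c ≤
              H * (ι (ℓ ℕ.!) * X one k) + ι ℓ * ((X harmonic c + ι ℓ * X one c) * power H ℓ)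
    X-lower = begin
      H * power H ℓ * X one c
        ≡⟨ X-const (H * power H ℓ) c ⟨
      X (λ _ → H * power H ℓ) c
        ≤⟨ X-mono c (V-lower ℓ) ⟩
      X (λ u → H * (ι (ℓ ℕ.!) * V ℓ u) + ι ℓ * ((harmonic u + ι ℓ) * power H ℓ)) c
        ≡⟨ X-+ main err c ⟩
      X main c + X err c
        ≡⟨ cong₂ _+_
             (trans (X-*ˡ H (λ u → ι (ℓ ℕ.!) * V ℓ u) c) (cong (H *_) (trans (X-*ˡ (ι (ℓ ℕ.!)) (V ℓ) c) (cong (ι (ℓ ℕ.!) *_) (sym X-one-V)))))
             (trans (X-*ˡ (ι ℓ) (λ u → loss u * power H ℓ) c) (cong (ι ℓ *_) (trans
               (X-cong {λ u → loss u * power H ℓ} {λ u → power H ℓ * loss u} c λ u → *-comm (loss u) (power H ℓ))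
               (trans (X-*ˡ (power H ℓ) loss c) (trans (*-comm (power H ℓ) (X loss c)) (cong (_* power H ℓ)
                 (trans (X-+ harmonic (λ _ → ι ℓ) c) (cong (X harmonic c +_) (X-const (ι ℓ) c))))))))) ⟩
      H * (ι (ℓ ℕ.!) * X one k) + ι ℓ * ((X harmonic c + ι ℓ * X one c) * power H ℓ) ∎
      where
      open ≤-Reasoning
      loss main err : ℕ → ℚ
      loss u = harmonic u + ι ℓ
      main u = H * (ι (ℓ ℕ.!) * V ℓ u)
      err u = ι ℓ * (loss u * power H ℓ)

    X-one-high : ∀ j → j ℕ.≤ ℓ → X one (j ℕ.+ c) ≤ power H j * P
    X-one-high zero    _ = ≤-trans X-one-≤P (≤-reflexive (sym (*-identityˡ P)))
    X-one-high (suc j) h = begin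
      X one (suc j ℕ.+ c)  ≡⟨ trans (X-suc one (j ℕ.+ c)) (X-cong (j ℕ.+ c) (Tr-high j h one)) ⟩
      X (T∞ one) (j ℕ.+ c)  ≤⟨ X-mono (j ℕ.+ c) T∞-const ⟩
      X (λ _ → H) (j ℕ.+ c)  ≡⟨ X-const H (j ℕ.+ c) ⟩
      H * X one (j ℕ.+ c)  ≤⟨ *-mono-left 0≤H (X-one-high j (ℕ.<⇒≤ h)) ⟩
      H * (power H j * P)  ≡⟨ *-assoc H _ P ⟨
      H * power H j * P  ∎
      where open ≤-Reasoning

    -- ∑ (d_1 + … + d_i) / (d_1 … d_i)
    Y : ℕ → ℚ
    Y i = Σ[ ds ∈ chains ext i ] v ds * ι (sum ds)

    private
      Σ-inv-ι : ∀ u f → (Σ[ d ∈ interval u f ] inv d * ι d) ≡ ι f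
      Σ-inv-ι u zero    = sym ι-0
      Σ-inv-ι u (suc f) = trans (cong₂ _+_ (trans (*-comm (inv (suc u)) _) (ι*inv {suc u} (ℕ.s≤s ℕ.z≤n))) (Σ-inv-ι (suc u) f)) (sym (ι-suc f))

      ext-high : ∀ j → j ℕ.< ℓ → ∀ xs → ext (suc (j ℕ.+ c)) xs ≡ interval (head0 xs) (n ∸ head0 xs)
      ext-high j j<ℓ xs = cong₂ (λ b m → if b then interval (head0 xs) (m ∸ head0 xs) else suc (head0 xs) ∷ [])
        (free-high (ℕ.s≤s (ℕ.m≤n+m c j)) (ℕ.+-monoˡ-≤ c j<ℓ)) (B-high (ℕ.s≤s (ℕ.m≤n+m c j)))

    -- For the new size d · (1 / d) = 1 gives at most n in place of a harmonic sum; the older sizes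
    -- pick up the factor H.
    Y-suc : ∀ j → j ℕ.< ℓ → Y (suc (j ℕ.+ c)) ≤ ι n * X one (j ℕ.+ c) + H * Y (j ℕ.+ c)
    Y-suc j j<ℓ = begin
      Y (suc i)
        ≡⟨ Σ-chains ext i (λ ds → v ds * ι (sum ds)) ⟩
      (Σ[ xs ∈ chains ext i ] Σ[ d ∈ ext (suc i) xs ] inv d * v xs * ι (d ℕ.+ sum xs))
        ≤⟨ Σ-mono (chains ext i) (λ {xs} _ → inner xs) ⟩
      (Σ[ xs ∈ chains ext i ] ι n * v xs + H * (v xs * ι (sum xs)))
        ≡⟨ trans (Σ-+ _ _ (chains ext i)) (cong₂ _+_ (trans (Σ-*ˡ (ι n) v (chains ext i)) (cong (ι n *_) (Σ-v i))) (Σ-*ˡ H _ (chains ext i))) ⟩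
      ι n * X one i + H * Y i ∎
      where
      open ≤-Reasoning
      i = j ℕ.+ c
      inner : ∀ xs → (Σ[ d ∈ ext (suc i) xs ] inv d * v xs * ι (d ℕ.+ sum xs)) ≤ ι n * v xs + H * (v xs * ι (sum xs))
      inner xs = begin
        (Σ[ d ∈ ext (suc i) xs ] inv d * v xs * ι (d ℕ.+ sum xs))
          ≡⟨ cong (λ ds → Σ[ d ∈ ds ] inv d * v xs * ι (d ℕ.+ sum xs)) (ext-high j j<ℓ xs) ⟩
        (Σ[ d ∈ I ] inv d * v xs * ι (d ℕ.+ sum xs))
          ≡⟨ Σ-cong I (λ {d} _ → trans (cong (inv d * v xs *_) (ι-+ d (sum xs))) (lem (inv d) (v xs) (ι d) (ι (sum xs)))) ⟩
        (Σ[ d ∈ I ] v xs * (inv d * ι d) + v xs * ι (sum xs) * inv d)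
          ≡⟨ trans (Σ-+ _ _ I) (cong₂ _+_ (trans (Σ-*ˡ (v xs) _ I) (cong (v xs *_) (Σ-inv-ι (head0 xs) _))) (Σ-*ˡ (v xs * ι (sum xs)) inv I)) ⟩
        v xs * ι (n ∸ head0 xs) + v xs * ι (sum xs) * G (head0 xs)
          ≤⟨ +-mono-≤ (*-mono-left (0≤v xs) (ι-mono (ℕ.m∸n≤m n (head0 xs)))) (*-mono-left (*-nonNeg (0≤v xs) (0≤ι (sum xs))) (G≤H (head0 xs))) ⟩
        v xs * ι n + v xs * ι (sum xs) * H
          ≡⟨ cong₂ _+_ (*-comm (v xs) (ι n)) (*-comm (v xs * ι (sum xs)) H) ⟩
        ι n * v xs + H * (v xs * ι (sum xs)) ∎
        where
        I = interval (head0 xs) (n ∸ head0 xs)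
        lem : ∀ a b c d → a * b * (c + d) ≡ b * (a * c) + b * d * a
        lem = solve-∀ ℚ-ring

    -- Multiplied through by H to avoid H ^ (j - 1): in each contribution of a free size, one factor
    -- H has been traded for n.
    Y-high : ∀ j → j ℕ.≤ ℓ → H * Y (j ℕ.+ c) ≤ power H j * (H * Y c + ι j * (ι n * P))
    Y-high zero    _ = ≤-reflexive (trans (lem (H * Y c) (ι n * P)) (cong (λ a → 1ℚ * (H * Y c + a * (ι n * P))) (sym ι-0)))
      where
      lem : ∀ a b → a ≡ 1ℚ * (a + 0ℚ * b)
      lem = solve-∀ ℚ-ring
    Y-high (suc j) h = begin
      H * Y (suc (j ℕ.+ c))
        ≤⟨ *-mono-left 0≤H (Y-suc j h) ⟩
      H * (ι n * X one (j ℕ.+ c) + H * Y (j ℕ.+ c))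
        ≤⟨ *-mono-left 0≤H (+-mono-≤ (*-mono-left (0≤ι n) (X-one-high j (ℕ.<⇒≤ h))) (Y-high j (ℕ.<⇒≤ h))) ⟩
      H * (ι n * (power H j * P) + power H j * (H * Y c + ι j * (ι n * P)))
        ≡⟨ lem H (ι n) (power H j) P (Y c) (ι j) ⟩
      H * power H j * (H * Y c + (1ℚ + ι j) * (ι n * P))
        ≡⟨ cong (λ a → H * power H j * (H * Y c + a * (ι n * P))) (ι-suc j) ⟨
      H * power H j * (H * Y c + ι (suc j) * (ι n * P)) ∎
      where
      open ≤-Reasoning
      lem : ∀ H N h P Y j → H * (N * (h * P) + h * (H * Y + j * (N * P))) ≡ H * h * (H * Y + (1ℚ + j) * (N * P))
      lem = solve-∀ ℚ-ring

    chain-tail : ∀ i {ds} → ds ∈ chains ext (suc i) → ∃[ x ] ∃[ xs ] (ds ≡ x ∷ xs × xs ∈ chains ext i × x ∈ ext (suc i) xs)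
    chain-tail i ds∈ with ∈-concatMap-elim _ {xs = chains ext i} ds∈
    ... | xs , xs∈ , ds∈′ with ∈-map⁻ _ ds∈′
    ...   | x , x∈ , eq = x , xs , eq , xs∈ , x∈

    -- A free size is at most T, but forced steps can continue past T, one unit per rank.
    head-bound : ∀ i {ds} → i ℕ.≤ c → ds ∈ chains ext i → head0 ds ℕ.≤ T ℕ.+ i
    head-bound zero    _ (here refl) = ℕ.z≤n
    head-bound (suc i) h ds∈ with chain-tail i ds∈
    ... | x , xs , refl , xs∈ , x∈ = bound (free (suc i)) x∈
      where
      u≤ : head0 xs ℕ.≤ T ℕ.+ i
      u≤ = head-bound i (ℕ.<⇒≤ h) xs∈
      max≤ : head0 xs ℕ.+ (B (suc i) ∸ head0 xs) ℕ.≤ T ℕ.+ suc i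
      max≤ with ℕ.≤-total (B (suc i)) (head0 xs)
      ... | inj₁ B≤u = ℕ.≤-trans (ℕ.≤-reflexive (trans (cong (head0 xs ℕ.+_) (ℕ.m≤n⇒m∸n≡0 B≤u)) (ℕ.+-identityʳ _)))
                         (ℕ.≤-trans u≤ (ℕ.+-monoʳ-≤ T (ℕ.n≤1+n i)))
      ... | inj₂ u≤B = ℕ.≤-trans (ℕ.≤-reflexive (trans (ℕ.m+[n∸m]≡n u≤B) (B-low h))) (ℕ.m≤m+n T (suc i))
      bound : ∀ b → x ∈ (if b then interval (head0 xs) (B (suc i) ∸ head0 xs) else suc (head0 xs) ∷ []) → x ℕ.≤ T ℕ.+ suc i
      bound true  x∈          = ℕ.≤-trans (∈-interval⁻-≤ (head0 xs) _ x∈) max≤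
      bound false (here refl) = ℕ.≤-trans (ℕ.s≤s u≤) (ℕ.≤-reflexive (sym (ℕ.+-suc T i)))

    sum-bound : ∀ i {ds} → i ℕ.≤ c → ds ∈ chains ext i → sum ds ℕ.≤ i ℕ.* (T ℕ.+ c)
    sum-bound zero    _ (here refl) = ℕ.z≤n
    sum-bound (suc i) h ds∈ with chain-tail i ds∈ | head-bound (suc i) h ds∈
    ... | x , xs , refl , xs∈ , x∈ | x≤ = ℕ.+-mono-≤ (ℕ.≤-trans x≤ (ℕ.+-monoʳ-≤ T h)) (sum-bound i (ℕ.<⇒≤ h) xs∈)

    Y-c : Y c ≤ ι (c ℕ.* (T ℕ.+ c)) * P
    Y-c = begin
      Y c  ≤⟨ Σ-mono (chains ext c) (λ {ds} ds∈ → *-mono-left (0≤v ds) (ι-mono (sum-bound c ℕ.≤-refl ds∈))) ⟩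
      (Σ[ ds ∈ chains ext c ] v ds * ι (c ℕ.* (T ℕ.+ c)))  ≡⟨ X-const (ι (c ℕ.* (T ℕ.+ c))) c ⟩
      ι (c ℕ.* (T ℕ.+ c)) * X one c  ≤⟨ *-mono-left (0≤ι (c ℕ.* (T ℕ.+ c))) X-one-≤P ⟩
      ι (c ℕ.* (T ℕ.+ c)) * P  ∎
      where open ≤-Reasoning

    chain-split : ∀ j {ds} → ds ∈ chains ext (j ℕ.+ c) → ∃[ es ] ∃[ fs ] (ds ≡ es ++ fs × length es ≡ j × fs ∈ chains ext c)
    chain-split zero    ds∈ = [] , _ , refl , refl , ds∈
    chain-split (suc j) ds∈ with chain-tail (j ℕ.+ c) ds∈
    ... | x , xs , refl , xs∈ , _ with chain-split j xs∈
    ...   | es , fs , refl , e , fs∈ = x ∷ es , fs , refl , cong suc e , fs∈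

    open Counting n

    -- (T + c)² k, a bound for the factor t (t + 1) (k - 1) in `estimate-pair`.
    W : ℕ
    W = (T ℕ.+ c) ℕ.* (T ℕ.+ c) ℕ.* k

    private
      forced-head : ∀ {c₁ x xs} → suc c₁ ≡ c → x ∈ ext (suc c₁) xs → x ≡ suc (head0 xs)
      forced-head {c₁} {x} {xs} e x∈ = go (subst (λ b → x ∈ (if b then interval (head0 xs) (B (suc c₁) ∸ head0 xs) else suc (head0 xs) ∷ []))
                                            (trans (cong free e) free-c) x∈)
        where
        go : x ∈ suc (head0 xs) ∷ [] → x ≡ suc (head0 xs)
        go (here e) = e

      estimate-at : ∀ c₁ es fs → suc c₁ ≡ c → length es ≡ ℓ → fs ∈ chains ext (suc c₁) → All (1 ℕ.≤_) (es ++ fs) →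
                    Estimate (es ++ fs) (k ∸ 1) W (sum (es ++ fs))
      estimate-at c₁ es fs e le fs∈ ds>0 with chain-tail c₁ fs∈
      ... | x , [] , refl , xs∈ , x∈ rewrite forced-head {c₁} {x} {[]} e x∈ =
        subst (λ j → Estimate (es ++ 1 ∷ []) j W (sum (es ++ 1 ∷ []))) len
          (estimate-weaken ℕ.z≤n (ℕ.≤-trans (ℕ.m≤m+n (sum es) 1) (ℕ.≤-reflexive (sym (sum-++ es (1 ∷ []))))) (estimate-1 es (All.++⁻ˡ es ds>0)))
        where
        len : length es ≡ k ∸ 1
        len = trans le (trans (sym (ℕ.m+n∸n≡m ℓ 1)) (cong (λ m → ℓ ℕ.+ m ∸ 1) (trans (cong suc (proj₂ (∈-chains⁻ c₁ xs∈))) e)))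
      ... | x , t ∷ gs , refl , xs∈ , x∈ rewrite forced-head {c₁} {x} {t ∷ gs} e x∈ =
        subst (λ j → Estimate (es ++ suc t ∷ t ∷ gs) j W (sum (es ++ suc t ∷ t ∷ gs))) len
          (estimate-weaken w≤ ℕ.≤-refl (estimate-pair t es gs 1≤t (All.++⁺ (All.++⁻ˡ es ds>0) (drop₂ (All.++⁻ʳ es ds>0)))))
        where
        drop₂ : ∀ {a b : ℕ} {xs : List ℕ} → All (1 ℕ.≤_) (a ∷ b ∷ xs) → All (1 ℕ.≤_) xs
        drop₂ (_ ∷ _ ∷ p) = p
        1≤t : 1 ℕ.≤ t
        1≤t = All.head (All.tail (All.++⁻ʳ es ds>0))
        len : suc (length (es ++ gs)) ≡ k ∸ 1
        len = trans (cong suc (trans (length-++ es) (cong (ℕ._+ length gs) le)))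
          (trans (sym (ℕ.+-suc ℓ (length gs))) (trans (sym (ℕ.m+n∸n≡m (ℓ ℕ.+ suc (length gs)) 1)) fin))
          where
          fin : ℓ ℕ.+ suc (length gs) ℕ.+ 1 ∸ 1 ≡ k ∸ 1
          fin = cong (_∸ 1) (trans (ℕ.+-assoc ℓ _ 1) (cong (ℓ ℕ.+_) (trans (ℕ.+-comm (suc (length gs)) 1) (trans (cong suc (proj₂ (∈-chains⁻ c₁ xs∈))) e))))
        st≤ : suc t ℕ.≤ T ℕ.+ c
        st≤ = ℕ.≤-trans (ℕ.s≤s (head-bound c₁ (ℕ.≤-trans (ℕ.n≤1+n c₁) (ℕ.≤-reflexive e)) xs∈))
                (ℕ.≤-reflexive (trans (sym (ℕ.+-suc T c₁)) (cong (T ℕ.+_) e)))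
        w≤ : t ℕ.* suc t ℕ.* suc (length (es ++ gs)) ℕ.≤ W
        w≤ = ℕ.*-mono-≤ (ℕ.*-mono-≤ (ℕ.≤-trans (ℕ.n≤1+n t) st≤) st≤) (ℕ.≤-trans (ℕ.≤-reflexive len) (ℕ.m∸n≤m k 1))

    estimate : ∀ {ds} → ds ∈ chains ext k → Estimate ds (k ∸ 1) W (sum ds)
    estimate {ds} ds∈ with chain-split ℓ ds∈
    ... | es , fs , refl , le , fs∈ = go c refl fs∈
      where
      ds>0 : All (1 ℕ.≤_) (es ++ fs)
      ds>0 = descending-pos (good-descending (proj₁ (∈-chains⁻ k ds∈)))
      go : ∀ c′ → c′ ≡ c → fs ∈ chains ext c′ → Estimate (es ++ fs) (k ∸ 1) W (sum (es ++ fs))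
      go zero     e _ = contradiction (subst (1 ℕ.≤_) (sym e) 1≤c) λ ()
      go (suc c₁) e h = estimate-at c₁ es fs e le h ds>0

    mainCount : ℕ
    mainCount = ∑ (chains ext k) λ ds → cnt ds δ 0

    private
      J : ℕ
      J = k ∸ 1
      scaled : List ℕ → ℚ
      scaled ds = ι n * (ι (J ℕ.!) * ι (cnt ds δ 0))
      normalise : ∀ {ds} → ds ∈ chains ext k → v ds * ι (n ℕ.* (J ℕ.! ℕ.* product ds ℕ.* cnt ds δ 0)) ≡ scaled ds
      normalise {ds} ds∈ = begin
        v ds * ι (n ℕ.* (J ℕ.! ℕ.* product ds ℕ.* cnt ds δ 0))
          ≡⟨ cong (v ds *_) (trans (ι-* n _) (cong (ι n *_) (trans (ι-* (J ℕ.! ℕ.* product ds) _) (cong (_* ι (cnt ds δ 0)) (ι-* (J ℕ.!) (product ds)))))) ⟩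
        v ds * (ι n * (ι (J ℕ.!) * ι (product ds) * ι (cnt ds δ 0)))
          ≡⟨ lem (v ds) (ι n) (ι (J ℕ.!)) (ι (product ds)) (ι (cnt ds δ 0)) ⟩
        (v ds * ι (product ds)) * scaled ds
          ≡⟨ cong (_* scaled ds) (v*product (descending-pos (good-descending (proj₁ (∈-chains⁻ k ds∈))))) ⟩
        1ℚ * scaled ds
          ≡⟨ *-identityˡ (scaled ds) ⟩
        scaled ds ∎
        where
        open ≡-Reasoning
        lem : ∀ a b c d e → a * (b * (c * d * e)) ≡ (a * d) * (b * (c * e))
        lem = solve-∀ ℚ-ring
      Σ-scaled : Σ (chains ext k) scaled ≡ ι n * (ι (J ℕ.!) * ι mainCount)
      Σ-scaled = trans (Σ-*ˡ (ι n) _ (chains ext k)) (cong (ι n *_) (trans (Σ-*ˡ (ι (J ℕ.!)) _ (chains ext k))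
        (cong (ι (J ℕ.!) *_) (sym (ι-∑ (λ ds → cnt ds δ 0) (chains ext k))))))

    main-upper : ι n * (ι (J ℕ.!) * ι mainCount) ≤ ι (n ℕ.^ J) * ((ι n + ι W) * X one k)
    main-upper = begin
      ι n * (ι (J ℕ.!) * ι mainCount)
        ≡⟨ Σ-scaled ⟨
      Σ (chains ext k) scaled
        ≤⟨ Σ-mono (chains ext k) (λ {ds} ds∈ → ≤-trans (≤-reflexive (sym (normalise ds∈))) (*-mono-left (0≤v ds) (ι-mono (Estimate.upper (estimate ds∈))))) ⟩
      (Σ[ ds ∈ chains ext k ] v ds * ι (n ℕ.^ suc J ℕ.+ W ℕ.* n ℕ.^ J))
        ≡⟨ X-const (ι (n ℕ.^ suc J ℕ.+ W ℕ.* n ℕ.^ J)) k ⟩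
      ι (n ℕ.^ suc J ℕ.+ W ℕ.* n ℕ.^ J) * X one k
        ≡⟨ cong (_* X one k) (trans (ι-+ (n ℕ.^ suc J) _) (cong₂ _+_ (ι-* n (n ℕ.^ J)) (ι-* W (n ℕ.^ J)))) ⟩
      (ι n * ι (n ℕ.^ J) + ι W * ι (n ℕ.^ J)) * X one k
        ≡⟨ lem (ι n) (ι (n ℕ.^ J)) (ι W) (X one k) ⟩
      ι (n ℕ.^ J) * ((ι n + ι W) * X one k) ∎
      where
      open ≤-Reasoning
      lem : ∀ a b w x → (a * b + w * b) * x ≡ b * ((a + w) * x)
      lem = solve-∀ ℚ-ring

    main-lower : ι (n ℕ.^ J) * (ι n * X one k) ≤
                 ι n * (ι (J ℕ.!) * ι mainCount) + ι (n ℕ.^ J) * (ι (suc J) * Y k + ι W * X one k)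
    main-lower = begin
      ι (n ℕ.^ J) * (ι n * X one k)
        ≡⟨ trans (lem (ι (n ℕ.^ J)) (ι n) (X one k)) (cong (_* X one k) (sym (ι-* n (n ℕ.^ J)))) ⟩
      ι (n ℕ.^ suc J) * X one k
        ≡⟨ X-const (ι (n ℕ.^ suc J)) k ⟨
      (Σ[ ds ∈ chains ext k ] v ds * ι (n ℕ.^ suc J))
        ≤⟨ Σ-mono (chains ext k) (λ {ds} ds∈ → ≤-trans (*-mono-left (0≤v ds) (ι-mono (Estimate.lower (estimate ds∈)))) (≤-reflexive (each ds∈))) ⟩
      (Σ[ ds ∈ chains ext k ] scaled ds + (C * ι (suc J) * (v ds * ι (sum ds)) + C * ι W * v ds))
        ≡⟨ trans (Σ-+ scaled _ (chains ext k)) (cong₂ _+_ Σ-scaled (trans (Σ-+ _ _ (chains ext k))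
             (cong₂ _+_ (Σ-*ˡ (C * ι (suc J)) _ (chains ext k)) (trans (Σ-*ˡ (C * ι W) v (chains ext k)) (cong (C * ι W *_) (Σ-v k)))))) ⟩
      ι n * (ι (J ℕ.!) * ι mainCount) + (C * ι (suc J) * Y k + C * ι W * X one k)
        ≡⟨ cong (ι n * (ι (J ℕ.!) * ι mainCount) +_) (lem″ C (ι (suc J)) (Y k) (ι W) (X one k)) ⟩
      ι n * (ι (J ℕ.!) * ι mainCount) + C * (ι (suc J) * Y k + ι W * X one k) ∎
      where
      open ≤-Reasoning
      C = ι (n ℕ.^ J)
      lem : ∀ a b x → a * (b * x) ≡ b * a * x
      lem = solve-∀ ℚ-ring
      lem′ : ∀ v a s t C w → v * (a + s * t * C + w * C) ≡ v * a + (C * s * (v * t) + C * w * v)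
      lem′ = solve-∀ ℚ-ring
      lem″ : ∀ C s y w x → C * s * y + C * w * x ≡ C * (s * y + w * x)
      lem″ = solve-∀ ℚ-ring
      each : ∀ {ds} → ds ∈ chains ext k →
        v ds * ι (n ℕ.* (J ℕ.! ℕ.* product ds ℕ.* cnt ds δ 0) ℕ.+ suc J ℕ.* sum ds ℕ.* n ℕ.^ J ℕ.+ W ℕ.* n ℕ.^ J)
          ≡ scaled ds + (C * ι (suc J) * (v ds * ι (sum ds)) + C * ι W * v ds)
      each {ds} ds∈ = trans (cong (v ds *_) (trans (ι-+ (a ℕ.+ b) (W ℕ.* n ℕ.^ J)) (cong₂ _+_ (trans (ι-+ a b)
          (cong (ι a +_) (trans (ι-* (suc J ℕ.* sum ds) (n ℕ.^ J)) (cong (_* C) (ι-* (suc J) (sum ds)))))) (ι-* W (n ℕ.^ J)))))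
        (trans (lem′ (v ds) (ι a) (ι (suc J)) (ι (sum ds)) C (ι W)) (cong (_+ (C * ι (suc J) * (v ds * ι (sum ds)) + C * ι W * v ds)) (normalise ds∈)))
        where
        a = n ℕ.* (J ℕ.! ℕ.* product ds ℕ.* cnt ds δ 0)
        b = suc J ℕ.* sum ds ℕ.* n ℕ.^ J

  -- Binary length and the sizes of logarithmic quantities.

  2^-pos : ∀ L → 1 ℕ.≤ 2 ℕ.^ L
  2^-pos L = ℕ.m^n>0 2 L

  -- An integer stand-in for log n: n < 2 ^ L makes L dominate the harmonic number, and 2 ^ L ≤ 2 n
  -- makes every fixed power of L O(n).
  binary-length : ∀ n → 1 ℕ.≤ n → ∃[ L ] (n ℕ.< 2 ℕ.^ L × 2 ℕ.^ L ℕ.≤ 2 ℕ.* n)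
  binary-length (suc zero)    _ = 1 , ℕ.≤-refl , ℕ.≤-refl
  binary-length (suc (suc m)) _ with binary-length (suc m) (ℕ.s≤s ℕ.z≤n)
  ... | L , n< , ≤2n with ℕ.m≤n⇒m<n∨m≡n n<
  ...   | inj₁ n+1< = L , n+1< , ℕ.≤-trans ≤2n (ℕ.*-monoʳ-≤ 2 (ℕ.n≤1+n (suc m)))
  ...   | inj₂ n+1≡ = suc L , ℕ.≤-trans (ℕ.m<m+n (suc (suc m)) {suc (suc m)} (ℕ.s≤s ℕ.z≤n)) (ℕ.≤-reflexive (trans (cong (suc (suc m) ℕ.+_) (sym (ℕ.+-identityʳ _))) (cong (2 ℕ.*_) n+1≡)))
                        , ℕ.≤-reflexive (cong (2 ℕ.*_) (sym n+1≡))

  Σ-≤-const : ∀ {f : ℕ → ℚ} {b} u k → (∀ {d} → d ∈ interval u k → f d ≤ b) → Σ (interval u k) f ≤ ι k * b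
  Σ-≤-const {f} {b} u zero    h = ≤-reflexive (sym (trans (cong (_* b) ι-0) (*-zeroˡ b)))
  Σ-≤-const {f} {b} u (suc k) h = ≤-trans (+-mono-≤ (h (here refl)) (Σ-≤-const (suc u) k (h ∘ there)))
    (≤-reflexive (trans (lem b (ι k)) (cong (_* b) (sym (ι-suc k)))))
    where
    lem : ∀ b a → b + a * b ≡ (1ℚ + a) * b
    lem = solve-∀ ℚ-ring

  -- Dyadic blocks: the reciprocals of 2 ^ L, ..., 2 ^ (L + 1) - 1 add up to at most 1.
  harmonic-≤ : ∀ L {n} → n ℕ.< 2 ℕ.^ L → harmonic n ≤ ι L
  harmonic-≤ zero    {zero} _ = 0≤ι 0
  harmonic-≤ zero    {suc n} (ℕ.s≤s ())
  harmonic-≤ (suc L) {n} n< with ℕ.≤-<-connex (2 ℕ.^ L) n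
  ... | inj₂ n<′ = ≤-trans (harmonic-≤ L n<′) (ι-mono (ℕ.n≤1+n L))
  ... | inj₁ M≤n with 2 ℕ.^ L in eq | 2^-pos L
  ...   | suc h | _ = begin
    harmonic n  ≡⟨ cong harmonic (ℕ.m+[n∸m]≡n h≤n) ⟨
    harmonic (h ℕ.+ (n ∸ h))  ≡⟨ Σ-inv h (n ∸ h) ⟨
    Σ (interval h (n ∸ h)) inv + harmonic h  ≤⟨ +-mono-≤ top (harmonic-≤ L (subst (h ℕ.<_) (sym eq) ℕ.≤-refl)) ⟩
    1ℚ + ι L  ≡⟨ ι-suc L ⟨
    ι (suc L)  ∎
    where
    open ≤-Reasoning
    h≤n : h ℕ.≤ n
    h≤n = ℕ.≤-trans (ℕ.n≤1+n h) M≤n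
    count : n ∸ h ℕ.≤ suc h
    count = ℕ.≤-trans (ℕ.∸-monoˡ-≤ h (ℕ.≤-pred n<)) (ℕ.≤-reflexive (trans (ℕ.m+n∸m≡n h (suc h ℕ.+ 0)) (ℕ.+-identityʳ (suc h))))
    top : Σ (interval h (n ∸ h)) inv ≤ 1ℚ
    top = begin
      Σ (interval h (n ∸ h)) inv  ≤⟨ Σ-≤-const {inv} h (n ∸ h) (λ d∈ → inv-antimono {suc h} (ℕ.s≤s ℕ.z≤n) (∈-interval⁻ h _ d∈)) ⟩
      ι (n ∸ h) * inv (suc h)  ≤⟨ *-mono-right (0≤inv (suc h)) (ι-mono count) ⟩
      ι (suc h) * inv (suc h)  ≡⟨ ι*inv {suc h} (ℕ.s≤s ℕ.z≤n) ⟩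
      1ℚ  ∎

  suc≤2^ : ∀ m → suc m ℕ.≤ 2 ℕ.^ m
  suc≤2^ zero    = ℕ.≤-refl
  suc≤2^ (suc m) = ℕ.+-mono-≤ (2^-pos m) (ℕ.≤-trans (suc≤2^ m) (ℕ.≤-reflexive (sym (ℕ.+-identityʳ _))))

  *-^ : ∀ a b q → (a ℕ.* b) ℕ.^ q ≡ a ℕ.^ q ℕ.* b ℕ.^ q
  *-^ a b zero    = refl
  *-^ a b (suc q) = trans (cong (a ℕ.* b ℕ.*_) (*-^ a b q)) (lem a b (a ℕ.^ q) (b ℕ.^ q))
    where
    lem : ∀ a b c d → a ℕ.* b ℕ.* (c ℕ.* d) ≡ a ℕ.* c ℕ.* (b ℕ.* d)
    lem = ℕ-Solver.solve-∀

  -- The Q-th power of L ≤ Q · 2 ^ ⌊L / Q⌋, which is m + 1 ≤ 2 ^ m applied to the quotient.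
  polynomial-≤-exponential : ∀ q L → let Q = suc q in L ℕ.^ Q ℕ.≤ Q ℕ.^ Q ℕ.* 2 ℕ.^ L
  polynomial-≤-exponential q L = begin
    L ℕ.^ Q  ≤⟨ ℕ.^-monoˡ-≤ Q L≤ ⟩
    (Q ℕ.* 2 ℕ.^ m) ℕ.^ Q  ≡⟨ *-^ Q (2 ℕ.^ m) Q ⟩
    Q ℕ.^ Q ℕ.* (2 ℕ.^ m) ℕ.^ Q  ≡⟨ cong (Q ℕ.^ Q ℕ.*_) (ℕ.^-*-assoc 2 m Q) ⟩
    Q ℕ.^ Q ℕ.* 2 ℕ.^ (m ℕ.* Q)  ≤⟨ ℕ.*-monoʳ-≤ (Q ℕ.^ Q) (ℕ.^-monoʳ-≤ 2 (ℕ.m/n*n≤m L Q)) ⟩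
    Q ℕ.^ Q ℕ.* 2 ℕ.^ L  ∎
    where
    open ℕ.≤-Reasoning
    Q = suc q
    m = L ℕ./ Q
    L≤ : L ℕ.≤ Q ℕ.* 2 ℕ.^ m
    L≤ = begin
      L  ≡⟨ ℕ.m≡m%n+[m/n]*n L Q ⟩
      L ℕ.% Q ℕ.+ m ℕ.* Q  ≤⟨ ℕ.+-monoˡ-≤ (m ℕ.* Q) (ℕ.<⇒≤ (ℕ.m%n<n L Q)) ⟩
      suc m ℕ.* Q  ≤⟨ ℕ.*-monoˡ-≤ Q (suc≤2^ m) ⟩
      2 ℕ.^ m ℕ.* Q  ≡⟨ ℕ.*-comm (2 ℕ.^ m) Q ⟩
      Q ℕ.* 2 ℕ.^ m  ∎

  -- Each d has at most n / d multiplicities m with m d < n.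
  R-≤ : ∀ n L → harmonic n ≤ ι L → Counting.R n ℕ.≤ n ℕ.* L
  R-≤ n L H≤L = ι-cancel (begin
    ι R  ≡⟨ ι-∑ (λ d → act d (P 0) 0) (interval 0 n) ⟩
    (Σ[ d ∈ interval 0 n ] ι (act d (P 0) 0))  ≤⟨ Σ-mono (interval 0 n) (λ {d} d∈ → each (∈-interval⁻ 0 n d∈)) ⟩
    (Σ[ d ∈ interval 0 n ] ι n * inv d)  ≡⟨ Σ-*ˡ (ι n) inv (interval 0 n) ⟩
    ι n * Σ (interval 0 n) inv  ≡⟨ cong (ι n *_) (trans (sym (+-identityʳ _)) (Σ-inv 0 n)) ⟩
    ι n * harmonic n  ≤⟨ *-mono-left (0≤ι n) H≤L ⟩
    ι n * ι L  ≡⟨ ι-* n L ⟨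
    ι (n ℕ.* L)  ∎)
    where
    open ≤-Reasoning
    open Counting n
    each : ∀ {d} → 0 ℕ.< d → ι (act d (P 0) 0) ≤ ι n * inv d
    each {d} 0<d = cancel-ι 0<d (begin
      ι d * ι (act d (P 0) 0)  ≡⟨ ι-* d _ ⟨
      ι (d ℕ.* act d (P 0) 0)  ≤⟨ ι-mono (lt-≤ d 0) ⟩
      ι n  ≡⟨ trans (lem (ι d) (ι n) (inv d)) (trans (cong (ι n *_) (ι*inv 0<d)) (*-identityʳ (ι n))) ⟨
      ι d * (ι n * inv d)  ∎)
      where
      lem : ∀ a b c → a * (b * c) ≡ b * (a * c)
      lem = solve-∀ ℚ-ring

  -- Mercator's series against the harmonic number.

  module Mercator (n : ℕ) (1≤n : 1 ℕ.≤ n) where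

    private
      r x : ℚ
      r = inv n
      x = 1ℚ - r

      S : ℕ → ℚ
      S = mercatorSum x

      r≤1 : r ≤ 1ℚ
      r≤1 = subst (r ≤_) inv-1 (inv-antimono {1} ℕ.≤-refl 1≤n)

      0≤x : 0ℚ ≤ x
      0≤x = subst (_≤ x) (+-inverseʳ r) (+-monoˡ-≤ (- r) r≤1)

      x≤1 : x ≤ 1ℚ
      x≤1 = ≤-by r (0≤inv n) (lem r)
        where
        lem : ∀ r → 1ℚ - r + r ≡ 1ℚ
        lem = solve-∀ ℚ-ring

      power≤1 : ∀ i → power x i ≤ 1ℚ
      power≤1 zero    = ≤-refl
      power≤1 (suc i) = ≤-trans (*-mono-≤ 0≤x 0≤1 x≤1 (power≤1 i)) ≤-refl

      bernoulli : ∀ i → 1ℚ ≤ power x i + ι i * r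
      bernoulli zero    = ≤-by (ι 0 * r) (*-nonNeg (0≤ι 0) (0≤inv n)) refl
      bernoulli (suc i) = begin
        1ℚ  ≡⟨ lem₁ r ⟩
        x * 1ℚ + r  ≤⟨ +-monoˡ-≤ r (*-mono-left 0≤x (bernoulli i)) ⟩
        x * (X + ι i * r) + r  ≡⟨ cong (_+ r) (*-distribˡ-+ x X (ι i * r)) ⟩
        x * X + x * (ι i * r) + r  ≤⟨ +-monoˡ-≤ r (+-monoʳ-≤ (x * X) (*-mono-right (*-nonNeg (0≤ι i) (0≤inv n)) x≤1)) ⟩
        x * X + 1ℚ * (ι i * r) + r  ≡⟨ lem₂ (x * X) (ι i) r ⟩
        x * X + (1ℚ + ι i) * r  ≡⟨ cong (λ a → x * X + a * r) (ι-suc i) ⟨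
        x * X + ι (suc i) * r  ∎
        where
        open ≤-Reasoning
        X = power x i
        lem₁ : ∀ r → 1ℚ ≡ (1ℚ - r) * 1ℚ + r
        lem₁ = solve-∀ ℚ-ring
        lem₂ : ∀ a i r → a + 1ℚ * (i * r) + r ≡ a + (1ℚ + i) * r
        lem₂ = solve-∀ ℚ-ring

      term : ∀ i → S (suc i) ≡ S i + power x (suc i) * inv (suc i)
      term i = cong (λ a → S i + power x (suc i) * a) (sym (inv≡ i))

      -- By Bernoulli x ^ i ≥ 1 - i / n, so the i-th term falls short of 1 / i by at most 1 / n.
      -- Over the first n terms this adds up to 1.
      harmonic-≤-S : ∀ i → harmonic i ≤ S i + ι i * r
      harmonic-≤-S zero    = ≤-by (ι 0 * r) (*-nonNeg (0≤ι 0) (0≤inv n)) refl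
      harmonic-≤-S (suc i) = begin
        harmonic i + y  ≤⟨ +-monoʳ-≤ (harmonic i) step ⟩
        harmonic i + (X * y + r)  ≤⟨ +-monoˡ-≤ (X * y + r) (harmonic-≤-S i) ⟩
        S i + ι i * r + (X * y + r)  ≡⟨ lem (S i) (ι i) r (X * y) ⟩
        S i + X * y + (1ℚ + ι i) * r  ≡⟨ cong₂ (λ a b → a + b * r) (term i) (ι-suc i) ⟨
        S (suc i) + ι (suc i) * r  ∎
        where
        open ≤-Reasoning
        y = inv (suc i)
        X = power x (suc i)
        lem : ∀ s i r a → s + i * r + (a + r) ≡ s + a + (1ℚ + i) * r
        lem = solve-∀ ℚ-ring
        lem′ : ∀ X i r y → (X + i * r) * y ≡ X * y + i * y * r
        lem′ = solve-∀ ℚ-ring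
        step : y ≤ X * y + r
        step = begin
          y  ≡⟨ *-identityˡ y ⟨
          1ℚ * y  ≤⟨ *-mono-right (0≤inv (suc i)) (bernoulli (suc i)) ⟩
          (X + ι (suc i) * r) * y  ≡⟨ lem′ X (ι (suc i)) r y ⟩
          X * y + ι (suc i) * y * r  ≡⟨ cong (λ a → X * y + a * r) (ι*inv {suc i} (ℕ.s≤s ℕ.z≤n)) ⟩
          X * y + 1ℚ * r  ≡⟨ cong (X * y +_) (*-identityˡ r) ⟩
          X * y + r  ∎

      S-mono : ∀ d → S n ≤ S (d ℕ.+ n)
      S-mono zero    = ≤-refl
      S-mono (suc d) = ≤-trans (S-mono d) (≤-by (power x (suc i) * inv (suc i)) (*-nonNeg (power-nonNeg (suc i) 0≤x) (0≤inv (suc i))) (sym (term i)))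
        where i = d ℕ.+ n

      S-≤-harmonic : ∀ i → S i ≤ harmonic i
      S-≤-harmonic zero    = ≤-refl
      S-≤-harmonic (suc i) = ≤-trans (≤-reflexive (term i)) (+-mono-≤ (S-≤-harmonic i)
        (≤-trans (*-mono-right (0≤inv (suc i)) (power≤1 (suc i))) (≤-reflexive (*-identityˡ (inv (suc i))))))

      -- For i ≥ n the term x ^ (i + 1) / (i + 1) is at most x ^ i / n = x ^ i - x ^ (i + 1), so the
      -- tail telescopes.
      S-tail : ∀ d → S (d ℕ.+ n) + power x (d ℕ.+ n) ≤ S n + power x n
      S-tail zero    = ≤-refl
      S-tail (suc d) = ≤-trans (begin
        S (suc i) + x * X  ≡⟨ cong (_+ x * X) (term i) ⟩
        S i + x * X * y + x * X  ≤⟨ +-monoˡ-≤ (x * X) (+-monoʳ-≤ (S i) small) ⟩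
        S i + X * r + x * X  ≡⟨ lem (S i) X r ⟩
        S i + X  ∎) (S-tail d)
        where
        open ≤-Reasoning
        i = d ℕ.+ n
        X = power x i
        y = inv (suc i)
        lem : ∀ s X r → s + X * r + (1ℚ - r) * X ≡ s + X
        lem = solve-∀ ℚ-ring
        small : x * X * y ≤ X * r
        small = *-mono-≤ (power-nonNeg (suc i) 0≤x) (0≤inv n)
          (≤-trans (*-mono-right (power-nonNeg i 0≤x) x≤1) (≤-reflexive (*-identityˡ X)))
          (inv-antimono 1≤n (ℕ.≤-trans (ℕ.m≤n+m n d) (ℕ.n≤1+n i)))

    mercator-≥ : ∀ m → n ℕ.≤ m → harmonic n ≤ S m + 1ℚ
    mercator-≥ m n≤m = begin
      harmonic n  ≤⟨ harmonic-≤-S n ⟩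
      S n + ι n * r  ≡⟨ cong (S n +_) (ι*inv 1≤n) ⟩
      S n + 1ℚ  ≤⟨ +-monoˡ-≤ 1ℚ (S-mono (m ∸ n)) ⟩
      S (m ∸ n ℕ.+ n) + 1ℚ  ≡⟨ cong (λ i → S i + 1ℚ) (ℕ.m∸n+n≡m n≤m) ⟩
      S m + 1ℚ  ∎
      where open ≤-Reasoning

    mercator-≤ : ∀ m → n ℕ.≤ m → S m ≤ harmonic n + 1ℚ
    mercator-≤ m n≤m = begin
      S m  ≡⟨ cong S (ℕ.m∸n+n≡m n≤m) ⟨
      S (m ∸ n ℕ.+ n)  ≤⟨ ≤-by (power x (m ∸ n ℕ.+ n)) (power-nonNeg (m ∸ n ℕ.+ n) 0≤x) refl ⟩
      S (m ∸ n ℕ.+ n) + power x (m ∸ n ℕ.+ n)  ≤⟨ S-tail (m ∸ n) ⟩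
      S n + power x n  ≤⟨ +-mono-≤ (S-≤-harmonic n) (power≤1 n) ⟩
      harmonic n + 1ℚ  ∎
      where open ≤-Reasoning

  -- The product in the denominator.

  module Denominator (free : ℕ → Bool) (B : ℕ → ℕ) (n T c : ℕ)
                     (B-low : ∀ {i} → i ℕ.≤ c → B i ≡ T)
                     (free-c : free c ≡ false) (T≤n : T ℕ.≤ n) (1≤T : 1 ℕ.≤ T)
                     (a : ℕ → ℕ) (a-step : ∀ j → a (suc j) ≡ 0 ⊎ a (suc j) ℕ.< a j) (a₀<c : a 0 ℕ.< c)
                     (free⇒a : ∀ {i} → i ℕ.< c → free i ≡ true → ∃[ j ] a j ≡ i)
                     (a⇒free : ∀ j → 0 ℕ.< a j → free (a j) ≡ true) where
    open Prefix free B n T c B-low free-c T≤n 1≤T using (r; K; P)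

    private
      f : ℕ → ℕ
      f j = c ∸ a j ∸ j

      a-mono : ∀ j d → a (d ℕ.+ j) ≡ 0 ⊎ a (d ℕ.+ j) ℕ.+ d ℕ.≤ a j
      a-mono j zero    = inj₂ (ℕ.≤-reflexive (ℕ.+-identityʳ (a j)))
      a-mono j (suc d) with a-step (d ℕ.+ j)
      ... | inj₁ z = inj₁ z
      ... | inj₂ h with a-mono j d
      ...   | inj₁ z = contradiction (subst (a (suc d ℕ.+ j) ℕ.<_) z h) λ ()
      ...   | inj₂ le = inj₂ (ℕ.≤-trans (ℕ.≤-reflexive (ℕ.+-suc _ d)) (ℕ.≤-trans (ℕ.+-monoˡ-≤ d h) le))

      a-< : ∀ {i j} → i ℕ.< j → 0 ℕ.< a j → a j ℕ.< a i
      a-< {i} {j} i<j 0<aj with a-mono i (j ∸ i)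
      ... | inj₁ z = contradiction (subst (λ m → a m ≡ 0) (ℕ.m∸n+n≡m (ℕ.<⇒≤ i<j)) z) (ℕ.>⇒≢ 0<aj)
      ... | inj₂ le = ℕ.≤-trans (ℕ.≤-reflexive (ℕ.+-comm 1 (a j))) (ℕ.≤-trans (ℕ.+-monoʳ-≤ (a j) (ℕ.m<n⇒0<n∸m i<j))
        (subst (λ m → a m ℕ.+ (j ∸ i) ℕ.≤ a i) (ℕ.m∸n+n≡m (ℕ.<⇒≤ i<j)) le))

      -- j counts the a's above rank c - s.
      record State (s : ℕ) : Set where
        field
          j     : ℕ
          count : r s ℕ.+ j ≡ s
          prod  : K s ≡ ∏[ j ] f
          next  : a j ℕ.≤ c ∸ s
          above : ∀ {i} → i ℕ.< j → c ∸ s ℕ.< a i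

      r-suc : ∀ s {b} → free (c ∸ s) ≡ b → r (suc s) ≡ (if b then r s else suc (r s))
      r-suc s e = cong (λ b → if b then r s else suc (r s)) e

      K-suc : ∀ s {b} → free (c ∸ s) ≡ b → K (suc s) ≡ (if b then r s ℕ.* K s else K s)
      K-suc s e = cong (λ b → if b then r s ℕ.* K s else K s) e

      state : ∀ s → s ℕ.≤ c → State s
      state zero    _ = record { j = 0 ; count = refl ; prod = refl ; next = ℕ.<⇒≤ a₀<c ; above = λ () }
      state (suc s) s<c with state s (ℕ.<⇒≤ s<c)
      ... | st with free (c ∸ s) in eq
      ...   | true  = record
        { j = suc j
        ; count = trans (cong (ℕ._+ suc j) (r-suc s eq)) (trans (ℕ.+-suc (r s) j) (cong suc count))
        ; prod = trans (K-suc s eq) (trans (cong₂ ℕ._*_ factor prod) (ℕ.*-comm (f j) _))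
        ; next = next′
        ; above = above′ }
        where
        open State st
        rank>0 : 0 ℕ.< c ∸ s
        rank>0 = ℕ.m<n⇒0<n∸m s<c
        rank<c : c ∸ s ℕ.< c
        rank<c = ℕ.≤∧≢⇒< (ℕ.m∸n≤m c s) λ e → contradiction (trans (sym eq) (trans (cong free e) free-c)) λ ()
        -- The free rank c - s is a value of `a`. Smaller indices have values above it, and larger
        -- ones have values below `a j`, itself at most c - s.
        hit : a j ≡ c ∸ s
        hit with free⇒a rank<c eq
        ... | j′ , e with ℕ.<-cmp j′ j
        ...   | tri< j′<j _ _ = contradiction (sym e) (ℕ.<⇒≢ (above j′<j))
        ...   | tri≈ _ refl _ = e
        ...   | tri> _ _ j<j′ = contradiction (ℕ.≤-trans (a-< j<j′ (subst (0 ℕ.<_) (sym e) rank>0)) next) (ℕ.≤⇒≯ (ℕ.≤-reflexive (sym e)))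
        -- Of the s ranks in (c - s, c] exactly j are free, so r s = s - j, which is c - a j - j.
        factor : r s ≡ f j
        factor = sym (trans (cong (λ b → c ∸ b ∸ j) hit) (trans (cong (_∸ j) (trans (ℕ.m∸[m∸n]≡n (ℕ.<⇒≤ s<c)) (sym count))) (ℕ.m+n∸n≡m (r s) j)))
        pred-rank : suc (c ∸ suc s) ≡ c ∸ s
        pred-rank = sym (ℕ.+-∸-assoc 1 s<c)
        next′ : a (suc j) ℕ.≤ c ∸ suc s
        next′ with a-step j
        ... | inj₁ z = subst (ℕ._≤ c ∸ suc s) (sym z) ℕ.z≤n
        ... | inj₂ h = ℕ.≤-pred (ℕ.≤-trans h (ℕ.≤-reflexive (trans hit (sym pred-rank))))
        above′ : ∀ {i} → i ℕ.< suc j → c ∸ suc s ℕ.< a i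
        above′ {i} (ℕ.s≤s i≤j) with ℕ.m≤n⇒m<n∨m≡n i≤j
        ... | inj₁ i<j  = ℕ.≤-trans (ℕ.≤-trans (ℕ.≤-reflexive pred-rank) (ℕ.n≤1+n _)) (above i<j)
        ... | inj₂ refl = ℕ.≤-reflexive (trans pred-rank (sym hit))
      ...   | false = record
        { j = j
        ; count = trans (cong (ℕ._+ j) (r-suc s eq)) (cong suc count)
        ; prod = trans (K-suc s eq) prod
        ; next = next′
        ; above = λ i<j → ℕ.≤-trans (ℕ.≤-trans (ℕ.≤-reflexive pred-rank) (ℕ.n≤1+n _)) (above i<j) }
        where
        open State st
        pred-rank : suc (c ∸ suc s) ≡ c ∸ s
        pred-rank = sym (ℕ.+-∸-assoc 1 s<c)
        next′ : a j ℕ.≤ c ∸ suc s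
        next′ with ℕ.m≤n⇒m<n∨m≡n next
        ... | inj₁ h = ℕ.≤-pred (ℕ.≤-trans h (ℕ.≤-reflexive (sym pred-rank)))
        ... | inj₂ e = contradiction (trans (sym (a⇒free j (subst (0 ℕ.<_) (sym e) (ℕ.m<n⇒0<n∸m s<c)))) (trans (cong free e) eq)) λ ()

      rise-! : ∀ m → rise 0 m ≡ m ℕ.!
      rise-! zero    = refl
      rise-! (suc m) = trans (rise-last 0 m) (trans (cong (ℕ._* suc m) (rise-! m)) (ℕ.*-comm (m ℕ.!) (suc m)))

      -- The indices i < c with `a i = 0` contribute c - i, that is m, m - 1, ..., 1; together they
      -- form the factorial coming from `rise 0 (r c)`.
      factorial-tail : ∀ j m → m ℕ.+ j ≡ c → (∀ i → j ℕ.≤ i → a i ≡ 0) → ∀ t u → t ℕ.+ u ≡ m →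
                       ∏[ t ℕ.+ j ] f ℕ.* u ℕ.! ≡ ∏[ j ] f ℕ.* m ℕ.!
      factorial-tail j m e z zero    u h = cong (λ x → ∏[ j ] f ℕ.* x ℕ.!) h
      factorial-tail j m e z (suc t) u h = trans (ℕ.*-assoc (∏[ t ℕ.+ j ] f) (f (t ℕ.+ j)) (u ℕ.!))
        (trans (cong (λ x → ∏[ t ℕ.+ j ] f ℕ.* (x ℕ.* u ℕ.!)) value) (factorial-tail j m e z t (suc u) (trans (ℕ.+-suc t u) h)))
        where
        value : f (t ℕ.+ j) ≡ suc u
        value = trans (cong (λ b → c ∸ b ∸ (t ℕ.+ j)) (z (t ℕ.+ j) (ℕ.m≤n+m j t)))
          (trans (cong (_∸ (t ℕ.+ j)) (trans (sym e) (trans (cong (ℕ._+ j) (trans (sym h) (sym (ℕ.+-suc t u)))) (lem t (suc u) j)))) (ℕ.m+n∸m≡n (t ℕ.+ j) (suc u)))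
          where
          lem : ∀ t u j → t ℕ.+ u ℕ.+ j ≡ t ℕ.+ j ℕ.+ u
          lem = ℕ-Solver.solve-∀

    K-rise : K c ℕ.* rise 0 (r c) ≡ ∏[ c ] f
    K-rise = begin
      K c ℕ.* rise 0 (r c)  ≡⟨ cong₂ ℕ._*_ prod (rise-! (r c)) ⟩
      ∏[ j ] f ℕ.* (r c) ℕ.!  ≡⟨ factorial-tail j (r c) count zeros (r c) 0 (ℕ.+-identityʳ (r c)) ⟨
      ∏[ r c ℕ.+ j ] f ℕ.* 1  ≡⟨ trans (ℕ.*-identityʳ _) (cong (λ m → ∏[ m ] f) count) ⟩
      ∏[ c ] f  ∎
      where
      open ≡-Reasoning
      open State (state c ℕ.≤-refl)
      aj≡0 : a j ≡ 0
      aj≡0 = ℕ.n≤0⇒n≡0 (ℕ.≤-trans next (ℕ.≤-reflexive (ℕ.n∸n≡0 c)))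
      zeros : ∀ i → j ℕ.≤ i → a i ≡ 0
      zeros i j≤i with a-mono j (i ∸ j)
      ... | inj₁ z = subst (λ m → a m ≡ 0) (ℕ.m∸n+n≡m j≤i) z
      ... | inj₂ le = subst (λ m → a m ≡ 0) (ℕ.m∸n+n≡m j≤i)
        (ℕ.n≤0⇒n≡0 (ℕ.≤-trans (ℕ.m≤m+n _ (i ∸ j)) (ℕ.≤-trans le (ℕ.≤-reflexive aj≡0))))

    P≡ : P ≡ inv (∏[ c ] f)
    P≡ = cong inv K-rise

  -- Asymptotics of the main count.

  module Combine (free : ℕ → Bool) (B : ℕ → ℕ) (n T c ℓ : ℕ)
                 (B-low : ∀ {i} → i ℕ.≤ c → B i ≡ T) (B-high : ∀ {i} → c ℕ.< i → B i ≡ n)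
                 (1≤c : 1 ℕ.≤ c) (free-c : free c ≡ false)
                 (free-high : ∀ {i} → c ℕ.< i → i ℕ.≤ ℓ ℕ.+ c → free i ≡ true)
                 (T≤n : T ℕ.≤ n) (1≤T : 1 ℕ.≤ T)
                 (Δ : ℕ) (1≤Δ : 1 ℕ.≤ Δ) (P≡ : Prefix.P free B n T c B-low free-c T≤n 1≤T ≡ inv Δ)
                 (L C₁ C₃ : ℕ) (H≤L : harmonic n ≤ ι L) (1≤L : 1 ℕ.≤ L)
                 (L≤T : L ℕ.^ suc c ℕ.≤ T)
                 (W≤ : (T ℕ.+ c) ℕ.* (T ℕ.+ c) ℕ.* (ℓ ℕ.+ c) ℕ.* L ℕ.≤ C₁ ℕ.* n)
                 (Y≤ : c ℕ.* (T ℕ.+ c) ℕ.* L ℕ.≤ C₃ ℕ.* n) where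
    open Suffix free B n T c ℓ B-low B-high 1≤c free-c free-high T≤n 1≤T

    private
      J : ℕ
      J = k ∸ 1
      N F E Nj h : ℚ
      N = ι n
      F = ι (ℓ ℕ.!)
      E = ι (J ℕ.!)
      Nj = ι (n ℕ.^ J)
      h = power H ℓ

      0≤h : 0ℚ ≤ h
      0≤h = power-nonNeg ℓ 0≤H
      0≤Nj : 0ℚ ≤ Nj
      0≤Nj = 0≤ι (n ℕ.^ J)
      1≤n : 1 ℕ.≤ n
      1≤n = ℕ.≤-trans 1≤T T≤n

      ΔP≡1 : ι Δ * P ≡ 1ℚ
      ΔP≡1 = trans (cong (ι Δ *_) P≡) (ι*inv 1≤Δ)
      0≤P : 0ℚ ≤ P
      0≤P = subst (0ℚ ≤_) (sym P≡) (0≤inv Δ)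
      P≤1 : P ≤ 1ℚ
      P≤1 = subst (_≤ 1ℚ) (sym P≡) (subst (inv Δ ≤_) inv-1 (inv-antimono {1} (ℕ.s≤s ℕ.z≤n) 1≤Δ))

      *H-≤ : ∀ {x y} → x ℕ.* L ℕ.≤ y ℕ.* n → ι x * H ≤ ι y * N
      *H-≤ {x} {y} le = begin
        ι x * H  ≤⟨ *-mono-left (0≤ι x) H≤L ⟩
        ι x * ι L  ≡⟨ ι-* x L ⟨
        ι (x ℕ.* L)  ≤⟨ ι-mono le ⟩
        ι (y ℕ.* n)  ≡⟨ ι-* y n ⟩
        ι y * N  ∎
        where open ≤-Reasoning

      scale : ι (ℓ ℕ.! ℕ.* J ℕ.! ℕ.* Δ) ≡ F * E * ι Δ
      scale = trans (ι-* (ℓ ℕ.! ℕ.* J ℕ.!) Δ) (cong (_* ι Δ) (ι-* (ℓ ℕ.!) (J ℕ.!)))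

      FX : ι Δ * (F * X one k) ≤ h
      FX = begin
        ι Δ * (F * X one k)  ≤⟨ *-mono-left (0≤ι Δ) X-upper ⟩
        ι Δ * (h * P)  ≡⟨ trans (lem (ι Δ) h P) (cong (_* h) ΔP≡1) ⟩
        1ℚ * h  ≡⟨ *-identityˡ h ⟩
        h  ∎
        where
        open ≤-Reasoning
        lem : ∀ a b c → a * (b * c) ≡ a * c * b
        lem = solve-∀ ℚ-ring

    D : ℕ
    D = ℓ ℕ.! ℕ.* J ℕ.! ℕ.* Δ

    main-≤ : ι D * ι mainCount * H ≤ Nj * (h * (H + ι C₁))
    main-≤ = cancel-ι 1≤n (begin
      N * (ι D * ι mainCount * H)
        ≡⟨ trans (cong (λ d → N * (d * ι mainCount * H)) scale) (lem₁ N F E (ι Δ) (ι mainCount) H) ⟩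
      F * ι Δ * H * (N * (E * ι mainCount))
        ≤⟨ *-mono-left (*-nonNeg (*-nonNeg (0≤ι (ℓ ℕ.!)) (0≤ι Δ)) 0≤H) main-upper ⟩
      F * ι Δ * H * (Nj * ((N + ι W) * X one k))
        ≡⟨ lem₂ F (ι Δ) H Nj N (ι W) (X one k) ⟩
      Nj * (N * H + ι W * H) * (ι Δ * (F * X one k))
        ≤⟨ *-mono-left (*-nonNeg 0≤Nj (+-nonNeg (*-nonNeg (0≤ι n) 0≤H) (*-nonNeg (0≤ι W) 0≤H))) FX ⟩
      Nj * (N * H + ι W * H) * h
        ≤⟨ *-mono-right 0≤h (*-mono-left 0≤Nj (+-monoʳ-≤ (N * H) (*H-≤ {W} {C₁} W≤))) ⟩
      Nj * (N * H + ι C₁ * N) * h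
        ≡⟨ lem₃ Nj N H (ι C₁) h ⟩
      N * (Nj * (h * (H + ι C₁))) ∎)
      where
      open ≤-Reasoning
      lem₁ : ∀ N F E D m H → N * (F * E * D * m * H) ≡ F * D * H * (N * (E * m))
      lem₁ = solve-∀ ℚ-ring
      lem₂ : ∀ F D H Nj N W X → F * D * H * (Nj * ((N + W) * X)) ≡ Nj * (N * H + W * H) * (D * (F * X))
      lem₂ = solve-∀ ℚ-ring
      lem₃ : ∀ Nj N H C h → Nj * (N * H + C * N) * h ≡ N * (Nj * (h * (H + C)))
      lem₃ = solve-∀ ℚ-ring

    -- The first summand comes from the sum of the sizes, `C₁` from the rounding in the forced pair.
    -- In the last group 2 c comes from `X-harmonic`, c from the cutoff, and ℓ² from the repeated
    -- indices among the free sizes.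
    C₂ : ℕ
    C₂ = suc J ℕ.* (ℓ ℕ.! ℕ.* (C₃ ℕ.+ ℓ)) ℕ.+ C₁ ℕ.+ (Δ ℕ.* (ℓ ℕ.* (2 ℕ.* c) ℕ.+ c) ℕ.+ ℓ ℕ.* ℓ)

    private
      -- The reason for the hypothesis L ^ (c + 1) ≤ T: the cutoff may cost only a fraction 1 / H.
      err-T : H * (inv T * power (ι L) c) ≤ 1ℚ
      err-T = begin
        H * (inv T * power (ι L) c)  ≤⟨ *-mono-right (*-nonNeg (0≤inv T) (power-nonNeg c (0≤ι L))) H≤L ⟩
        ι L * (inv T * power (ι L) c)  ≡⟨ trans (lem (ι L) (inv T) (power (ι L) c)) (cong (inv T *_) (sym (ι-^ L (suc c)))) ⟩
        inv T * ι (L ℕ.^ suc c)  ≤⟨ *-mono-left (0≤inv T) (ι-mono L≤T) ⟩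
        inv T * ι T  ≡⟨ trans (*-comm (inv T) (ι T)) (ι*inv 1≤T) ⟩
        1ℚ  ∎
        where
        open ≤-Reasoning
        lem : ∀ a b c → a * (b * c) ≡ b * (a * c)
        lem = solve-∀ ℚ-ring

      e₀ e₁ : ℚ
      e₀ = ι ℓ * (ι (2 ℕ.* c) + ι ℓ * P) + ι c
      e₁ = ι Δ * (ι ℓ * ι (2 ℕ.* c) + ι c) + ι ℓ * ι ℓ

      -- Collects what is lost between P and the weighted sum over complete chains: the cutoff, the
      -- start of the free sizes at d_c, and the repeated indices.
      HP : H * h * P ≤ H * (F * X one k) + h * e₀
      HP = begin
        H * h * P
          ≤⟨ *-mono-left (*-nonNeg 0≤H 0≤h) (P-≤X-one (ι L) H≤L (1≤ι 1≤L)) ⟩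
        H * h * (X one c + ι c * ε)
          ≡⟨ lem₁ H h (X one c) (ι c) ε ⟩
        H * h * X one c + h * (ι c * (H * ε))
          ≤⟨ +-mono-≤ X-lower (*-mono-left 0≤h (*-mono-left (0≤ι c) err-T)) ⟩
        H * (F * X one k) + ι ℓ * ((X harmonic c + ι ℓ * X one c) * h) + h * (ι c * 1ℚ)
          ≤⟨ +-monoˡ-≤ (h * (ι c * 1ℚ)) (+-monoʳ-≤ (H * (F * X one k)) (*-mono-left (0≤ι ℓ) (*-mono-right 0≤h
               (+-mono-≤ X-harmonic (*-mono-left (0≤ι ℓ) X-one-≤P))))) ⟩
        H * (F * X one k) + ι ℓ * ((ι (2 ℕ.* c) + ι ℓ * P) * h) + h * (ι c * 1ℚ)
          ≡⟨ lem₂ (H * (F * X one k)) (ι ℓ) (ι (2 ℕ.* c) + ι ℓ * P) h (ι c) ⟩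
        H * (F * X one k) + h * e₀ ∎
        where
        open ≤-Reasoning
        ε = inv T * power (ι L) c
        lem₁ : ∀ H h X c e → H * h * (X + c * e) ≡ H * h * X + h * (c * (H * e))
        lem₁ = solve-∀ ℚ-ring
        lem₂ : ∀ a l b h c → a + l * (b * h) + h * (c * 1ℚ) ≡ a + h * (l * b + c)
        lem₂ = solve-∀ ℚ-ring

      H-≤ : H * h ≤ H * (F * ι Δ * X one k) + h * e₁
      H-≤ = begin
        H * h
          ≡⟨ trans (sym (*-identityˡ (H * h))) (trans (cong (_* (H * h)) (sym ΔP≡1)) (lem₁ (ι Δ) P (H * h))) ⟩
        ι Δ * (H * h * P)
          ≤⟨ *-mono-left (0≤ι Δ) HP ⟩
        ι Δ * (H * (F * X one k) + h * e₀)
          ≡⟨ lem₂ (ι Δ) H F (X one k) h (ι ℓ) (ι (2 ℕ.* c)) P (ι c) ⟩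
        H * (F * ι Δ * X one k) + h * (ι Δ * (ι ℓ * ι (2 ℕ.* c) + ι c) + ι ℓ * ι ℓ * (ι Δ * P))
          ≡⟨ cong (λ a → H * (F * ι Δ * X one k) + h * (ι Δ * (ι ℓ * ι (2 ℕ.* c) + ι c) + a))
               (trans (cong (ι ℓ * ι ℓ *_) ΔP≡1) (*-identityʳ (ι ℓ * ι ℓ))) ⟩
        H * (F * ι Δ * X one k) + h * e₁ ∎
        where
        open ≤-Reasoning
        lem₁ : ∀ d p x → d * p * x ≡ d * (x * p)
        lem₁ = solve-∀ ℚ-ring
        lem₂ : ∀ d H F X h l t P c → d * (H * (F * X) + h * (l * (t + l * P) + c))
             ≡ H * (F * d * X) + h * (d * (l * t + c) + l * l * (d * P))
        lem₂ = solve-∀ ℚ-ring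

      HY : ι Δ * (H * Y k) ≤ h * (N * (ι C₃ + ι ℓ))
      HY = begin
        ι Δ * (H * Y k)
          ≤⟨ *-mono-left (0≤ι Δ) (Y-high ℓ ℕ.≤-refl) ⟩
        ι Δ * (h * (H * Y c + ι ℓ * (N * P)))
          ≤⟨ *-mono-left (0≤ι Δ) (*-mono-left 0≤h (+-monoˡ-≤ (ι ℓ * (N * P)) HYc)) ⟩
        ι Δ * (h * (ι C₃ * N * P + ι ℓ * (N * P)))
          ≡⟨ trans (lem (ι Δ) h (ι C₃) N P (ι ℓ)) (trans (cong (_* (h * (N * (ι C₃ + ι ℓ)))) ΔP≡1) (*-identityˡ (h * (N * (ι C₃ + ι ℓ))))) ⟩
        h * (N * (ι C₃ + ι ℓ)) ∎
        where
        open ≤-Reasoning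
        lem : ∀ d h C N P l → d * (h * (C * N * P + l * (N * P))) ≡ d * P * (h * (N * (C + l)))
        lem = solve-∀ ℚ-ring
        y = c ℕ.* (T ℕ.+ c)
        HYc : H * Y c ≤ ι C₃ * N * P
        HYc = begin
          H * Y c  ≤⟨ *-mono-left 0≤H Y-c ⟩
          H * (ι y * P)  ≡⟨ trans (sym (*-assoc H (ι y) P)) (cong (_* P) (*-comm H (ι y))) ⟩
          ι y * H * P  ≤⟨ *-mono-right 0≤P (*H-≤ {y} {C₃} Y≤) ⟩
          ι C₃ * N * P  ∎

      C₂≡ : ι C₂ ≡ ι (suc J) * (F * (ι C₃ + ι ℓ)) + ι C₁ + e₁
      C₂≡ = trans (ι-+ _ (Δ ℕ.* (ℓ ℕ.* (2 ℕ.* c) ℕ.+ c) ℕ.+ ℓ ℕ.* ℓ)) (cong₂ _+_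
        (trans (ι-+ _ C₁) (cong (_+ ι C₁) (trans (ι-* (suc J) _) (cong (ι (suc J) *_) (trans (ι-* (ℓ ℕ.!) _) (cong (F *_) (ι-+ C₃ ℓ)))))))
        (trans (ι-+ _ (ℓ ℕ.* ℓ)) (cong₂ _+_ (trans (ι-* Δ _) (cong (ι Δ *_) (trans (ι-+ _ c) (cong (_+ ι c) (ι-* ℓ (2 ℕ.* c)))))) (ι-* ℓ ℓ))))

    main-≥ : Nj * (h * H) ≤ ι D * ι mainCount * H + Nj * (h * ι C₂)
    main-≥ = cancel-ι 1≤n (begin
      N * (Nj * (h * H))
        ≡⟨ lem₁ N Nj h H ⟩
      Nj * N * (H * h)
        ≤⟨ *-mono-left (*-nonNeg 0≤Nj (0≤ι n)) H-≤ ⟩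
      Nj * N * (H * (F * ι Δ * X one k) + h * e₁)
        ≡⟨ lem₂ Nj N H F (ι Δ) (X one k) (h * e₁) ⟩
      F * ι Δ * H * (Nj * (N * X one k)) + Nj * N * (h * e₁)
        ≤⟨ +-monoˡ-≤ (Nj * N * (h * e₁)) (*-mono-left (*-nonNeg (*-nonNeg (0≤ι (ℓ ℕ.!)) (0≤ι Δ)) 0≤H) main-lower) ⟩
      F * ι Δ * H * (N * (E * ι mainCount) + Nj * (ι (suc J) * Y k + ι W * X one k)) + Nj * N * (h * e₁)
        ≡⟨ lem₃ F (ι Δ) H N E (ι mainCount) Nj (ι (suc J)) (Y k) (ι W) (X one k) h e₁ ⟩
      N * (F * E * ι Δ * ι mainCount * H) + Nj * (ι (suc J) * F * (ι Δ * (H * Y k)) + ι W * H * (ι Δ * (F * X one k))) + Nj * N * (h * e₁)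
        ≤⟨ +-monoˡ-≤ (Nj * N * (h * e₁)) (+-monoʳ-≤ (N * (F * E * ι Δ * ι mainCount * H)) (*-mono-left 0≤Nj
             (+-mono-≤ (*-mono-left (*-nonNeg (0≤ι (suc J)) (0≤ι (ℓ ℕ.!))) HY)
               (≤-trans (*-mono-left (*-nonNeg (0≤ι W) 0≤H) FX) (*-mono-right 0≤h (*H-≤ {W} {C₁} W≤)))))) ⟩
      N * (F * E * ι Δ * ι mainCount * H) + Nj * (ι (suc J) * F * (h * (N * (ι C₃ + ι ℓ))) + ι C₁ * N * h) + Nj * N * (h * e₁)
        ≡⟨ lem₄ N (F * E * ι Δ * ι mainCount * H) Nj (ι (suc J)) F h (ι C₃ + ι ℓ) (ι C₁) e₁ ⟩
      N * (F * E * ι Δ * ι mainCount * H + Nj * (h * (ι (suc J) * (F * (ι C₃ + ι ℓ)) + ι C₁ + e₁)))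
        ≡⟨ cong₂ (λ d x → N * (d * ι mainCount * H + Nj * (h * x))) scale C₂≡ ⟨
      N * (ι D * ι mainCount * H + Nj * (h * ι C₂)) ∎)
      where
      open ≤-Reasoning
      lem₁ : ∀ N Nj h H → N * (Nj * (h * H)) ≡ Nj * N * (H * h)
      lem₁ = solve-∀ ℚ-ring
      lem₂ : ∀ Nj N H F D X e → Nj * N * (H * (F * D * X) + e) ≡ F * D * H * (Nj * (N * X)) + Nj * N * e
      lem₂ = solve-∀ ℚ-ring
      lem₃ : ∀ F D H N E m Nj s Y W X h e → F * D * H * (N * (E * m) + Nj * (s * Y + W * X)) + Nj * N * (h * e)
           ≡ N * (F * E * D * m * H) + Nj * (s * F * (D * (H * Y)) + W * H * (D * (F * X))) + Nj * N * (h * e)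
      lem₃ = solve-∀ ℚ-ring
      lem₄ : ∀ N a Nj s F h x C e → N * a + Nj * (s * F * (h * (N * x)) + C * N * h) + Nj * N * (h * e)
           ≡ N * (a + Nj * (h * (s * (F * x) + C + e)))
      lem₄ = solve-∀ ℚ-ring

  -- From the harmonic number to the logarithm.

  -- 2 ^ ℓ - 1, in the recursive form that `power-difference` produces.
  geometric : ℕ → ℕ
  geometric zero    = 0
  geometric (suc ℓ) = 2 ℕ.* geometric ℓ ℕ.+ 1

  ∣∣-≤ : ∀ {x y b} → 0ℚ ≤ y → x * y ≤ b → - x * y ≤ b → ∣ x ∣ * y ≤ b
  ∣∣-≤ {x} {y} {b} 0≤y h₁ h₂ with ∣p∣≡p∨∣p∣≡-p x
  ... | inj₁ e = subst (λ a → a * y ≤ b) (sym e) h₁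
  ... | inj₂ e = subst (λ a → a * y ≤ b) (sym e) h₂

  2ℚ : ℚ
  2ℚ = 1ℚ + 1ℚ

  module Perturb {H s : ℚ} (2≤H : 2ℚ ≤ H) (H≤s+1 : H ≤ s + 1ℚ) (s≤H+1 : s ≤ H + 1ℚ) where

    1≤s : 1ℚ ≤ s
    1≤s = subst₂ _≤_ refl (lem s) (+-monoˡ-≤ (- 1ℚ) (≤-trans 2≤H H≤s+1))
      where
      lem : ∀ s → s + 1ℚ - 1ℚ ≡ s
      lem = solve-∀ ℚ-ring

    0≤s : 0ℚ ≤ s
    0≤s = ≤-trans 0≤1 1≤s

    0≤H : 0ℚ ≤ H
    0≤H = ≤-trans (+-nonNeg 0≤1 0≤1) 2≤H

    0≤2 : 0ℚ ≤ 2ℚ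
    0≤2 = +-nonNeg 0≤1 0≤1

    double : ∀ x → x + x ≡ 2ℚ * x
    double = solve-∀ ℚ-ring

    H≤2s : H ≤ 2ℚ * s
    H≤2s = ≤-trans H≤s+1 (≤-trans (+-monoʳ-≤ s 1≤s) (≤-reflexive (double s)))

    s≤2H : s ≤ 2ℚ * H
    s≤2H = ≤-trans s≤H+1 (≤-trans (+-monoʳ-≤ H (≤-trans (≤-by 1ℚ 0≤1 refl) 2≤H)) (≤-reflexive (double H)))

    ∣H-s∣≤1 : ∣ H - s ∣ ≤ 1ℚ
    ∣H-s∣≤1 = subst (_≤ 1ℚ) (*-identityʳ (∣ H - s ∣)) (∣∣-≤ {H - s} {1ℚ} 0≤1
      (subst₂ _≤_ (sym (*-identityʳ (H - s))) (lem₁ s) (+-monoˡ-≤ (- s) H≤s+1))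
      (subst₂ _≤_ (lem₂ H s) (lem₁ H) (+-monoˡ-≤ (- H) s≤H+1)))
      where
      lem₁ : ∀ s → s + 1ℚ - s ≡ 1ℚ
      lem₁ = solve-∀ ℚ-ring
      lem₂ : ∀ H s → s - H ≡ - (H - s) * 1ℚ
      lem₂ = solve-∀ ℚ-ring

    power-2s : ∀ ℓ → power (2ℚ * s) ℓ ≡ power 2ℚ ℓ * power s ℓ
    power-2s zero    = refl
    power-2s (suc ℓ) = trans (cong (2ℚ * s *_) (power-2s ℓ)) (lem 2ℚ s (power 2ℚ ℓ) (power s ℓ))
      where
      lem : ∀ a b c d → a * b * (c * d) ≡ a * c * (b * d)
      lem = solve-∀ ℚ-ring

    -- Splitting off one factor, H ≤ 2 s doubles the constant and |H - s| ≤ 1 adds one to it.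
    power-difference : ∀ ℓ → ∣ power H ℓ - power s ℓ ∣ * s ≤ ι (geometric ℓ) * power s ℓ
    power-difference zero    = ≤-reflexive (trans (*-zeroˡ s) (sym (trans (cong (_* 1ℚ) ι-0) (*-zeroˡ 1ℚ))))
    power-difference (suc ℓ) = begin
      ∣ H * Hℓ - s * sℓ ∣ * s
        ≡⟨ cong (λ x → ∣ x ∣ * s) (lem₁ H Hℓ s sℓ) ⟩
      ∣ H * (Hℓ - sℓ) + (H - s) * sℓ ∣ * s
        ≤⟨ *-mono-right 0≤s (∣p+q∣≤∣p∣+∣q∣ (H * (Hℓ - sℓ)) ((H - s) * sℓ)) ⟩
      (∣ H * (Hℓ - sℓ) ∣ + ∣ (H - s) * sℓ ∣) * s
        ≡⟨ cong₂ (λ a b → (a + b) * s) (trans (∣p*q∣≡∣p∣*∣q∣ H (Hℓ - sℓ)) (cong (_* ∣ Hℓ - sℓ ∣) (0≤p⇒∣p∣≡p 0≤H)))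
             (trans (∣p*q∣≡∣p∣*∣q∣ (H - s) sℓ) (cong (∣ H - s ∣ *_) (0≤p⇒∣p∣≡p 0≤sℓ))) ⟩
      (H * ∣ Hℓ - sℓ ∣ + ∣ H - s ∣ * sℓ) * s
        ≡⟨ lem₂ H (∣ Hℓ - sℓ ∣) (∣ H - s ∣) sℓ s ⟩
      H * (∣ Hℓ - sℓ ∣ * s) + ∣ H - s ∣ * (s * sℓ)
        ≤⟨ +-mono-≤ (*-mono-≤ 0≤H (*-nonNeg (0≤ι (geometric ℓ)) 0≤sℓ) H≤2s (power-difference ℓ)) (*-mono-right (*-nonNeg 0≤s 0≤sℓ) ∣H-s∣≤1) ⟩
      2ℚ * s * (ι (geometric ℓ) * sℓ) + 1ℚ * (s * sℓ)
        ≡⟨ lem₃ s (ι (geometric ℓ)) sℓ ⟩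
      (2ℚ * ι (geometric ℓ) + 1ℚ) * (s * sℓ)
        ≡⟨ cong (_* (s * sℓ)) (trans (ι-+ (2 ℕ.* geometric ℓ) 1) (cong₂ _+_ (trans (ι-* 2 (geometric ℓ)) (cong (_* ι (geometric ℓ)) (trans (ι-suc 1) (cong (1ℚ +_) ι-1)))) ι-1)) ⟨
      ι (geometric (suc ℓ)) * (s * sℓ) ∎
      where
      open ≤-Reasoning
      Hℓ = power H ℓ
      sℓ = power s ℓ
      0≤sℓ : 0ℚ ≤ sℓ
      0≤sℓ = power-nonNeg ℓ 0≤s
      lem₁ : ∀ a b c d → a * b - c * d ≡ a * (b - d) + (a - c) * d
      lem₁ = solve-∀ ℚ-ring
      lem₂ : ∀ H a b c s → (H * a + b * c) * s ≡ H * (a * s) + b * (s * c)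
      lem₂ = solve-∀ ℚ-ring
      lem₃ : ∀ s g t → 2ℚ * s * (g * t) + 1ℚ * (s * t) ≡ (2ℚ * g + 1ℚ) * (s * t)
      lem₃ = solve-∀ ℚ-ring

    -- The error is centred at q H ^ ℓ on the scale 1 / H and then moved to s: s ≤ 2 H accounts for
    -- the factor 2, H ≤ 2 s for 2 ^ ℓ, and the change of centre for `geometric ℓ`.
    conclude : ∀ ℓ {a q C} → 0ℚ ≤ q → 0ℚ ≤ C →
      a * H ≤ q * (power H ℓ * (H + C)) → q * (power H ℓ * H) ≤ a * H + q * (power H ℓ * C) →
      ∣ a - q * power s ℓ ∣ * s ≤ (2ℚ * power 2ℚ ℓ * C + ι (geometric ℓ)) * (q * power s ℓ)
    conclude ℓ {a} {q} {C} 0≤q 0≤C up lo = begin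
      ∣ a - q * sℓ ∣ * s
        ≡⟨ cong (λ x → ∣ x ∣ * s) (lem₁ a q Hℓ sℓ) ⟩
      ∣ (a - q * Hℓ) + q * (Hℓ - sℓ) ∣ * s
        ≤⟨ *-mono-right 0≤s (∣p+q∣≤∣p∣+∣q∣ (a - q * Hℓ) (q * (Hℓ - sℓ))) ⟩
      (∣ a - q * Hℓ ∣ + ∣ q * (Hℓ - sℓ) ∣) * s
        ≡⟨ cong (λ b → (∣ a - q * Hℓ ∣ + b) * s) (trans (∣p*q∣≡∣p∣*∣q∣ q (Hℓ - sℓ)) (cong (_* ∣ Hℓ - sℓ ∣) (0≤p⇒∣p∣≡p 0≤q))) ⟩
      (∣ a - q * Hℓ ∣ + q * ∣ Hℓ - sℓ ∣) * s
        ≡⟨ lem₂ (∣ a - q * Hℓ ∣) q (∣ Hℓ - sℓ ∣) s ⟩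
      ∣ a - q * Hℓ ∣ * s + q * (∣ Hℓ - sℓ ∣ * s)
        ≤⟨ +-mono-≤ first (*-mono-left 0≤q (power-difference ℓ)) ⟩
      2ℚ * (q * (power 2ℚ ℓ * sℓ * C)) + q * (ι (geometric ℓ) * sℓ)
        ≡⟨ lem₃ q (power 2ℚ ℓ) sℓ C (ι (geometric ℓ)) ⟩
      (2ℚ * power 2ℚ ℓ * C + ι (geometric ℓ)) * (q * sℓ) ∎
      where
      open ≤-Reasoning
      Hℓ = power H ℓ
      sℓ = power s ℓ
      lem₁ : ∀ a q h t → a - q * t ≡ (a - q * h) + q * (h - t)
      lem₁ = solve-∀ ℚ-ring
      lem₂ : ∀ x q y s → (x + q * y) * s ≡ x * s + q * (y * s)
      lem₂ = solve-∀ ℚ-ring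
      lem₃ : ∀ q p t C g → 2ℚ * (q * (p * t * C)) + q * (g * t) ≡ (2ℚ * p * C + g) * (q * t)
      lem₃ = solve-∀ ℚ-ring
      lem₄ : ∀ a q h H C → q * (h * (H + C)) - q * h * H ≡ q * (h * C)
      lem₄ = solve-∀ ℚ-ring
      centred : ∣ a - q * Hℓ ∣ * H ≤ q * (Hℓ * C)
      centred = ∣∣-≤ {a - q * Hℓ} {H} 0≤H
        (subst₂ _≤_ (lem a q Hℓ H) (lem₄ a q Hℓ H C) (+-monoˡ-≤ (- (q * Hℓ * H)) up))
        (subst₂ _≤_ (lem′ a q Hℓ H) (lem″ (a * H) (q * (Hℓ * C))) (+-monoˡ-≤ (- (a * H)) lo))
        where
        lem : ∀ a q h H → a * H - q * h * H ≡ (a - q * h) * H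
        lem = solve-∀ ℚ-ring
        lem′ : ∀ a q h H → q * (h * H) - a * H ≡ - (a - q * h) * H
        lem′ = solve-∀ ℚ-ring
        lem″ : ∀ x y → x + y - x ≡ y
        lem″ = solve-∀ ℚ-ring
      first : ∣ a - q * Hℓ ∣ * s ≤ 2ℚ * (q * (power 2ℚ ℓ * sℓ * C))
      first = begin
        ∣ a - q * Hℓ ∣ * s  ≤⟨ *-mono-left (0≤∣p∣ (a - q * Hℓ)) s≤2H ⟩
        ∣ a - q * Hℓ ∣ * (2ℚ * H)  ≡⟨ lem (∣ a - q * Hℓ ∣) 2ℚ H ⟩
        2ℚ * (∣ a - q * Hℓ ∣ * H)  ≤⟨ *-mono-left 0≤2 centred ⟩
        2ℚ * (q * (Hℓ * C))  ≤⟨ *-mono-left 0≤2 (*-mono-left 0≤q (*-mono-right 0≤C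
                                            (≤-trans (power-mono ℓ 0≤H H≤2s) (≤-reflexive (power-2s ℓ))))) ⟩
        2ℚ * (q * (power 2ℚ ℓ * sℓ * C)) ∎
        where
        lem : ∀ x t H → x * (t * H) ≡ t * (x * H)
        lem = solve-∀ ℚ-ring

  -- Reading off the shape of μ.

  entry-∈ : ∀ xs m → 0 ℕ.< entry xs m → entry xs m ∈ xs
  entry-∈ (x ∷ xs) zero    _ = here refl
  entry-∈ (x ∷ xs) (suc m) h = there (entry-∈ xs m h)

  ∈-entry : ∀ {x xs} → x ∈ xs → ∃[ m ] entry xs m ≡ x
  ∈-entry (here refl) = 0 , refl
  ∈-entry (there h)   = let m , e = ∈-entry h in suc m , e

  entry-step : ∀ {xs} → Linked ℕ._≥_ xs → Unique xs → ∀ i → entry xs (suc i) ≡ 0 ⊎ entry xs (suc i) ℕ.< entry xs i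
  entry-step []      _                i       = inj₁ refl
  entry-step [-]     _                i       = inj₁ refl
  entry-step (h ∷ _) ((x≢y ∷ _) ∷ _)  zero    = inj₂ (ℕ.≤∧≢⇒< h (x≢y ∘ sym))
  entry-step (_ ∷ l) (_ ∷ u)          (suc i) = entry-step l u i

  module Pattern {μ k ℓ a} (strict : Strict μ) (form : HasForm μ k ℓ a) where
    open HasForm form
    open DecMembership ℕ._≟_ using (_∈?_)

    c : ℕ
    c = k ∸ ℓ

    0<c : 0 ℕ.< c
    0<c = ℕ.≤-trans (ℕ.s≤s ℕ.z≤n) gap

    ℓ≤k : ℓ ℕ.≤ k
    ℓ≤k = ℕ.<⇒≤ (ℕ.m∸n≢0⇒n<m (ℕ.>⇒≢ 0<c))

    ℓ+c≡k : ℓ ℕ.+ c ≡ k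
    ℓ+c≡k = ℕ.m+[n∸m]≡n ℓ≤k

    free : ℕ → Bool
    free i = does (i ∈? parts μ)

    free-true : ∀ {i} → free i ≡ true → i ∈ parts μ
    free-true {i} e with i ∈? parts μ
    ... | yes i∈ = i∈
    free-true {i} () | no _

    free-false : ∀ {i} → free i ≡ false → ¬ i ∈ parts μ
    free-false {i} e with i ∈? parts μ
    free-false {i} () | yes _
    ... | no i∉ = i∉

    ∈-free : ∀ {i} → i ∈ parts μ → free i ≡ true
    ∈-free {i} i∈ with i ∈? parts μ
    ... | yes _ = refl
    ... | no i∉ = contradiction i∈ i∉

    ∉-free : ∀ {i} → ¬ i ∈ parts μ → free i ≡ false
    ∉-free {i} i∉ with i ∈? parts μ
    ... | yes i∈ = contradiction i∈ i∉
    ... | no _   = refl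

    top : suc (ℓ ℕ.+ c) ∈ parts μ
    top = subst (_∈ parts μ) (trans (leading 0 ℕ.z≤n) (cong suc (sym ℓ+c≡k)))
      (entry-∈ (parts μ) 0 (subst (0 ℕ.<_) (sym (leading 0 ℕ.z≤n)) (ℕ.s≤s ℕ.z≤n)))

    parts≤ : All (ℕ._≤ suc (ℓ ℕ.+ c)) (parts μ)
    parts≤ = All.map (λ h → ℕ.≤-trans h (ℕ.≤-reflexive (trans (leading 0 ℕ.z≤n) (cong suc (sym ℓ+c≡k))))) (parts≤part0 (parts μ) (parts-≥ μ))

    a-step : ∀ j → a (suc j) ≡ 0 ⊎ a (suc j) ℕ.< a j
    a-step j = subst₂ (λ x y → x ≡ 0 ⊎ x ℕ.< y) (trans (cong (entry (parts μ)) (sym (ℕ.+-suc (suc ℓ) j))) (remaining (suc j))) (remaining j)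
      (entry-step (decreasing μ) strict (suc ℓ ℕ.+ j))

    a<c : ∀ j → a j ℕ.< c
    a<c zero    = gap
    a<c (suc j) with a-step j
    ... | inj₁ z = subst (ℕ._< c) (sym z) 0<c
    ... | inj₂ h = ℕ.<-trans h (a<c j)

    a-∈ : ∀ j → 0 ℕ.< a j → a j ∈ parts μ
    a-∈ j h = subst (_∈ parts μ) (remaining j) (entry-∈ (parts μ) (suc ℓ ℕ.+ j) (subst (0 ℕ.<_) (sym (remaining j)) h))

    -- The leading run ends at c + 1, and all later parts are values of `a`.
    locate : ∀ {i} → i ∈ parts μ → c ℕ.< i ⊎ ∃[ j ] a j ≡ i
    locate {i} i∈ with ∈-entry i∈
    ... | m , e with ℕ.≤-<-connex m ℓ
    ...   | inj₁ m≤ℓ = inj₁ (subst (c ℕ.<_) (trans (sym (leading m m≤ℓ)) e)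
              (ℕ.≤-trans (ℕ.≤-reflexive (sym (ℕ.+-∸-assoc 1 ℓ≤k))) (ℕ.∸-monoʳ-≤ (suc k) m≤ℓ)))
    ...   | inj₂ ℓ<m = inj₂ (m ∸ suc ℓ , trans (sym (remaining (m ∸ suc ℓ))) (trans (cong (entry (parts μ)) (ℕ.m+[n∸m]≡n ℓ<m)) e))

    free-c : free c ≡ false
    free-c = ∉-free λ c∈ → refute (locate c∈)
      where
      refute : c ℕ.< c ⊎ ∃[ j ] a j ≡ c → _
      refute (inj₁ h)       = ℕ.<-irrefl refl h
      refute (inj₂ (j , e)) = ℕ.<-irrefl e (a<c j)

    free-high : ∀ {i} → c ℕ.< i → i ℕ.≤ ℓ ℕ.+ c → free i ≡ true
    free-high {i} c<i i≤ = ∈-free (subst (_∈ parts μ) value (entry-∈ (parts μ) m (subst (0 ℕ.<_) (sym value) (ℕ.≤-trans (ℕ.s≤s ℕ.z≤n) c<i))))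
      where
      m = suc k ∸ i
      m≤ℓ : m ℕ.≤ ℓ
      m≤ℓ = ℕ.≤-trans (ℕ.∸-monoʳ-≤ (suc k) c<i) (ℕ.≤-reflexive (ℕ.m∸[m∸n]≡n ℓ≤k))
      value : entry (parts μ) m ≡ i
      value = trans (leading m m≤ℓ) (ℕ.m∸[m∸n]≡n (ℕ.≤-trans i≤ (ℕ.≤-trans (ℕ.≤-reflexive ℓ+c≡k) (ℕ.n≤1+n k))))

    free⇒a : ∀ {i} → i ℕ.< c → free i ≡ true → ∃[ j ] a j ≡ i
    free⇒a i<c e with locate (free-true e)
    ... | inj₁ c<i = contradiction c<i (ℕ.<-asym i<c)
    ... | inj₂ h   = h

    a⇒free : ∀ j → 0 ℕ.< a j → free (a j) ≡ true
    a⇒free j h = ∈-free (a-∈ j h)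

  ∑-≤-const : ∀ {f : ℕ → ℕ} {b} u k → (∀ {d} → d ∈ interval u k → f d ℕ.≤ b) → ∑ (interval u k) f ℕ.≤ k ℕ.* b
  ∑-≤-const u zero    h = ℕ.z≤n
  ∑-≤-const u (suc k) h = ℕ.+-mono-≤ (h (here refl)) (∑-≤-const (suc u) k (h ∘ there))

  -- Negligible partitions.

  module Errors (n L T A : ℕ) (1≤n : 1 ℕ.≤ n) (1≤L : 1 ℕ.≤ L) (1≤T : 1 ℕ.≤ T)
                (R≤ : Counting.R n ℕ.≤ n ℕ.* L) (TTL≤ : T ℕ.* T ℕ.* L ℕ.≤ A ℕ.* n) where
    open Counting n

    private
      cancel-T : ∀ {x y} → T ℕ.* x ℕ.≤ T ℕ.* y → x ℕ.≤ y
      cancel-T {x} {y} h = ℕ.*-cancelˡ-≤ T {{ℕ.>-nonZero 1≤T}} h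

      power-R : ∀ i → R ℕ.^ i ℕ.≤ n ℕ.^ i ℕ.* L ℕ.^ i
      power-R zero    = ℕ.≤-refl
      power-R (suc i) = ℕ.≤-trans (ℕ.*-mono-≤ R≤ (power-R i)) (ℕ.≤-reflexive (lem n L (n ℕ.^ i) (L ℕ.^ i)))
        where
        lem : ∀ a b c d → a ℕ.* b ℕ.* (c ℕ.* d) ≡ a ℕ.* c ℕ.* (b ℕ.* d)
        lem = ℕ-Solver.solve-∀

    -- R ≤ n L turns the crude count into n ^ (i + j + 1) L ^ (i + j) / T, and T absorbs the power
    -- of L with one factor L to spare.
    tail-bound : ∀ i j S → suc T ℕ.* S ℕ.≤ n ℕ.* R ℕ.^ j ℕ.* R ℕ.^ i → L ℕ.^ suc (i ℕ.+ j) ℕ.≤ T →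
                 S ℕ.* L ℕ.≤ n ℕ.^ suc (i ℕ.+ j)
    tail-bound i j S hS hT = cancel-T (begin
      T ℕ.* (S ℕ.* L)  ≡⟨ ℕ.*-assoc T S L ⟨
      T ℕ.* S ℕ.* L  ≤⟨ ℕ.*-monoˡ-≤ L (ℕ.≤-trans (ℕ.*-monoˡ-≤ S (ℕ.n≤1+n T)) hS) ⟩
      n ℕ.* R ℕ.^ j ℕ.* R ℕ.^ i ℕ.* L  ≡⟨ cong (ℕ._* L) (trans (ℕ.*-assoc n (R ℕ.^ j) (R ℕ.^ i)) (cong (n ℕ.*_) (trans (ℕ.*-comm (R ℕ.^ j) (R ℕ.^ i)) (sym (ℕ.^-distribˡ-+-* R i j))))) ⟩
      n ℕ.* R ℕ.^ (i ℕ.+ j) ℕ.* L  ≤⟨ ℕ.*-monoˡ-≤ L (ℕ.*-monoʳ-≤ n (power-R (i ℕ.+ j))) ⟩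
      n ℕ.* (n ℕ.^ m ℕ.* L ℕ.^ m) ℕ.* L  ≡⟨ lem n (n ℕ.^ m) (L ℕ.^ m) L ⟩
      L ℕ.* L ℕ.^ m ℕ.* (n ℕ.* n ℕ.^ m)  ≤⟨ ℕ.*-monoˡ-≤ (n ℕ.* n ℕ.^ m) hT ⟩
      T ℕ.* n ℕ.^ suc m  ∎)
      where
      open ℕ.≤-Reasoning
      m = i ℕ.+ j
      lem : ∀ a b c d → a ℕ.* (b ℕ.* c) ℕ.* d ≡ d ℕ.* c ℕ.* (a ℕ.* b)
      lem = ℕ-Solver.solve-∀

    -- T² = O(n) makes the divisor bound T + n / T of order n / T, and T absorbs the powers of L
    -- from the other sizes.
    small-bound : ∀ J j → j ℕ.< J → L ℕ.^ J ℕ.≤ T →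
                  (∑ (tuples (suc j)) λ ds → cnt ds δ 0) ℕ.* L ℕ.≤ suc A ℕ.* n ℕ.^ J
    small-bound (suc J) j (ℕ.s≤s j≤J) hT = cancel-T (begin
      T ℕ.* (S ℕ.* L)  ≡⟨ ℕ.*-assoc T S L ⟨
      T ℕ.* S ℕ.* L  ≤⟨ ℕ.*-monoˡ-≤ L (∑-tuples-δ T j) ⟩
      (T ℕ.* T ℕ.+ n) ℕ.* R ℕ.^ j ℕ.* L  ≤⟨ ℕ.*-monoˡ-≤ L (ℕ.*-mono-≤ (ℕ.+-monoˡ-≤ n TT≤) (power-R j)) ⟩
      (A ℕ.* n ℕ.+ n) ℕ.* (n ℕ.^ j ℕ.* L ℕ.^ j) ℕ.* L  ≤⟨ ℕ.*-monoˡ-≤ L (ℕ.*-monoʳ-≤ (A ℕ.* n ℕ.+ n)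
          (ℕ.*-mono-≤ (ℕ.^-monoʳ-≤ n {{ℕ.>-nonZero 1≤n}} j≤J) (ℕ.^-monoʳ-≤ L {{ℕ.>-nonZero 1≤L}} j≤J))) ⟩
      (A ℕ.* n ℕ.+ n) ℕ.* (n ℕ.^ J ℕ.* L ℕ.^ J) ℕ.* L  ≡⟨ lem A n (n ℕ.^ J) (L ℕ.^ J) L ⟩
      L ℕ.* L ℕ.^ J ℕ.* (suc A ℕ.* (n ℕ.* n ℕ.^ J))  ≤⟨ ℕ.*-monoˡ-≤ (suc A ℕ.* n ℕ.^ suc J) hT ⟩
      T ℕ.* (suc A ℕ.* n ℕ.^ suc J)  ∎)
      where
      open ℕ.≤-Reasoning
      S = ∑ (tuples (suc j)) λ ds → cnt ds δ 0
      TT≤ : T ℕ.* T ℕ.≤ A ℕ.* n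
      TT≤ = ℕ.≤-trans (ℕ.m≤m*n (T ℕ.* T) L {{ℕ.>-nonZero 1≤L}}) TTL≤
      lem : ∀ A n b c d → (A ℕ.* n ℕ.+ n) ℕ.* (b ℕ.* c) ℕ.* d ≡ d ℕ.* c ℕ.* (suc A ℕ.* (n ℕ.* b))
      lem = ℕ-Solver.solve-∀

    smalls-bound : ∀ J → L ℕ.^ J ℕ.≤ T →
      (∑ (interval 0 J) λ j → ∑ (tuples j) λ ds → cnt ds δ 0) ℕ.* L ℕ.≤ J ℕ.* (suc A ℕ.* n ℕ.^ J)
    smalls-bound J hT = ℕ.≤-trans (ℕ.≤-reflexive (trans (ℕ.*-comm _ L) (sym (∑-*ˡ L f (interval 0 J)))))
      (∑-≤-const {λ j → L ℕ.* f j} 0 J λ {d} d∈ → each d (∈-interval⁻ 0 J d∈) (∈-interval⁻-≤ 0 J d∈))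
      where
      f : ℕ → ℕ
      f j = ∑ (tuples j) λ ds → cnt ds δ 0
      each : ∀ d → 0 ℕ.< d → d ℕ.≤ J → L ℕ.* f d ℕ.≤ suc A ℕ.* n ℕ.^ J
      each (suc d) _ d<J = ℕ.≤-trans (ℕ.≤-reflexive (ℕ.*-comm L (f (suc d)))) (small-bound J d d<J hT)

  /-ι : ∀ m d .{{_ : ℕ.NonZero d}} → ℤ.+ m / d ≡ ι m * inv d
  /-ι m (suc d) = cancel-ι-≡ {suc d} (ℕ.s≤s ℕ.z≤n) (trans
    (subst₂ (λ a b → a * (ℤ.+ m / suc d) ≡ b) (sym (ι≡ (suc d))) (sym (ι≡ m)) concrete)
    (sym (trans (lem (ι (suc d)) (ι m) (inv (suc d))) (trans (cong (ι m *_) (ι*inv {suc d} (ℕ.s≤s ℕ.z≤n))) (*-identityʳ (ι m))))))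
    where
    lem : ∀ a b c → a * (b * c) ≡ b * (a * c)
    lem = solve-∀ ℚ-ring
    concrete : (ℤ.+ suc d / 1) * (ℤ.+ m / suc d) ≡ ℤ.+ m / 1
    concrete = toℚᵘ-injective (ℚᵘ.≃-trans (toℚᵘ-homo-* (ℤ.+ suc d / 1) (ℤ.+ m / suc d))
      (ℚᵘ.≃-trans (ℚᵘ.*-cong (toℚᵘ-fromℚᵘ (ℚᵘ.mkℚᵘ (ℤ.+ suc d) 0)) (toℚᵘ-fromℚᵘ (ℚᵘ.mkℚᵘ (ℤ.+ m) d)))
        (ℚᵘ.≃-trans (ℚᵘ.*≡* (trans (ℤ.*-identityʳ (ℤ.+ suc d ℤ.* ℤ.+ m)) (trans (ℤ.*-comm (ℤ.+ suc d) (ℤ.+ m))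
          (cong (λ x → ℤ.+ m ℤ.* ℤ.+ suc x) (sym (ℕ.+-identityʳ d))))))
          (ℚᵘ.≃-sym (toℚᵘ-fromℚᵘ (ℚᵘ.mkℚᵘ (ℤ.+ m) 0))))))

  2≤harmonic : ∀ {n} → 4 ℕ.≤ n → 2ℚ ≤ harmonic n
  2≤harmonic {n} 4≤n = ≤-trans (begin
    1ℚ + 1ℚ
      ≡⟨ cong (1ℚ +_) (trans (sym (ι*inv {4} (ℕ.s≤s ℕ.z≤n))) (trans (cong (_* y) four) (lem₁ (ι 2) y))) ⟩
    1ℚ + (ι 2 * y + y + y)
      ≤⟨ +-monoʳ-≤ 1ℚ (+-monoˡ-≤ y (+-mono-≤ (≤-reflexive (sym (inv-scale {2} {2} (ℕ.s≤s ℕ.z≤n) (ℕ.s≤s ℕ.z≤n))))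
           (inv-antimono {3} {4} (ℕ.s≤s ℕ.z≤n) (ℕ.n≤1+n 3)))) ⟩
    1ℚ + (inv 2 + inv 3 + y)
      ≡⟨ trans (lem₂ (inv 2) (inv 3) y) (cong (λ a → 0ℚ + a + inv 2 + inv 3 + y) (sym inv-1)) ⟩
    harmonic 4 ∎) (harmonic-mono 4≤n)
    where
    open ≤-Reasoning
    y = inv 4
    four : ι 4 ≡ ι 2 + 1ℚ + 1ℚ
    four = trans (ι-+ 2 2) (trans (cong (ι 2 +_) (trans (ι-suc 1) (cong (1ℚ +_) ι-1))) (sym (+-assoc (ι 2) 1ℚ 1ℚ)))
    lem₁ : ∀ a y → (a + 1ℚ + 1ℚ) * y ≡ a * y + y + y
    lem₁ = solve-∀ ℚ-ring
    lem₂ : ∀ a b y → 1ℚ + (a + b + y) ≡ 0ℚ + 1ℚ + a + b + y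
    lem₂ = solve-∀ ℚ-ring

  ∏-pos : ∀ n (f : ℕ → ℕ) → (∀ j → j ℕ.< n → 1 ℕ.≤ f j) → 1 ℕ.≤ ∏[ n ] f
  ∏-pos zero    f h = ℕ.≤-refl
  ∏-pos (suc n) f h = ℕ.*-mono-≤ (∏-pos n f λ j j<n → h j (ℕ.m<n⇒m<1+n j<n)) (h n ℕ.≤-refl)

  -- Constants and assembly.

  module Asymptotics {μ k ℓ a} (strict : Strict μ) (form : HasForm μ k ℓ a) where
    open Pattern strict form

    -- Q = 2 (k + 1) + 1 is the exponent of L in T² L, and A makes T² L ≤ A n. `C₁` bounds the
    -- rounding in the forced pair and `C₃` the sum of the sizes up to rank c. In `C₄`, 1 is for the
    -- tail and `suc A` for each of the `J` smaller numbers of sizes.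
    Δ Q A C₁ C₃ C₄ D C₂ C J : ℕ
    J = ℓ ℕ.+ c ∸ 1
    Δ = ∏[ c ] (λ j → c ∸ a j ∸ j)
    Q = 2 ℕ.* (ℓ ℕ.+ c) ℕ.+ 3
    A = Q ℕ.^ Q ℕ.* 2
    C₁ = suc c ℕ.* suc c ℕ.* (ℓ ℕ.+ c) ℕ.* A
    C₃ = c ℕ.* suc c ℕ.* A
    C₄ = 1 ℕ.+ J ℕ.* suc A
    D = ℓ ℕ.! ℕ.* J ℕ.! ℕ.* Δ
    C₂ = suc J ℕ.* (ℓ ℕ.! ℕ.* (C₃ ℕ.+ ℓ)) ℕ.+ C₁ ℕ.+ (Δ ℕ.* (ℓ ℕ.* (2 ℕ.* c) ℕ.+ c) ℕ.+ ℓ ℕ.* ℓ)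
    C = C₁ ℕ.+ D ℕ.* C₄ ℕ.+ C₂

    1≤Δ : 1 ℕ.≤ Δ
    1≤Δ = ∏-pos c _ λ j j<c → subst (0 ℕ.<_) (sym (ℕ.∸-+-assoc c (a j) j)) (ℕ.m<n⇒0<n∸m (factor-positive strict form j j<c))

    1≤D : 1 ℕ.≤ D
    1≤D = ℕ.*-mono-≤ (ℕ.*-mono-≤ (ℕ.1≤n! ℓ) (ℕ.1≤n! J)) 1≤Δ

    D≡ : D ≡ denominator k ℓ a
    D≡ = cong (λ m → ℓ ℕ.! ℕ.* (m ∸ 1) ℕ.! ℕ.* Δ) ℓ+c≡k

    K : ℚ
    K = 2ℚ * power 2ℚ ℓ * ι C + ι (geometric ℓ)

    -- n ≥ 2 ^ A forces A < L, hence T ≤ n; n ≥ 4 gives a harmonic number of at least 2.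
    n₀ : ℕ
    n₀ = 2 ℕ.^ A ℕ.+ 4

    module At (n : ℕ) (2^A≤n : 2 ℕ.^ A ℕ.≤ n) (4≤n : 4 ℕ.≤ n) where

      1≤n : 1 ℕ.≤ n
      1≤n = ℕ.≤-trans (ℕ.s≤s ℕ.z≤n) 4≤n

      L : ℕ
      L = proj₁ (binary-length n 1≤n)

      n<2^L : n ℕ.< 2 ℕ.^ L
      n<2^L = proj₁ (proj₂ (binary-length n 1≤n))

      2^L≤2n : 2 ℕ.^ L ℕ.≤ 2 ℕ.* n
      2^L≤2n = proj₂ (proj₂ (binary-length n 1≤n))

      A<L : A ℕ.< L
      A<L = ℕ.≰⇒> λ L≤A → ℕ.<⇒≱ (ℕ.<-≤-trans n<2^L (ℕ.^-monoʳ-≤ 2 L≤A)) 2^A≤n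

      1≤L : 1 ℕ.≤ L
      1≤L = ℕ.≤-trans (ℕ.s≤s ℕ.z≤n) A<L

      instance
        L≢0 : ℕ.NonZero L
        L≢0 = ℕ.>-nonZero 1≤L

      -- The exponent k + 1 covers all powers of L to be absorbed: c + 1 for the cutoff and k - 1
      -- for the tail and the smaller numbers of sizes.
      T : ℕ
      T = L ℕ.^ suc (ℓ ℕ.+ c)

      1≤T : 1 ℕ.≤ T
      1≤T = ℕ.m^n>0 L (suc (ℓ ℕ.+ c))

      power-L≤T : ∀ {i} → i ℕ.≤ suc (ℓ ℕ.+ c) → L ℕ.^ i ℕ.≤ T
      power-L≤T h = ℕ.^-monoʳ-≤ L h

      TTL≤ : T ℕ.* T ℕ.* L ℕ.≤ A ℕ.* n
      TTL≤ = begin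
        T ℕ.* T ℕ.* L  ≡⟨ cong (ℕ._* L) (ℕ.^-distribˡ-+-* L m m) ⟨
        L ℕ.^ (m ℕ.+ m) ℕ.* L  ≡⟨ ℕ.*-comm _ L ⟩
        L ℕ.^ suc (m ℕ.+ m)  ≡⟨ cong (L ℕ.^_) (lem (ℓ ℕ.+ c)) ⟩
        L ℕ.^ suc q  ≤⟨ polynomial-≤-exponential q L ⟩
        suc q ℕ.^ suc q ℕ.* 2 ℕ.^ L  ≤⟨ ℕ.*-monoʳ-≤ (suc q ℕ.^ suc q) 2^L≤2n ⟩
        suc q ℕ.^ suc q ℕ.* (2 ℕ.* n)  ≡⟨ cong (λ Q → Q ℕ.^ Q ℕ.* (2 ℕ.* n)) (sym (ℕ.+-suc (2 ℕ.* (ℓ ℕ.+ c)) 2)) ⟩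
        Q ℕ.^ Q ℕ.* (2 ℕ.* n)  ≡⟨ ℕ.*-assoc (Q ℕ.^ Q) 2 n ⟨
        A ℕ.* n  ∎
        where
        open ℕ.≤-Reasoning
        m = suc (ℓ ℕ.+ c)
        q = 2 ℕ.* (ℓ ℕ.+ c) ℕ.+ 2
        lem : ∀ x → suc (suc x ℕ.+ suc x) ≡ suc (2 ℕ.* x ℕ.+ 2)
        lem = ℕ-Solver.solve-∀

      1≤A : 1 ℕ.≤ A
      1≤A = ℕ.*-mono-≤ (ℕ.m^n>0 Q {{ℕ.>-nonZero (ℕ.≤-trans (ℕ.s≤s ℕ.z≤n) (ℕ.m≤n+m 3 (2 ℕ.* (ℓ ℕ.+ c))))}} Q) (ℕ.s≤s {n = 1} ℕ.z≤n)

      T≤TT : T ℕ.≤ T ℕ.* T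
      T≤TT = ℕ.m≤m*n T T {{ℕ.>-nonZero 1≤T}}

      -- A T² ≤ L T² ≤ A n, and T ≤ T².
      T≤n : T ℕ.≤ n
      T≤n = ℕ.≤-trans T≤TT (ℕ.*-cancelˡ-≤ A {{ℕ.>-nonZero 1≤A}} (ℕ.≤-trans (ℕ.≤-reflexive (ℕ.*-comm A (T ℕ.* T)))
        (ℕ.≤-trans (ℕ.*-monoʳ-≤ (T ℕ.* T) (ℕ.<⇒≤ A<L)) TTL≤)))

      T+c≤ : T ℕ.+ c ℕ.≤ suc c ℕ.* T
      T+c≤ = ℕ.+-monoʳ-≤ T (ℕ.m≤m*n c T {{ℕ.>-nonZero 1≤T}})

      W≤ : (T ℕ.+ c) ℕ.* (T ℕ.+ c) ℕ.* (ℓ ℕ.+ c) ℕ.* L ℕ.≤ C₁ ℕ.* n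
      W≤ = begin
        (T ℕ.+ c) ℕ.* (T ℕ.+ c) ℕ.* (ℓ ℕ.+ c) ℕ.* L
          ≤⟨ ℕ.*-monoˡ-≤ L (ℕ.*-monoˡ-≤ (ℓ ℕ.+ c) (ℕ.*-mono-≤ T+c≤ T+c≤)) ⟩
        suc c ℕ.* T ℕ.* (suc c ℕ.* T) ℕ.* (ℓ ℕ.+ c) ℕ.* L
          ≡⟨ lem (suc c) T (ℓ ℕ.+ c) L ⟩
        suc c ℕ.* suc c ℕ.* (ℓ ℕ.+ c) ℕ.* (T ℕ.* T ℕ.* L)
          ≤⟨ ℕ.*-monoʳ-≤ (suc c ℕ.* suc c ℕ.* (ℓ ℕ.+ c)) TTL≤ ⟩
        suc c ℕ.* suc c ℕ.* (ℓ ℕ.+ c) ℕ.* (A ℕ.* n)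
          ≡⟨ ℕ.*-assoc (suc c ℕ.* suc c ℕ.* (ℓ ℕ.+ c)) A n ⟨
        C₁ ℕ.* n ∎
        where
        open ℕ.≤-Reasoning
        lem : ∀ s T k L → s ℕ.* T ℕ.* (s ℕ.* T) ℕ.* k ℕ.* L ≡ s ℕ.* s ℕ.* k ℕ.* (T ℕ.* T ℕ.* L)
        lem = ℕ-Solver.solve-∀

      Y≤ : c ℕ.* (T ℕ.+ c) ℕ.* L ℕ.≤ C₃ ℕ.* n
      Y≤ = begin
        c ℕ.* (T ℕ.+ c) ℕ.* L  ≤⟨ ℕ.*-monoˡ-≤ L (ℕ.*-monoʳ-≤ c (ℕ.≤-trans T+c≤ (ℕ.*-monoʳ-≤ (suc c) T≤TT))) ⟩
        c ℕ.* (suc c ℕ.* (T ℕ.* T)) ℕ.* L  ≡⟨ lem c (suc c) (T ℕ.* T) L ⟩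
        c ℕ.* suc c ℕ.* (T ℕ.* T ℕ.* L)  ≤⟨ ℕ.*-monoʳ-≤ (c ℕ.* suc c) TTL≤ ⟩
        c ℕ.* suc c ℕ.* (A ℕ.* n)  ≡⟨ ℕ.*-assoc (c ℕ.* suc c) A n ⟨
        C₃ ℕ.* n  ∎
        where
        open ℕ.≤-Reasoning
        lem : ∀ c s T L → c ℕ.* (s ℕ.* T) ℕ.* L ≡ c ℕ.* s ℕ.* (T ℕ.* L)
        lem = ℕ-Solver.solve-∀

      H≤L : harmonic n ≤ ι L
      H≤L = harmonic-≤ L n<2^L

      B : ℕ → ℕ
      B = cutoff c T n

      B-low : ∀ {i} → i ℕ.≤ c → B i ≡ T
      B-low = cutoff-low {c} {T} {n}

      B-high : ∀ {i} → c ℕ.< i → B i ≡ n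
      B-high = cutoff-high {c} {T} {n}

      P≡ : Prefix.P free B n T c B-low free-c T≤n 1≤T ≡ inv Δ
      P≡ = Denominator.P≡ free B n T c B-low free-c T≤n 1≤T a a-step (a<c 0) free⇒a a⇒free

      open Combine free B n T c ℓ B-low B-high 0<c free-c free-high T≤n 1≤T Δ 1≤Δ P≡ L C₁ C₃ H≤L 1≤L
                   (power-L≤T (ℕ.s≤s (ℕ.m≤n+m c ℓ))) W≤ Y≤
        using (main-≤; main-≥)

      open Counts μ strict c ℓ parts≤ top free free-true free-false 0<c free-c n 1≤n T (Av-enumeration μ n)
        using (mainCount; tailCount; smallCount; avoiders-≤; avoiders-≥)
      open Errors n L T A 1≤n 1≤L 1≤T (R-≤ n L H≤L) TTL≤

      errors : ℕ
      errors = tailCount c ℕ.+ smallCount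

      private
        J≤ : J ℕ.≤ suc (ℓ ℕ.+ c)
        J≤ = ℕ.≤-trans (ℕ.m∸n≤m (ℓ ℕ.+ c) 1) (ℕ.n≤1+n (ℓ ℕ.+ c))

        tail≤ : ∀ c′ → c′ ≡ c → tailCount c′ ℕ.* L ℕ.≤ n ℕ.^ J
        tail≤ zero          _ = ℕ.z≤n
        tail≤ (suc zero)    _ = ℕ.z≤n
        tail≤ (suc (suc c′)) e = subst (λ m → tailCount (suc (suc c′)) ℕ.* L ℕ.≤ n ℕ.^ m) J≡
          (tail-bound ℓ c′ (tailCount (suc (suc c′))) (Counting.∑-tail-≤ n T (n ∸ T) ℓ c′) (power-L≤T (subst (ℕ._≤ suc (ℓ ℕ.+ c)) (sym J≡) J≤)))
          where
          J≡ : suc (ℓ ℕ.+ c′) ≡ J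
          J≡ = trans (cong (_∸ 1) (sym (trans (ℕ.+-suc ℓ (suc c′)) (cong suc (ℕ.+-suc ℓ c′))))) (cong (λ x → ℓ ℕ.+ x ∸ 1) e)

      errors≤ : errors ℕ.* L ℕ.≤ C₄ ℕ.* n ℕ.^ J
      errors≤ = ℕ.≤-trans (ℕ.≤-reflexive (ℕ.*-distribʳ-+ L (tailCount c) smallCount))
        (ℕ.≤-trans (ℕ.+-mono-≤ (tail≤ c refl) (smalls-bound J (power-L≤T J≤)))
          (ℕ.≤-reflexive (lem (n ℕ.^ J) J A)))
        where
        lem : ∀ x J A → x ℕ.+ J ℕ.* (suc A ℕ.* x) ≡ (1 ℕ.+ J ℕ.* suc A) ℕ.* x
        lem = ℕ-Solver.solve-∀

      H h α Nj : ℚ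
      H = harmonic n
      h = power H ℓ
      α = ι (∣Av∣ μ n)
      Nj = ι (n ℕ.^ J)

      2≤H : 2ℚ ≤ H
      2≤H = 2≤harmonic 4≤n

      1≤H : 1ℚ ≤ H
      1≤H = ≤-trans (≤-by 1ℚ 0≤1 refl) 2≤H

      0≤Nj : 0ℚ ≤ Nj
      0≤Nj = 0≤ι (n ℕ.^ J)

      0≤H : 0ℚ ≤ H
      0≤H = ≤-trans 0≤1 1≤H

      0≤h : 0ℚ ≤ h
      0≤h = power-nonNeg ℓ 0≤H

      errors-H : ι errors * H ≤ Nj * (h * ι C₄)
      errors-H = begin
        ι errors * H  ≤⟨ *-mono-left (0≤ι errors) H≤L ⟩
        ι errors * ι L  ≡⟨ ι-* errors L ⟨
        ι (errors ℕ.* L)  ≤⟨ ι-mono errors≤ ⟩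
        ι (C₄ ℕ.* n ℕ.^ J)  ≡⟨ trans (ι-* C₄ (n ℕ.^ J)) (lem₁ (ι C₄) Nj) ⟩
        1ℚ * (Nj * ι C₄)  ≤⟨ *-mono-right (*-nonNeg 0≤Nj (0≤ι C₄)) (1≤power ℓ 1≤H) ⟩
        h * (Nj * ι C₄)  ≡⟨ lem₂ h Nj (ι C₄) ⟩
        Nj * (h * ι C₄)  ∎
        where
        open ≤-Reasoning
        lem₁ : ∀ a b → a * b ≡ 1ℚ * (b * a)
        lem₁ = solve-∀ ℚ-ring
        lem₂ : ∀ a b c → a * (b * c) ≡ b * (a * c)
        lem₂ = solve-∀ ℚ-ring

      C≡ : ι C ≡ ι C₁ + ι D * ι C₄ + ι C₂
      C≡ = trans (ι-+ (C₁ ℕ.+ D ℕ.* C₄) C₂) (cong (_+ ι C₂) (trans (ι-+ C₁ (D ℕ.* C₄)) (cong (ι C₁ +_) (ι-* D C₄))))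

      q : ℚ
      q = Nj * inv D

      D*q : ∀ x → ι D * (q * x) ≡ Nj * x
      D*q x = trans (lem (ι D) Nj (inv D) x) (trans (cong (_* (Nj * x)) (ι*inv 1≤D)) (*-identityˡ (Nj * x)))
        where
        lem : ∀ D N d x → D * (N * d * x) ≡ D * d * (N * x)
        lem = solve-∀ ℚ-ring

      upper : α * H ≤ q * (h * (H + ι C))
      upper = cancel-ι 1≤D (begin
        ι D * (α * H)
          ≤⟨ *-mono-left (0≤ι D) (*-mono-right 0≤H (ι-mono (ℕ.≤-trans avoiders-≤ (ℕ.≤-reflexive (ℕ.+-assoc mainCount (tailCount c) smallCount))))) ⟩
        ι D * (ι (mainCount ℕ.+ errors) * H)
          ≡⟨ trans (cong (λ x → ι D * (x * H)) (ι-+ mainCount errors)) (lem₁ (ι D) (ι mainCount) (ι errors) H) ⟩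
        ι D * ι mainCount * H + ι D * (ι errors * H)
          ≤⟨ +-mono-≤ main-≤ (*-mono-left (0≤ι D) errors-H) ⟩
        Nj * (h * (H + ι C₁)) + ι D * (Nj * (h * ι C₄))
          ≤⟨ ≤-by (Nj * (h * ι C₂)) (*-nonNeg 0≤Nj (*-nonNeg 0≤h (0≤ι C₂))) (lem₂ Nj h H (ι C₁) (ι D) (ι C₄) (ι C₂)) ⟩
        Nj * (h * (H + (ι C₁ + ι D * ι C₄ + ι C₂)))
          ≡⟨ cong (λ x → Nj * (h * (H + x))) C≡ ⟨
        Nj * (h * (H + ι C))
          ≡⟨ D*q (h * (H + ι C)) ⟨
        ι D * (q * (h * (H + ι C))) ∎)
        where
        open ≤-Reasoning
        lem₁ : ∀ D m e H → D * ((m + e) * H) ≡ D * m * H + D * (e * H)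
        lem₁ = solve-∀ ℚ-ring
        lem₂ : ∀ N h H a D b c → N * (h * (H + a)) + D * (N * (h * b)) + N * (h * c) ≡ N * (h * (H + (a + D * b + c)))
        lem₂ = solve-∀ ℚ-ring

      lower : q * (h * H) ≤ α * H + q * (h * ι C)
      lower = cancel-ι 1≤D (begin
        ι D * (q * (h * H))
          ≡⟨ D*q (h * H) ⟩
        Nj * (h * H)
          ≤⟨ main-≥ ⟩
        ι D * ι mainCount * H + Nj * (h * ι C₂)
          ≤⟨ +-mono-≤ (*-mono-right 0≤H (*-mono-left (0≤ι D) (ι-mono avoiders-≥)))
               (*-mono-left 0≤Nj (*-mono-left 0≤h (ι-mono (ℕ.m≤n+m C₂ (C₁ ℕ.+ D ℕ.* C₄))))) ⟩
        ι D * α * H + Nj * (h * ι C)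
          ≡⟨ cong₂ _+_ (*-assoc (ι D) α H) (sym (D*q (h * ι C))) ⟩
        ι D * (α * H) + ι D * (q * (h * ι C))
          ≡⟨ *-distribˡ-+ (ι D) (α * H) (q * (h * ι C)) ⟨
        ι D * (α * H + q * (h * ι C)) ∎)
        where open ≤-Reasoning

      -- Holds for each single partial sum because, from index n on, all of them lie within 1 of the
      -- harmonic number.
      approximation : ∀ m → n ℕ.≤ m → let s = mercatorSum (1ℚ - inv n) m in
                      ∣ α - q * power s ℓ ∣ * s ≤ K * (q * power s ℓ)
      approximation m n≤m = Perturb.conclude {H} {mercatorSum (1ℚ - inv n) m} 2≤H (mercator-≥ m n≤m) (mercator-≤ m n≤m)
        ℓ {α} {q} {ι C} (*-nonNeg 0≤Nj (0≤inv D)) (0≤ι C) upper lower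
        where open Mercator n 1≤n

    approximation : ∀ n .{{_ : ℕ.NonZero n}} .{{_ : ℕ.NonZero (denominator k ℓ a)}} → n₀ ℕ.≤ n → ∀ m → n ℕ.≤ m →
      let q = ℤ.+ (n ℕ.^ (k ∸ 1)) / denominator k ℓ a
          s = approx (log n) m
      in ∣ ℤ.+ ∣Av∣ μ n / 1 - q * power s ℓ ∣ * s ≤ K * (q * power s ℓ)
    approximation n@(suc n′) n₀≤n m n≤m = transport (ι≡ (∣Av∣ μ n)) q≡ (cong (λ r → mercatorSum (1ℚ - r) m) (inv≡ n′))
      (At.approximation n (ℕ.m+n≤o⇒m≤o (2 ℕ.^ A) n₀≤n) (ℕ.m+n≤o⇒n≤o (2 ℕ.^ A) n₀≤n) m n≤m)
      where
      transport : ∀ {α α′ q q′ s s′} → α ≡ α′ → q ≡ q′ → s ≡ s′ →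
        ∣ α - q * power s ℓ ∣ * s ≤ K * (q * power s ℓ) → ∣ α′ - q′ * power s′ ℓ ∣ * s′ ≤ K * (q′ * power s′ ℓ)
      transport refl refl refl h = h
      q≡ : ι (n ℕ.^ J) * inv D ≡ ℤ.+ (n ℕ.^ (k ∸ 1)) / denominator k ℓ a
      q≡ = trans (cong₂ (λ i d → ι (n ℕ.^ (i ∸ 1)) * inv d) ℓ+c≡k D≡) (sym (/-ι (n ℕ.^ (k ∸ 1)) (denominator k ℓ a)))

open import Data.Nat.Base as ℕ using (ℕ; zero; suc; NonZero; _∸_)
open import Data.Integer.Base using (+_)
open import Data.Product.Base using (∃-syntax; _,_)
open import Data.Rational.Base as ℚ using (ℚ; _/_)
import Data.Rational.Properties as ℚ
open import Relation.Nullary using (¬_)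
open import Relation.Binary.PropositionalEquality using (_≡_; refl; cong; sym; subst)
open import Defs
open RationalEstimates using (module Asymptotics)

-- Transfer to the reals.

approx-^ : ∀ x ℓ m → approx (x ^ ℓ) m ≡ power (approx x m) ℓ
approx-^ x zero    m = refl
approx-^ x (suc ℓ) m = cong (approx x m ℚ.*_) (approx-^ x ℓ m)

-- Comparison of reals asks for eventual inequality of the approximants up to ε; here it holds
-- without ε from a fixed index on.
bound-from-approximations : ∀ {N : ℕ} {q K : ℚ} {L : ℝ} {ℓ} n₁ →
  (∀ m → n₁ ℕ.≤ m → let s = approx L m in
    ℚ.∣ + N / 1 ℚ.- q ℚ.* power s ℓ ∣ ℚ.* s ℚ.≤ K ℚ.* (q ℚ.* power s ℓ)) →
  ∣ fromℕ N - fromℚ q * L ^ ℓ ∣ * L ≤ fromℚ K * (fromℚ q * L ^ ℓ)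
bound-from-approximations {N} {q} {K} {L} {ℓ} n₁ h ε ε>0 = n₁ , λ m n₁≤m →
  subst (λ t → ℚ.∣ + N / 1 ℚ.- q ℚ.* t ∣ ℚ.* approx L m ℚ.≤ K ℚ.* (q ℚ.* t) ℚ.+ ε) (sym (approx-^ L ℓ m))
    (ℚ.≤-trans (h m n₁≤m) (subst (ℚ._≤ y m ℚ.+ ε) (ℚ.+-identityʳ (y m)) (ℚ.+-monoʳ-≤ (y m) (ℚ.<⇒≤ ε>0))))
  where
  y : ℕ → ℚ
  y m = K ℚ.* (q ℚ.* power (approx L m) ℓ)

mainTheorem19 :
    (μ : Partition) (strict : Strict μ) → ¬ IsStaircase μ →
    (k ℓ : ℕ) (a : ℕ → ℕ) (form : HasForm μ k ℓ a) →
    let instance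
          denominator≢0 : NonZero (denominator k ℓ a)
          denominator≢0 = denominator-nonZero strict form

        leadingTerm : (n : ℕ) .{{_ : NonZero n}} → ℝ
        leadingTerm n =
          fromℚ (+ (n ℕ.^ (k ∸ 1)) / denominator k ℓ a) * log n ^ ℓ
    in
    -- |Av_n(μ)| = leadingTerm n · (1 + O(1 / log n))
    ∃[ K ] ∃[ n₀ ] ((n : ℕ) .{{_ : NonZero n}} → n₀ ℕ.≤ n →
      ∣ fromℕ (∣Av∣ μ n) - leadingTerm n ∣ * log n ≤ K * leadingTerm n)
mainTheorem19 μ strict _ k ℓ a form = fromℚ K , n₀ , λ n n₀≤n →
  -- The fixed index is n itself, where the partial sums of Mercator's series come within 1 of the
  -- harmonic number.
  bound-from-approximations {∣Av∣ μ n} {+ (n ℕ.^ (k ∸ 1)) / denominator k ℓ a} {K} {log n} {ℓ} n (approximation n n₀≤n)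
  where
  open Asymptotics strict form using (K; n₀; approximation)
  instance
    denominator≢0 : NonZero (denominator k ℓ a)
    denominator≢0 = denominator-nonZero strict form
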